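{- Let $F\subseteq K$ be an arbitrary field extension. Then each of $\mathrm{rr}(F^\times)$ and $\mathrm{rr}(K^\times/F^\times)$ is either $0$ or infinite.
   Context: For a commutative group $A$, the rational rank $\mathrm{rr}(A)$ is the cardinality of a maximal $\mathbb{Z}$-linearly independent subset of $A$; equivalently, $\mathrm{rr}(A)=\dim_{\mathbb{Q}}(A\otimes_{\mathbb{Z}}\mathbb{Q})$. -}

module Defs where

open import Level using (Level; _⊔_; suc)
open import Data.Nat.Base using (ℕ)
open import Data.Fin.Base using (Fin)
open import Data.Integer.Base using (ℤ; +_; -[1+_]; 0ℤ)
open import Data.Product.Base using (Σ; ∃-syntax; _×_; _,_; proj₁; proj₂)
open import Data.Sum.Base using (_⊎_)
open import Algebra.Bundles using (CommutativeRing; AbelianGroup)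
open import Algebra.Definitions using (Invertible)
open import Algebra.Morphism.Structures using (module GroupMorphisms; module RingMorphisms)
import Algebra.Definitions.RawMonoid as RawMonoidDefs
import Algebra.Properties.AbelianGroup as AbelianGroupProperties
import Algebra.Properties.CommutativeSemigroup as CommutativeSemigroupProperties
open import Function.Bundles using (Bijection)
open import Function.Definitions using (Injective)
open import Relation.Binary.Bundles using (Setoid)
import Relation.Binary.Construct.On as On
open import Relation.Binary.PropositionalEquality.Core using (_≡_)
import Relation.Binary.PropositionalEquality.Properties as ≡
import Relation.Binary.Reasoning.Setoid as SetoidReasoning
open import Relation.Nullary.Negation.Core using (¬_)
open import Relation.Unary using (Pred; _∈_; _⊆_)

private
  variable
    c ℓ c₁ ℓ₁ c₂ ℓ₂ a b : Level

module _ (A : AbelianGroup c ℓ) where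
  open AbelianGroup A
  open RawMonoidDefs rawMonoid using (sum) renaming (_×_ to _·ℕ_)

  infixr 8 _·_

  _·_ : ℤ → Carrier → Carrier
  (+ n)    · x = n ·ℕ x
  -[1+ n ] · x = (ℕ.suc n ·ℕ x) ⁻¹

  -- "Distinct elements" means distinct modulo _≈_.
  Independent : Pred Carrier ℓ → Set (c ⊔ ℓ)
  Independent S =
    ∀ (n : ℕ) (x : Fin n → Carrier) → (∀ i → x i ∈ S) → Injective _≡_ _≈_ x →
    ∀ (k : Fin n → ℤ) → sum (λ i → k i · x i) ≈ ε → ∀ i → k i ≡ 0ℤ

  -- Subsets are not required to respect _≈_, but a maximal independent
  -- one does, since its closure under _≈_ is again independent.
  MaximalIndependent : Pred Carrier ℓ → Set (c ⊔ suc ℓ)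
  MaximalIndependent S =
    Independent S × (∀ (T : Pred Carrier ℓ) → Independent T → S ⊆ T → T ⊆ S)

  subsetSetoid : Pred Carrier ℓ → Setoid (c ⊔ ℓ) ℓ
  subsetSetoid S = On.setoid {B = Σ Carrier S} setoid proj₁

  -- rr(A) = |κ|, the setoid κ standing for a cardinal.
  IsRationalRank : Setoid a b → Set (c ⊔ suc ℓ ⊔ a ⊔ b)
  IsRationalRank κ = ∃[ S ] MaximalIndependent S × Bijection κ (subsetSetoid S)

  RankIs : ℕ → Set (c ⊔ suc ℓ)
  RankIs n = IsRationalRank (≡.setoid (Fin n))

  -- No maximal independent subset is finite.  That some maximal independent
  -- subset exists needs Zorn's lemma, which is not assumed; with excluded
  -- middle alone, an infinite rank in this sense still means that every
  -- finite independent subset extends to a strictly larger finite one.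
  RankInfinite : Set (c ⊔ suc ℓ)
  RankInfinite = ∀ n → ¬ RankIs n

  RankZeroOrInfinite : Set (c ⊔ suc ℓ)
  RankZeroOrInfinite = RankIs 0 ⊎ RankInfinite

module _ (G : AbelianGroup c₁ ℓ₁) (H : AbelianGroup c₂ ℓ₂) where
  private
    module G = AbelianGroup G
    module H = AbelianGroup H
  open GroupMorphisms G.rawGroup H.rawGroup using (IsGroupHomomorphism)

  quotientByImage : (φ : G.Carrier → H.Carrier) → IsGroupHomomorphism φ →
                    AbelianGroup c₂ (c₁ ⊔ ℓ₂)
  quotientByImage φ φ-hom = record
    { Carrier = H.Carrier
    ; _≈_     = _∼_
    ; _∙_     = H._∙_
    ; ε       = H.ε
    ; _⁻¹     = H._⁻¹
    ; isAbelianGroup = record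
      { isGroup = record
        { isMonoid = record
          { isSemigroup = record
            { isMagma = record
              { isEquivalence = record
                { refl  = ≈⇒∼ H.refl
                ; sym   = ∼-sym
                ; trans = ∼-trans
                }
              ; ∙-cong = ∼-cong
              }
            ; assoc = λ x y z → ≈⇒∼ (H.assoc x y z)
            }
          ; identity = (λ x → ≈⇒∼ (H.identityˡ x)) , (λ x → ≈⇒∼ (H.identityʳ x))
          }
        ; inverse = (λ x → ≈⇒∼ (H.inverseˡ x)) , (λ x → ≈⇒∼ (H.inverseʳ x))
        ; ⁻¹-cong = ∼-inv
        }
      ; comm = λ x y → ≈⇒∼ (H.comm x y)
      }
    }
    where
    open IsGroupHomomorphism φ-hom using (homo; ε-homo; ⁻¹-homo)
    open SetoidReasoning H.setoid
    open AbelianGroupProperties H using (⁻¹-∙-comm)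
    open CommutativeSemigroupProperties H.commutativeSemigroup using (interchange)

    _∼_ : H.Carrier → H.Carrier → Set (c₁ ⊔ ℓ₂)
    x ∼ y = ∃[ g ] x H.≈ φ g H.∙ y

    ≈⇒∼ : ∀ {x y} → x H.≈ y → x ∼ y
    ≈⇒∼ {x} {y} x≈y = G.ε , (begin
      x              ≈⟨ x≈y ⟩
      y              ≈⟨ H.identityˡ y ⟨
      H.ε H.∙ y      ≈⟨ H.∙-congʳ ε-homo ⟨
      φ G.ε H.∙ y    ∎)

    ∼-sym : ∀ {x y} → x ∼ y → y ∼ x
    ∼-sym {x} {y} (g , x≈gy) = g G.⁻¹ , (begin
      y                                 ≈⟨ H.identityˡ y ⟨
      H.ε H.∙ y                         ≈⟨ H.∙-congʳ (H.inverseˡ (φ g)) ⟨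
      (φ g H.⁻¹ H.∙ φ g) H.∙ y          ≈⟨ H.assoc _ _ _ ⟩
      φ g H.⁻¹ H.∙ (φ g H.∙ y)          ≈⟨ H.∙-cong (⁻¹-homo g) x≈gy ⟨
      φ (g G.⁻¹) H.∙ x                  ∎)

    ∼-trans : ∀ {x y z} → x ∼ y → y ∼ z → x ∼ z
    ∼-trans {x} {y} {z} (g , x≈gy) (h , y≈hz) = g G.∙ h , (begin
      x                       ≈⟨ x≈gy ⟩
      φ g H.∙ y               ≈⟨ H.∙-congˡ y≈hz ⟩
      φ g H.∙ (φ h H.∙ z)     ≈⟨ H.assoc _ _ _ ⟨
      (φ g H.∙ φ h) H.∙ z     ≈⟨ H.∙-congʳ (homo g h) ⟨
      φ (g G.∙ h) H.∙ z       ∎)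

    ∼-cong : ∀ {x y u v} → x ∼ y → u ∼ v → (x H.∙ u) ∼ (y H.∙ v)
    ∼-cong {x} {y} {u} {v} (g , x≈gy) (h , u≈hv) = g G.∙ h , (begin
      x H.∙ u                          ≈⟨ H.∙-cong x≈gy u≈hv ⟩
      (φ g H.∙ y) H.∙ (φ h H.∙ v)      ≈⟨ interchange _ _ _ _ ⟩
      (φ g H.∙ φ h) H.∙ (y H.∙ v)      ≈⟨ H.∙-congʳ (homo g h) ⟨
      φ (g G.∙ h) H.∙ (y H.∙ v)        ∎)

    ∼-inv : ∀ {x y} → x ∼ y → (x H.⁻¹) ∼ (y H.⁻¹)
    ∼-inv {x} {y} (g , x≈gy) = g G.⁻¹ , (begin
      x H.⁻¹                           ≈⟨ H.⁻¹-cong x≈gy ⟩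
      (φ g H.∙ y) H.⁻¹                 ≈⟨ ⁻¹-∙-comm _ _ ⟨
      φ g H.⁻¹ H.∙ y H.⁻¹              ≈⟨ H.∙-congʳ (⁻¹-homo g) ⟨
      φ (g G.⁻¹) H.∙ y H.⁻¹            ∎)

IsField : CommutativeRing c ℓ → Set (c ⊔ ℓ)
IsField R = ¬ (0# ≈ 1#) × (∀ x → ¬ (x ≈ 0#) → Invertible _≈_ 1# _*_ x)
  where open CommutativeRing R

-- The group of units; over a field, the nonzero elements.
infix 9 _ˣ

_ˣ : CommutativeRing c ℓ → AbelianGroup (c ⊔ ℓ) ℓ
R ˣ = record
  { Carrier = Unit
  ; _≈_     = λ u v → proj₁ u ≈ proj₁ v
  ; _∙_     = λ { (x , x′ , x′x≈1 , xx′≈1) (y , y′ , y′y≈1 , yy′≈1) →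
                  x * y , x′ * y′ , mul-inv x′x≈1 y′y≈1 , mul-inv xx′≈1 yy′≈1 }
  ; ε       = 1# , 1# , *-identityˡ 1# , *-identityˡ 1#
  ; _⁻¹     = λ { (x , x′ , x′x≈1 , xx′≈1) → x′ , x , xx′≈1 , x′x≈1 }
  ; isAbelianGroup = record
    { isGroup = record
      { isMonoid = record
        { isSemigroup = record
          { isMagma = record
            { isEquivalence = record { refl = refl ; sym = sym ; trans = trans }
            ; ∙-cong = *-cong
            }
          ; assoc = λ u v w → *-assoc (proj₁ u) (proj₁ v) (proj₁ w)
          }
        ; identity = (λ u → *-identityˡ (proj₁ u)) , (λ u → *-identityʳ (proj₁ u))
        }
      ; inverse = (λ u → proj₁ (proj₂ (proj₂ u))) , (λ u → proj₂ (proj₂ (proj₂ u)))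
      ; ⁻¹-cong = λ { {_ , _ , x′x≈1 , _} {_ , _ , _ , yy′≈1} x≈y → inv-cong x′x≈1 yy′≈1 x≈y }
      }
    ; comm = λ u v → *-comm (proj₁ u) (proj₁ v)
    }
  }
  where
  open CommutativeRing R
  open SetoidReasoning setoid
  open CommutativeSemigroupProperties *-commutativeSemigroup using (interchange)

  Unit = Σ Carrier (Invertible _≈_ 1# _*_)

  mul-inv : ∀ {x x′ y y′} → x′ * x ≈ 1# → y′ * y ≈ 1# → (x′ * y′) * (x * y) ≈ 1#
  mul-inv x′x≈1 y′y≈1 =
    trans (interchange _ _ _ _) (trans (*-cong x′x≈1 y′y≈1) (*-identityˡ 1#))

  inv-cong : ∀ {x x′ y y′} → x′ * x ≈ 1# → y * y′ ≈ 1# → x ≈ y → x′ ≈ y′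
  inv-cong {x} {x′} {y} {y′} x′x≈1 yy′≈1 x≈y = begin
    x′              ≈⟨ *-identityʳ x′ ⟨
    x′ * 1#         ≈⟨ *-congˡ yy′≈1 ⟨
    x′ * (y * y′)   ≈⟨ *-assoc _ _ _ ⟨
    (x′ * y) * y′   ≈⟨ *-congʳ (*-congˡ x≈y) ⟨
    (x′ * x) * y′   ≈⟨ *-congʳ x′x≈1 ⟩
    1# * y′         ≈⟨ *-identityˡ y′ ⟩
    y′              ∎

-- The inclusion F ⊆ K is given as an injective ring homomorphism.
record FieldExtension (F : CommutativeRing c₁ ℓ₁) (K : CommutativeRing c₂ ℓ₂) :
                      Set (c₁ ⊔ ℓ₁ ⊔ c₂ ⊔ ℓ₂) where
  private
    module F = CommutativeRing F
    module K = CommutativeRing K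
  open RingMorphisms F.rawRing K.rawRing using (IsRingMonomorphism)

  field
    F-isField : IsField F
    K-isField : IsField K
    ι         : F.Carrier → K.Carrier
    ι-mono    : IsRingMonomorphism ι

  open IsRingMonomorphism ι-mono using (⟦⟧-cong; *-homo; 1#-homo)
  open GroupMorphisms (AbelianGroup.rawGroup (F ˣ)) (AbelianGroup.rawGroup (K ˣ))
    using (IsGroupHomomorphism)

  ιˣ : AbelianGroup.Carrier (F ˣ) → AbelianGroup.Carrier (K ˣ)
  ιˣ (x , x′ , x′x≈1 , xx′≈1) = ι x , ι x′ , pres x′x≈1 , pres xx′≈1
    where
    pres : ∀ {y z} → y F.* z F.≈ F.1# → ι y K.* ι z K.≈ K.1#
    pres yz≈1 = K.trans (K.sym (*-homo _ _)) (K.trans (⟦⟧-cong yz≈1) 1#-homo)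

  ιˣ-homomorphism : IsGroupHomomorphism ιˣ
  ιˣ-homomorphism = record
    { isMonoidHomomorphism = record
      { isMagmaHomomorphism = record
        { isRelHomomorphism = record { cong = ⟦⟧-cong }
        ; homo = λ u v → *-homo (proj₁ u) (proj₁ v)
        }
      ; ε-homo = 1#-homo
      }
    ; ⁻¹-homo = λ _ → K.refl
    }

  Kˣ/Fˣ : AbelianGroup (c₂ ⊔ ℓ₂) (c₁ ⊔ ℓ₁ ⊔ ℓ₂)
  Kˣ/Fˣ = quotientByImage (F ˣ) (K ˣ) ιˣ ιˣ-homomorphism

{-# OPTIONS --safe #-}
module Submission where

-- All ranks are shown infinite by extending a finite independent family.
-- If a field contains an element t of infinite multiplicative order, its
-- subring S = ℤ (characteristic 0) or 𝔽ₚ[t] is infinite with finitely many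
-- units, so Euclid's argument yields infinitely many pairwise coprime
-- nonunits of S; these are independent.
--
-- For Kˣ/Fˣ with F not algebraic over a finite field, let no power of a ∈ K
-- lie in F.  Replacing a by a power of it makes it separable over F if it is
-- algebraic, so that there is a field L ⊇ K and b ∈ L, b ≠ a, at which every
-- polynomial over F with root a vanishes (b = 0 when a is
-- transcendental).  Conjugating a relation ∏ (1 + sⱼa)^kⱼ ∈ F gives
-- ∏ ((1 + sⱼa) / (1 + sⱼb))^kⱼ = 1, which for kₙ ≠ 0 makes 1 + sₙa divide, in
-- S[a, b], a power of the product z of a - b with all 1 + sⱼa and 1 + sⱼb,
-- j < n.  Eliminating b and then a shows that some s ∈ S has 1 + sa dividing
-- no power of a given z ≠ 0, and sₙ is chosen in this way.

open import Defs
open import Algebra.Bundles using (AbelianGroup; CommutativeRing)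
import Algebra.Properties.AbelianGroup as AbelianGroupProperties
import Algebra.Properties.CommutativeMonoid.Mult as CommutativeMonoidMult
import Algebra.Properties.CommutativeMonoid.Sum as CommutativeMonoidSum
import Algebra.Properties.CommutativeSemigroup as CommutativeSemigroupProperties
import Algebra.Properties.CommutativeSemiring.Exp as Exp
import Algebra.Properties.Group as GroupProperties
import Algebra.Properties.Ring as RingProperties
import Algebra.Properties.Semiring.Mult as SemiringMult
import Algebra.Properties.Semiring.Mult.TCOptimised as SemiringMult′
import Algebra.Solver.Ring
open import Algebra.Morphism.Structures using (module RingMorphisms)
open import Algebra.Solver.Ring.AlmostCommutativeRing using (fromCommutativeRing; _-Raw-AlmostCommutative⟶_)
open import Axiom.ExcludedMiddle using (ExcludedMiddle)
open import Data.Empty using (⊥; ⊥-elim)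
open import Data.Fin.Base using (Fin; zero; suc; toℕ; fromℕ<; punchIn; punchOut)
import Data.Fin.Properties as Fin
open import Data.Integer.Base as ℤ using (ℤ; +_; -[1+_]; _⊖_; 0ℤ; 1ℤ)
import Data.Integer.DivMod as ℤ
import Data.Integer.Properties as ℤ
open import Data.List.Base using (List; []; _∷_; _++_; length; map; lookup; tabulate; cartesianProductWith)
open import Data.List.Membership.Propositional using () renaming (_∈_ to _∈ˡ_)
open import Data.List.Membership.Propositional.Properties using (∈-++⁺ˡ; ∈-++⁺ʳ; ∈-++⁻; ∈-map⁺; ∈-tabulate⁺)
open import Data.List.Properties using (length-map; length-tabulate)
open import Data.List.Relation.Unary.All as All using (All; []; _∷_)
open import Data.List.Relation.Unary.All.Properties using () renaming (map⁺ to All-map⁺)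
open import Data.List.Relation.Unary.Any as Any using (Any; here; there)
import Data.List.Relation.Unary.Any.Properties as Any
open import Data.Maybe.Base using (Maybe; just; nothing)
open import Data.Nat.Base as ℕ using (ℕ; zero; suc; z≤n; s≤s)
open import Data.Nat.Induction using (<-wellFounded)
import Data.Nat.Properties as ℕ
open import Data.Product.Base using (Σ; ∃; ∃-syntax; _×_; _,_; proj₁; proj₂)
open import Data.Sum.Base using (_⊎_; inj₁; inj₂; [_,_]′)
open import Data.Unit.Polymorphic.Base using (⊤; tt)
open import Function.Base using (_∘_; id)
open import Function.Bundles using (module Bijection)
open import Induction.WellFounded using (Acc; acc)
open import Level using (Level; _⊔_; Lift; lift; lower)
open import Relation.Binary.Definitions using (tri<; tri≈; tri>)
open import Relation.Binary.PropositionalEquality.Core as ≡ using (_≡_)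
import Relation.Binary.Reasoning.Setoid as SetoidReasoning
open import Relation.Nullary using (¬_; yes; no)
open import Relation.Unary using (Pred)

-- The overview leaves open the case that Fˣ is torsion. There a relation modulo Fˣ, raised to the
-- order of its right-hand side, becomes a relation in Kˣ, so coprime elements of a small subring of
-- K stay independent modulo Fˣ. If Fˣ has an element of infinite order, S can be placed inside F,
-- but its elements are then trivial in the quotient; this is why the elements 1 + sa take over.
--
-- The obstacle is the right-hand side of a relation modulo Fˣ: it is an arbitrary element of F,
-- unrelated to S. Conjugation removes it, at the price of a second root b. The root b is taken from
-- m / (X - a), m the minimal polynomial of a; this quotient takes the value m'(a) at a, so b ≠ a is
-- guaranteed exactly by separability. In the inseparable case m is a polynomial in X^p, the element
-- a^p has smaller degree, and no power of a^p lies in F, so the replacement ends.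
--
-- The factor a - b belongs to z because 1 + sb is congruent to s(b - a) modulo 1 + sa, and s is
-- prime to 1 + sa.

-- Rational rank by pure closures and Steinitz exchange

module Rank (em : ∀ ℓ → ExcludedMiddle ℓ) {c ℓ : Level} (A : AbelianGroup c ℓ) where
  open AbelianGroup A
  open CommutativeMonoidMult commutativeMonoid using ()
    renaming (_×_ to _·ℕ_; ×-homo-+ to ·-homo-+; ×-assocˡ to ·-assoc; ×-distrib-+ to ·-distrib;
              ×-congʳ to ·-congʳ; ×-congˡ to ·-congˡ)
  open CommutativeMonoidSum commutativeMonoid using (sum; sum-remove)
  open CommutativeSemigroupProperties commutativeSemigroup using (interchange)
  open GroupProperties group using (inverseˡ-unique; ε⁻¹≈ε; ∙-cancelʳ; ⁻¹-involutive)
  open AbelianGroupProperties A using (⁻¹-∙-comm)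
  open SetoidReasoning setoid

  record IsSubgroup {p} (H : Pred Carrier p) : Set (c ⊔ ℓ ⊔ p) where
    field
      resp : ∀ {x y} → x ≈ y → H x → H y
      ε∈   : H ε
      ∙∈   : ∀ {x y} → H x → H y → H (x ∙ y)
      ⁻¹∈  : ∀ {x} → H x → H (x ⁻¹)

    ·ℕ∈ : ∀ n {x} → H x → H (n ·ℕ x)
    ·ℕ∈ zero    Hx = ε∈
    ·ℕ∈ (suc n) Hx = ∙∈ Hx (·ℕ∈ n Hx)

    ·∈ : ∀ k {x} → H x → H (_·_ A k x)
    ·∈ (+ n)    Hx = ·ℕ∈ n Hx
    ·∈ -[1+ n ] Hx = ⁻¹∈ (·ℕ∈ (suc n) Hx)

    sum∈ : ∀ {n} (t : Fin n → Carrier) → (∀ i → H (t i)) → H (sum t)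
    sum∈ {zero}  t Ht = ε∈
    sum∈ {suc n} t Ht = ∙∈ (Ht zero) (sum∈ (t ∘ suc) (Ht ∘ suc))

  data ⟨_⟩ {p} (X : Pred Carrier p) : Pred Carrier (c ⊔ ℓ ⊔ p) where
    gen  : ∀ {x} → X x → ⟨ X ⟩ x
    ε∈   : ⟨ X ⟩ ε
    ∙∈   : ∀ {x y} → ⟨ X ⟩ x → ⟨ X ⟩ y → ⟨ X ⟩ (x ∙ y)
    ⁻¹∈  : ∀ {x} → ⟨ X ⟩ x → ⟨ X ⟩ (x ⁻¹)
    resp : ∀ {x y} → x ≈ y → ⟨ X ⟩ x → ⟨ X ⟩ y

  ⟨⟩-isSubgroup : ∀ {p} (X : Pred Carrier p) → IsSubgroup ⟨ X ⟩
  ⟨⟩-isSubgroup X = record { resp = resp ; ε∈ = ε∈ ; ∙∈ = ∙∈ ; ⁻¹∈ = ⁻¹∈ }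

  ⟨⟩-least : ∀ {p q} {X : Pred Carrier p} {H : Pred Carrier q} → IsSubgroup H →
             (∀ {x} → X x → H x) → ∀ {g} → ⟨ X ⟩ g → H g
  ⟨⟩-least {X = X} {H} H-sub X⊆H = go
    where
    module H = IsSubgroup H-sub
    go : ∀ {g} → ⟨ X ⟩ g → H g
    go (gen Xx)    = X⊆H Xx
    go ε∈          = H.ε∈
    go (∙∈ x y)    = H.∙∈ (go x) (go y)
    go (⁻¹∈ x)     = H.⁻¹∈ (go x)
    go (resp eq x) = H.resp eq (go x)

  ⟨⟩-mono : ∀ {p q} {X : Pred Carrier p} {Y : Pred Carrier q} →
            (∀ {x} → X x → Y x) → ∀ {g} → ⟨ X ⟩ g → ⟨ Y ⟩ g
  ⟨⟩-mono {Y = Y} X⊆Y = ⟨⟩-least (⟨⟩-isSubgroup Y) (gen ∘ X⊆Y)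

  ·-⁻¹ : ∀ n x → n ·ℕ (x ⁻¹) ≈ (n ·ℕ x) ⁻¹
  ·-⁻¹ zero    x = sym ε⁻¹≈ε
  ·-⁻¹ (suc n) x = trans (∙-congˡ (·-⁻¹ n x)) (⁻¹-∙-comm _ _)

  ·-ε : ∀ n → n ·ℕ ε ≈ ε
  ·-ε zero    = refl
  ·-ε (suc n) = trans (identityˡ _) (·-ε n)

  ·-comm : ∀ m n x → m ·ℕ (n ·ℕ x) ≈ n ·ℕ (m ·ℕ x)
  ·-comm m n x = begin
    m ·ℕ (n ·ℕ x)  ≈⟨ ·-assoc x m n ⟩
    (m ℕ.* n) ·ℕ x ≈⟨ ·-congˡ (ℕ.*-comm m n) ⟩
    (n ℕ.* m) ·ℕ x ≈⟨ ·-assoc x n m ⟨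
    n ·ℕ (m ·ℕ x)  ∎

  -- The pure closure of the generated subgroup, that is, the preimage of the ℚ-span of `X` in A ⊗
  -- ℚ. Lying outside it replaces linear independence, so torsion never has to be divided out.
  Cl : ∀ {p} → Pred Carrier p → Pred Carrier (c ⊔ ℓ ⊔ p)
  Cl X g = ∃[ m ] ⟨ X ⟩ (suc m ·ℕ g)

  Cl-gen : ∀ {p} {X : Pred Carrier p} {x} → X x → Cl X x
  Cl-gen Xx = 0 , resp (sym (identityʳ _)) (gen Xx)

  Cl-root : ∀ {p} {X : Pred Carrier p} m {g} → Cl X (suc m ·ℕ g) → Cl X g
  Cl-root m {g} (n , p) = m ℕ.+ n ℕ.* suc m , resp (·-assoc g (suc n) (suc m)) p

  Cl-isSubgroup : ∀ {p} (X : Pred Carrier p) → IsSubgroup (Cl X)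
  Cl-isSubgroup X = record
    { resp = λ { x≈y (m , p) → m , resp (·-congʳ (suc m) x≈y) p }
    ; ε∈   = 0 , resp (sym (identityʳ _)) ε∈
    ; ∙∈   = λ { {x} {y} (m , p) (n , q) → Cl-root m (n , resp
               (begin
                 suc n ·ℕ (suc m ·ℕ x) ∙ suc m ·ℕ (suc n ·ℕ y)
                   ≈⟨ ∙-congˡ (·-comm (suc m) (suc n) y) ⟩
                 suc n ·ℕ (suc m ·ℕ x) ∙ suc n ·ℕ (suc m ·ℕ y)
                   ≈⟨ ·-distrib _ _ (suc n) ⟨
                 suc n ·ℕ (suc m ·ℕ x ∙ suc m ·ℕ y)
                   ≈⟨ ·-congʳ (suc n) (·-distrib x y (suc m)) ⟨
                 suc n ·ℕ (suc m ·ℕ (x ∙ y)) ∎)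
               (∙∈ (·ℕ∈ (suc n) p) (·ℕ∈ (suc m) q))) }
    ; ⁻¹∈  = λ { {x} (m , p) → m , resp (sym (·-⁻¹ (suc m) x)) (⁻¹∈ p) }
    }
    where open IsSubgroup (⟨⟩-isSubgroup X) using (·ℕ∈)

  Cl-least : ∀ {p q} {X : Pred Carrier p} {Y : Pred Carrier q} →
             (∀ {x} → X x → Cl Y x) → ∀ {g} → Cl X g → Cl Y g
  Cl-least {Y = Y} X⊆Cl (m , p) = Cl-root m (⟨⟩-least (Cl-isSubgroup Y) X⊆Cl p)

  Clˡ : List Carrier → Pred Carrier (c ⊔ ℓ)
  Clˡ xs = Cl (_∈ˡ xs)

  Cl-mono : ∀ {xs ys} → (∀ {x} → x ∈ˡ xs → x ∈ˡ ys) → ∀ {g} → Clˡ xs g → Clˡ ys g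
  Cl-mono xs⊆ys = Cl-least (λ x∈xs → Cl-gen (xs⊆ys x∈xs))

  -- The coefficient of `e` is the difference q - p of two naturals kept on opposite sides, which
  -- avoids computing with integer multiples.
  ⟨∷⟩-split : ∀ {e xs g} → ⟨ _∈ˡ (e ∷ xs) ⟩ g →
              ∃[ p ] ∃[ q ] ∃[ h ] ⟨ _∈ˡ xs ⟩ h × g ∙ p ·ℕ e ≈ q ·ℕ e ∙ h
  ⟨∷⟩-split {e} {xs} = ⟨⟩-least {H = H} H-sub λ
    { (here ≡.refl) → 0 , 1 , ε , ε∈ , ∙-congʳ (sym (identityʳ _))
    ; (there {xs = _} x∈xs) → 0 , 0 , _ , gen x∈xs , comm _ _ }
    where
    H : Pred Carrier _
    H g = ∃[ p ] ∃[ q ] ∃[ h ] ⟨ _∈ˡ xs ⟩ h × g ∙ p ·ℕ e ≈ q ·ℕ e ∙ h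
    H-sub : IsSubgroup H
    H-sub = record
      { resp = λ { x≈y (p , q , h , h∈ , eq) → p , q , h , h∈ , trans (∙-congʳ (sym x≈y)) eq }
      ; ε∈   = 0 , 0 , ε , ε∈ , refl
      ; ∙∈   = λ { {x} {y} (p , q , h , h∈ , eq) (p′ , q′ , h′ , h′∈ , eq′) →
          p ℕ.+ p′ , q ℕ.+ q′ , h ∙ h′ , ∙∈ h∈ h′∈ , (begin
            (x ∙ y) ∙ (p ℕ.+ p′) ·ℕ e           ≈⟨ ∙-congˡ (·-homo-+ e p p′) ⟩
            (x ∙ y) ∙ (p ·ℕ e ∙ p′ ·ℕ e)        ≈⟨ interchange _ _ _ _ ⟩
            (x ∙ p ·ℕ e) ∙ (y ∙ p′ ·ℕ e)        ≈⟨ ∙-cong eq eq′ ⟩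
            (q ·ℕ e ∙ h) ∙ (q′ ·ℕ e ∙ h′)       ≈⟨ interchange _ _ _ _ ⟩
            (q ·ℕ e ∙ q′ ·ℕ e) ∙ (h ∙ h′)       ≈⟨ ∙-congʳ (·-homo-+ e q q′) ⟨
            (q ℕ.+ q′) ·ℕ e ∙ (h ∙ h′)          ∎) }
      ; ⁻¹∈  = λ { {x} (p , q , h , h∈ , eq) → q , p , h ⁻¹ , ⁻¹∈ h∈ , (begin
            x ⁻¹ ∙ q ·ℕ e
              ≈⟨ identityʳ _ ⟨
            (x ⁻¹ ∙ q ·ℕ e) ∙ ε
              ≈⟨ ∙-congˡ (inverseʳ h) ⟨
            (x ⁻¹ ∙ q ·ℕ e) ∙ (h ∙ h ⁻¹)
              ≈⟨ trans (assoc _ _ _) (∙-congˡ (sym (assoc _ _ _))) ⟩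
            x ⁻¹ ∙ ((q ·ℕ e ∙ h) ∙ h ⁻¹)
              ≈⟨ ∙-congˡ (∙-congʳ eq) ⟨
            x ⁻¹ ∙ ((x ∙ p ·ℕ e) ∙ h ⁻¹)
              ≈⟨ trans (∙-congˡ (assoc _ _ _)) (sym (assoc _ _ _)) ⟩
            (x ⁻¹ ∙ x) ∙ (p ·ℕ e ∙ h ⁻¹)
              ≈⟨ trans (∙-congʳ (inverseˡ x)) (identityˡ _) ⟩
            p ·ℕ e ∙ h ⁻¹ ∎) }
      }

  cancel-·e : ∀ p r {e g h} → g ∙ p ·ℕ e ≈ (p ℕ.+ r) ·ℕ e ∙ h → g ≈ r ·ℕ e ∙ h
  cancel-·e p r {e} {g} {h} eq = ∙-cancelʳ (p ·ℕ e) _ _ (begin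
    g ∙ p ·ℕ e                 ≈⟨ eq ⟩
    (p ℕ.+ r) ·ℕ e ∙ h         ≈⟨ ∙-congʳ (trans (·-homo-+ e p r) (comm _ _)) ⟩
    (r ·ℕ e ∙ p ·ℕ e) ∙ h      ≈⟨ trans (assoc _ _ _) (trans (∙-congˡ (comm _ _)) (sym (assoc _ _ _))) ⟩
    (r ·ℕ e ∙ h) ∙ p ·ℕ e      ∎)

  solve-for : ∀ {x y z} → x ≈ y ∙ z → y ≈ x ∙ z ⁻¹
  solve-for {x} {y} {z} eq = begin
    y               ≈⟨ identityʳ y ⟨
    y ∙ ε           ≈⟨ ∙-congˡ (inverseʳ z) ⟨
    y ∙ (z ∙ z ⁻¹)  ≈⟨ assoc _ _ _ ⟨
    (y ∙ z) ∙ z ⁻¹  ≈⟨ ∙-congʳ eq ⟨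
    x ∙ z ⁻¹        ∎

  -- In `suc m ·ℕ y` the coefficient q - p of `e` cannot vanish, since `y` would then lie in the
  -- closure of `xs`. Solving for `e`, with either sign of that coefficient, puts a positive
  -- multiple of `e` into the subgroup generated by `y` and `xs`.
  exchange : ∀ {e y xs} → Clˡ (e ∷ xs) y → ¬ Clˡ xs y → Clˡ (y ∷ xs) e
  exchange {e} {y} {xs} (m , my∈) y∉ = case (⟨∷⟩-split my∈)
    where
    open IsSubgroup (⟨⟩-isSubgroup (_∈ˡ (y ∷ xs))) using (·ℕ∈)
    my∈′ : ⟨ _∈ˡ (y ∷ xs) ⟩ (suc m ·ℕ y)
    my∈′ = ·ℕ∈ (suc m) (gen (here ≡.refl))
    case : ∃[ p ] ∃[ q ] ∃[ h ] ⟨ _∈ˡ xs ⟩ h × suc m ·ℕ y ∙ p ·ℕ e ≈ q ·ℕ e ∙ h → Clˡ (y ∷ xs) e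
    case (p , q , h , h∈ , eq) with ℕ.<-cmp p q
    ... | tri≈ _ ≡.refl _ = ⊥-elim (y∉ (m , resp (sym (∙-cancelʳ (p ·ℕ e) _ _ (trans eq (comm _ _)))) h∈))
    ... | tri< p<q _ _ with ℕ.m≤n⇒∃[o]m+o≡n p<q
    ...   | r , ≡.refl = r , resp (sym (solve-for (cancel-·e p (suc r)
              (trans eq (∙-congʳ (·-congˡ (≡.sym (ℕ.+-suc p r))))))))
              (∙∈ my∈′ (⁻¹∈ (⟨⟩-mono there h∈)))
    case (p , q , h , h∈ , eq) | tri> _ _ q<p with ℕ.m≤n⇒∃[o]m+o≡n q<p
    ...   | r , ≡.refl = r , resp (sym (solve-for (cancel-·e q (suc r)
              (trans (comm h _) (trans (sym eq) (trans (comm _ _) (∙-congʳ (·-congˡ (≡.sym (ℕ.+-suc q r))))))))))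
              (∙∈ (⟨⟩-mono there h∈) (⁻¹∈ my∈′))

  -- Linear independence in A ⊗ ℚ built one element at a time, without coefficients, in the form
  -- that the exchange argument consumes.
  data Chain : List Carrier → Set (c ⊔ ℓ) where
    []  : Chain []
    _∷_ : ∀ {y ys} → ¬ Clˡ ys y → Chain ys → Chain (y ∷ ys)

  -- The discarded element is the one whose removal from the front of `rest` first loses `y` from
  -- the closure; it exists because `y` is outside the closure of `xs` alone, and `exchange`
  -- recovers it from `y`.
  replace : ∀ xs rest {y} → Clˡ (xs ++ rest) y → ¬ Clˡ xs y →
            ∃[ rest′ ] length rest ≡ suc (length rest′) ×
                       (∀ {g} → Clˡ (xs ++ rest) g → Clˡ (y ∷ xs ++ rest′) g)
  replace xs [] y∈ y∉ = ⊥-elim (y∉ (Cl-mono ([ id , (λ ()) ]′ ∘ ∈-++⁻ xs) y∈))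
  replace xs (e ∷ r) {y} y∈ y∉ with em _ {Clˡ (xs ++ r) y}
  ... | yes y∈xs++r = let r′ , len , sub = replace xs r y∈xs++r y∉ in
    e ∷ r′ , ≡.cong suc len , Cl-least λ x∈ → [ (λ x∈xs → Cl-gen (there (∈-++⁺ˡ x∈xs)))
      , (λ { (here ≡.refl) → Cl-gen (there (∈-++⁺ʳ xs (here ≡.refl)))
           ; (there x∈r) → Cl-mono
               (λ { (here eq) → here eq
                  ; (there z∈) → there ([ ∈-++⁺ˡ , ∈-++⁺ʳ xs ∘ there ]′ (∈-++⁻ xs z∈)) })
               (sub (Cl-gen (∈-++⁺ʳ xs x∈r))) }) ]′ (∈-++⁻ xs x∈)
  ... | no y∉xs++r = r , ≡.refl , Cl-least λ x∈ → [ (λ x∈xs → Cl-gen (there (∈-++⁺ˡ x∈xs)))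
      , (λ { (here ≡.refl) → exchange (Cl-mono front y∈) y∉xs++r
           ; (there x∈r) → Cl-gen (there (∈-++⁺ʳ xs x∈r)) }) ]′ (∈-++⁻ xs x∈)
    where
    front : ∀ {x} → x ∈ˡ xs ++ e ∷ r → x ∈ˡ e ∷ xs ++ r
    front x∈ = [ there ∘ ∈-++⁺ˡ , (λ { (here eq) → here eq ; (there x∈r) → there (∈-++⁺ʳ xs x∈r) }) ]′
                 (∈-++⁻ xs x∈)

  -- Every element of the chain takes the place of exactly one element of the spanning list, so the
  -- chain cannot be the longer of the two.
  steinitz : ∀ {es} → (∀ g → Clˡ es g) → ∀ {ys} → Chain ys →
             ∃[ rest ] length rest ℕ.+ length ys ≡ length es × (∀ g → Clˡ (ys ++ rest) g)
  steinitz {es} spans []               = es , ℕ.+-identityʳ _ , spans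
  steinitz      spans {y ∷ ys} (y∉ ∷ ch) =
    let rest , len , sp = steinitz spans ch
        rest′ , len′ , sub = replace ys rest (sp y) y∉
    in rest′ , ≡.trans (ℕ.+-suc _ _) (≡.trans (≡.cong (ℕ._+ length ys) (≡.sym len′)) len) ,
       λ g → sub (sp g)

  ·∈⇒≡0 : ∀ {xs g} → ¬ Clˡ xs g → ∀ k → ⟨ _∈ˡ xs ⟩ (_·_ A k g) → k ≡ 0ℤ
  ·∈⇒≡0 g∉ (+ zero)  kg∈ = ≡.refl
  ·∈⇒≡0 g∉ (+ suc n) kg∈ = ⊥-elim (g∉ (n , kg∈))
  ·∈⇒≡0 g∉ -[1+ n ]  kg∈ = ⊥-elim (g∉ (n , resp (⁻¹-involutive _) (⁻¹∈ kg∈)))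

  ·-congᶻ : ∀ k {x y} → x ≈ y → _·_ A k x ≈ _·_ A k y
  ·-congᶻ (+ n)    x≈y = ·-congʳ n x≈y
  ·-congᶻ -[1+ n ] x≈y = ⁻¹-cong (·-congʳ (suc n) x≈y)

  -- Maximality turns into spanning: an element `g` outside the closure could be added to `S`
  -- without losing independence, hence would already belong to `S`, which lies in the subgroup
  -- generated by `es`.
  RankIs⇒spanning : ∀ {n} → RankIs A n → ∃[ es ] length es ≡ n × (∀ g → Clˡ es g)
  RankIs⇒spanning {n} (S , (indep , maximal) , bij) = es , length-tabulate e , spans
    where
    open Bijection bij using (to; strictlySurjective)
    e : Fin n → Carrier
    e j = proj₁ (to j)
    es : List Carrier
    es = tabulate e
    open IsSubgroup (⟨⟩-isSubgroup (_∈ˡ es)) using (·∈; sum∈)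

    S⊆⟨es⟩ : ∀ {x} → S x → ⟨ _∈ˡ es ⟩ x
    S⊆⟨es⟩ {x} Sx = let j , eq = strictlySurjective (x , Sx) in resp eq (gen (∈-tabulate⁺ j))

    module _ (g : Carrier) (g∉ : ¬ Clˡ es g) where
      T : Pred Carrier ℓ
      T y = S y ⊎ y ≈ g

      T-indep : Independent A T
      T-indep m x x∈T inj k eq i with em _ {∃[ i₀ ] x i₀ ≈ g}
      ... | no ∄ = indep m x (λ j → [ id , (λ x≈g → ⊥-elim (∄ (j , x≈g))) ]′ (x∈T j)) inj k eq i
      -- By injectivity `i₀` is the only index in the class of `g`. Its coefficient vanishes because
      -- no nonzero multiple of `g` lies in the subgroup generated by `es`, and what remains is a
      -- relation in `S`.
      T-indep (suc m) x x∈T inj k eq i | yes (i₀ , xi₀≈g) = all0 i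
        where
        t : Fin (suc m) → Carrier
        t j = _·_ A (k j) (x j)
        x∈S : ∀ j → S (x (punchIn i₀ j))
        x∈S j = [ id , (λ xj≈g → ⊥-elim (Fin.punchInᵢ≢i i₀ j (inj (trans xj≈g (sym xi₀≈g))))) ]′
                  (x∈T (punchIn i₀ j))
        rest : Carrier
        rest = sum (λ j → t (punchIn i₀ j))
        rest∈ : ⟨ _∈ˡ es ⟩ rest
        rest∈ = sum∈ _ (λ j → ·∈ (k (punchIn i₀ j)) (S⊆⟨es⟩ (x∈S j)))
        eq′ : t i₀ ∙ rest ≈ ε
        eq′ = trans (sym (sum-remove {i = i₀} t)) eq
        ki₀≡0 : k i₀ ≡ 0ℤ
        ki₀≡0 = ·∈⇒≡0 g∉ (k i₀) (resp (trans (sym (inverseˡ-unique _ _ eq′)) (·-congᶻ (k i₀) xi₀≈g)) (⁻¹∈ rest∈))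
        rest≈ε : rest ≈ ε
        rest≈ε = trans (sym (identityˡ rest)) (trans (∙-congʳ (sym (reflexive (≡.cong (λ z → _·_ A z (x i₀)) ki₀≡0)))) eq′)
        others : ∀ j → k (punchIn i₀ j) ≡ 0ℤ
        others = indep m (x ∘ punchIn i₀) x∈S (Fin.punchIn-injective i₀ _ _ ∘ inj) (k ∘ punchIn i₀) rest≈ε
        all0 : ∀ j → k j ≡ 0ℤ
        all0 j with i₀ Fin.≟ j
        ... | yes ≡.refl = ki₀≡0
        ... | no  i₀≢j   = ≡.subst (λ z → k z ≡ 0ℤ) (Fin.punchIn-punchOut i₀≢j) (others (punchOut i₀≢j))

    spans : ∀ g → Clˡ es g
    spans g with em _ {Clˡ es g}
    ... | yes g∈ = g∈
    ... | no  g∉ = 0 , resp (sym (identityʳ g)) (S⊆⟨es⟩ (maximal (T g g∉) (T-indep g g∉) inj₁ (inj₂ refl)))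

  chains⇒infinite : (∀ n → ∃[ ys ] length ys ≡ n × Chain ys) → RankInfinite A
  chains⇒infinite chains n rank
    with es , ≡.refl , spans ← RankIs⇒spanning rank
    with ys , len , chain ← chains (suc n)
    with rest , eq , _ ← steinitz spans chain
    = ℕ.<-irrefl (≡.refl {x = length es})
        (ℕ.≤-trans (ℕ.≤-reflexive (≡.sym len)) (ℕ.≤-trans (ℕ.m≤n+m _ _) (ℕ.≤-reflexive eq)))

  -- The predicate `P` is the invariant shared by the elements chosen so far, such as membership in
  -- a small subring; it is what allows the next choice.
  extend⇒infinite : ∀ {p} (P : Pred Carrier p) →
                    (∀ ys → All P ys → ∃[ y ] P y × ¬ Clˡ ys y) → RankInfinite A
  extend⇒infinite P extend = chains⇒infinite λ n → let ys , _ , len , ch = go n in ys , len , ch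
    where
    go : ∀ n → ∃[ ys ] All P ys × length ys ≡ n × Chain ys
    go zero    = [] , [] , ≡.refl , []
    go (suc n) = let ys , Pys , len , ch = go n
                     y , Py , y∉ = extend ys Pys
                 in y ∷ ys , Py ∷ Pys , ≡.cong suc len , y∉ ∷ ch

  -- The empty set is maximal, because the one-term relation `suc m ·ℕ x ≈ ε` keeps every `x` out of
  -- an independent set.
  torsion⇒RankIs0 : (∀ g → ∃[ m ] suc m ·ℕ g ≈ ε) → RankIs A 0
  torsion⇒RankIs0 torsion = (λ _ → Lift ℓ ⊥) ,
    ((λ n x x∈ _ _ _ i → ⊥-elim (lower (x∈ i))) ,
     λ T T-indep _ {x} Tx → ⊥-elim (nonzero x Tx T-indep)) ,
    record { to = λ () ; cong = λ { {()} } ; bijective = (λ { {()} }) , λ { (_ , lift ()) } }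
    where
    nonzero : ∀ {T : Pred Carrier ℓ} x → T x → ¬ Independent A T
    nonzero x Tx T-indep with m , mx≈ε ← torsion x
      with () ← T-indep 1 (λ _ → x) (λ _ → Tx) (λ { {zero} {zero} _ → ≡.refl })
                  (λ _ → + suc m) (trans (identityʳ _) mx≈ε) zero

-- The ring map from ℤ and the ring solver

module IntegerMultiples {c ℓ : Level} (R : CommutativeRing c ℓ) where
  open CommutativeRing R
  open SemiringMult′ semiring using (×-homo-+; ×1-homo-*; 1+×) renaming (_×_ to _×′_)
  open RingProperties ring using (-0#≈0#; -‿distribˡ-*; -‿distribʳ-*; -‿involutive)
  open AbelianGroupProperties +-abelianGroup using (⁻¹-∙-comm)
  open SetoidReasoning setoid

  -- With the optimised multiples `fromℤ 1ℤ` reduces to `1#`, so `con 1ℤ` in a solver equation is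
  -- literally `1#`.
  fromℤ : ℤ → Carrier
  fromℤ (+ n)    = n ×′ 1#
  fromℤ -[1+ n ] = - (suc n ×′ 1#)

  fromℤ-neg : ∀ i → fromℤ (ℤ.- i) ≈ - fromℤ i
  fromℤ-neg (+ zero)  = sym -0#≈0#
  fromℤ-neg (+ suc n) = refl
  fromℤ-neg -[1+ n ]  = sym (-‿involutive _)

  fromℤ-⊖ : ∀ m n → fromℤ (m ⊖ n) ≈ m ×′ 1# - n ×′ 1#
  fromℤ-⊖ m       zero    = sym (trans (+-congˡ -0#≈0#) (+-identityʳ _))
  fromℤ-⊖ zero    (suc n) = sym (+-identityˡ _)
  fromℤ-⊖ (suc m) (suc n) = begin
    fromℤ (suc m ⊖ suc n)                    ≡⟨ ≡.cong fromℤ (ℤ.[1+m]⊖[1+n]≡m⊖n m n) ⟩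
    fromℤ (m ⊖ n)                            ≈⟨ fromℤ-⊖ m n ⟩
    m ×′ 1# - n ×′ 1#                          ≈⟨ +-identityˡ _ ⟨
    0# + (m ×′ 1# - n ×′ 1#)                   ≈⟨ +-congʳ (-‿inverseʳ 1#) ⟨
    (1# - 1#) + (m ×′ 1# - n ×′ 1#)            ≈⟨ +-assoc _ _ _ ⟩
    1# + (- 1# + (m ×′ 1# - n ×′ 1#))
      ≈⟨ +-congˡ (trans (sym (+-assoc _ _ _)) (trans (+-congʳ (+-comm _ _)) (+-assoc _ _ _))) ⟩
    1# + (m ×′ 1# + (- 1# - n ×′ 1#))          ≈⟨ +-assoc _ _ _ ⟨
    (1# + m ×′ 1#) + (- 1# - n ×′ 1#)          ≈⟨ +-congˡ (⁻¹-∙-comm _ _) ⟩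
    (1# + m ×′ 1#) - (1# + n ×′ 1#)            ≈⟨ +-cong (1+× m 1#) (-‿cong (1+× n 1#)) ⟨
    suc m ×′ 1# - suc n ×′ 1#                  ∎

  fromℤ-+ : ∀ i j → fromℤ (i ℤ.+ j) ≈ fromℤ i + fromℤ j
  fromℤ-+ (+ m)    (+ n)    = ×-homo-+ 1# m n
  fromℤ-+ (+ m)    -[1+ n ] = fromℤ-⊖ m (suc n)
  fromℤ-+ -[1+ m ] (+ n)    = trans (fromℤ-⊖ n (suc m)) (+-comm _ _)
  fromℤ-+ -[1+ m ] -[1+ n ] = begin
    - (suc (suc (m ℕ.+ n)) ×′ 1#)            ≡⟨ ≡.cong (λ k → - (suc k ×′ 1#)) (ℕ.+-suc m n) ⟨
    - ((suc m ℕ.+ suc n) ×′ 1#)              ≈⟨ -‿cong (×-homo-+ 1# (suc m) (suc n)) ⟩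
    - (suc m ×′ 1# + suc n ×′ 1#)             ≈⟨ ⁻¹-∙-comm _ _ ⟨
    - (suc m ×′ 1#) - suc n ×′ 1#             ∎

  fromℤ-* : ∀ i j → fromℤ (i ℤ.* j) ≈ fromℤ i * fromℤ j
  fromℤ-* (+ m) (+ n) = trans (reflexive (≡.cong fromℤ (≡.sym (ℤ.pos-* m n)))) (×1-homo-* m n)
  fromℤ-* (+ m) -[1+ n ] = begin
    fromℤ (+ m ℤ.* -[1+ n ])            ≡⟨ ≡.cong fromℤ (ℤ.neg-distribʳ-* (+ m) (+ suc n)) ⟨
    fromℤ (ℤ.- (+ m ℤ.* + suc n))       ≈⟨ fromℤ-neg (+ m ℤ.* + suc n) ⟩
    - fromℤ (+ m ℤ.* + suc n)           ≈⟨ -‿cong (fromℤ-* (+ m) (+ suc n)) ⟩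
    - (m ×′ 1# * (suc n ×′ 1#))           ≈⟨ -‿distribʳ-* _ _ ⟩
    m ×′ 1# * - (suc n ×′ 1#)             ∎
  fromℤ-* -[1+ m ] (+ n) = begin
    fromℤ (-[1+ m ] ℤ.* + n)            ≡⟨ ≡.cong fromℤ (ℤ.neg-distribˡ-* (+ suc m) (+ n)) ⟨
    fromℤ (ℤ.- (+ suc m ℤ.* + n))       ≈⟨ fromℤ-neg (+ suc m ℤ.* + n) ⟩
    - fromℤ (+ suc m ℤ.* + n)           ≈⟨ -‿cong (fromℤ-* (+ suc m) (+ n)) ⟩
    - (suc m ×′ 1# * (n ×′ 1#))           ≈⟨ -‿distribˡ-* _ _ ⟩
    - (suc m ×′ 1#) * (n ×′ 1#)           ∎
  fromℤ-* -[1+ m ] -[1+ n ] = begin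
    (suc m ℕ.* suc n) ×′ 1#                 ≈⟨ ×1-homo-* (suc m) (suc n) ⟩
    suc m ×′ 1# * (suc n ×′ 1#)             ≈⟨ -‿involutive _ ⟨
    - - (suc m ×′ 1# * (suc n ×′ 1#))       ≈⟨ -‿cong (-‿distribˡ-* _ _) ⟩
    - (- (suc m ×′ 1#) * (suc n ×′ 1#))     ≈⟨ -‿distribʳ-* _ _ ⟩
    - (suc m ×′ 1#) * - (suc n ×′ 1#)       ∎

  private
    fromℤ-homomorphism : ℤ.+-*-rawRing -Raw-AlmostCommutative⟶ fromCommutativeRing R
    fromℤ-homomorphism = record
      { ⟦_⟧ = fromℤ ; +-homo = fromℤ-+ ; *-homo = fromℤ-* ; -‿homo = fromℤ-neg
      ; 0-homo = refl ; 1-homo = refl }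

    _≟_ : ∀ i j → Maybe (fromℤ i ≈ fromℤ j)
    i ≟ j with i ℤ.≟ j
    ... | yes i≡j = just (reflexive (≡.cong fromℤ i≡j))
    ... | no  _   = nothing

  module Solver = Algebra.Solver.Ring ℤ.+-*-rawRing (fromCommutativeRing R) fromℤ-homomorphism _≟_

-- Proof by contradiction and least witnesses

module Classical (em : ∀ ℓ → ExcludedMiddle ℓ) where

  byContradiction : ∀ {p} {P : Set p} → ¬ ¬ P → P
  byContradiction {P = P} ¬¬P with em _ {P}
  ... | yes p = p
  ... | no ¬P = ⊥-elim (¬¬P ¬P)

  least : ∀ {p} (P : ℕ → Set p) → ∃ P → ∃[ n ] P n × (∀ m → P m → n ℕ.≤ m)
  least P (n , Pn) = go n (<-wellFounded n) Pn
    where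
    go : ∀ n → Acc ℕ._<_ n → P n → ∃[ n ] P n × (∀ m → P m → n ℕ.≤ m)
    go n (acc rec) Pn with em _ {∃[ m ] m ℕ.< n × P m}
    ... | yes (m , m<n , Pm) = go m (rec m<n) Pm
    ... | no ∄ = n , Pn , λ m Pm → ℕ.≮⇒≥ λ m<n → ∄ (m , m<n , Pm)

-- Polynomials as coefficient lists, subrings and pseudo-division

module Polynomials {c ℓ : Level} (R : CommutativeRing c ℓ) where
  open CommutativeRing R
  open Exp commutativeSemiring using (_^_)
  open RingProperties ring using (-1*x≈-x)
  open IntegerMultiples R
  open Solver
  open SetoidReasoning setoid

  -- Coefficients from degree 0 upwards, trailing zeros allowed.
  ev : List Carrier → Carrier → Carrier
  ev []      x = 0#
  ev (a ∷ p) x = a + x * ev p x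

  -- Vanishing as a formal polynomial. Vanishing of the values implies it only on an infinite set of
  -- points, which is where infinite subrings enter.
  AllZero : List Carrier → Set (c ⊔ ℓ)
  AllZero = All (_≈ 0#)

  add : List Carrier → List Carrier → List Carrier
  add []      q       = q
  add (a ∷ p) []      = a ∷ p
  add (a ∷ p) (b ∷ q) = (a + b) ∷ add p q

  scale : Carrier → List Carrier → List Carrier
  scale k = map (k *_)

  mul : List Carrier → List Carrier → List Carrier
  mul []      q = []
  mul (a ∷ p) q = add (scale a q) (0# ∷ mul p q)

  sub : List Carrier → List Carrier → List Carrier
  sub p q = add p (scale (- 1#) q)

  pow : List Carrier → ℕ → List Carrier
  pow p zero    = 1# ∷ []
  pow p (suc n) = mul p (pow p n)

  shift : ℕ → List Carrier → List Carrier
  shift zero    p = p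
  shift (suc n) p = 0# ∷ shift n p

  mono : ℕ → Carrier → List Carrier
  mono n a = shift n (a ∷ [])

  ev-cong : ∀ p {x y} → x ≈ y → ev p x ≈ ev p y
  ev-cong []      x≈y = refl
  ev-cong (a ∷ p) x≈y = +-congˡ (*-cong x≈y (ev-cong p x≈y))

  ev-AllZero : ∀ {p} → AllZero p → ∀ x → ev p x ≈ 0#
  ev-AllZero []         x = refl
  ev-AllZero (a≈0 ∷ p0) x =
    trans (+-cong a≈0 (*-congˡ (ev-AllZero p0 x))) (trans (+-identityˡ _) (zeroʳ x))

  ev-at-0 : ∀ a p → ev (a ∷ p) 0# ≈ a
  ev-at-0 a p = trans (+-congˡ (zeroˡ _)) (+-identityʳ a)

  ev-const : ∀ a x → ev (a ∷ []) x ≈ a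
  ev-const a x = trans (+-congˡ (zeroʳ x)) (+-identityʳ a)

  ev-add : ∀ p q x → ev (add p q) x ≈ ev p x + ev q x
  ev-add []      q       x = sym (+-identityˡ _)
  ev-add (a ∷ p) []      x = sym (+-identityʳ _)
  ev-add (a ∷ p) (b ∷ q) x = trans (+-congˡ (*-congˡ (ev-add p q x)))
    (solve 5 (λ a b x P Q → (a :+ b) :+ x :* (P :+ Q) := (a :+ x :* P) :+ (b :+ x :* Q)) refl
      a b x (ev p x) (ev q x))

  ev-scale : ∀ k p x → ev (scale k p) x ≈ k * ev p x
  ev-scale k []      x = sym (zeroʳ k)
  ev-scale k (a ∷ p) x = trans (+-congˡ (*-congˡ (ev-scale k p x)))
    (solve 4 (λ k a x P → k :* a :+ x :* (k :* P) := k :* (a :+ x :* P)) refl k a x (ev p x))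

  ev-mul : ∀ p q x → ev (mul p q) x ≈ ev p x * ev q x
  ev-mul []      q x = sym (zeroˡ _)
  ev-mul (a ∷ p) q x = begin
    ev (add (scale a q) (0# ∷ mul p q)) x            ≈⟨ ev-add (scale a q) _ x ⟩
    ev (scale a q) x + (0# + x * ev (mul p q) x)
      ≈⟨ +-cong (ev-scale a q x) (+-congˡ (*-congˡ (ev-mul p q x))) ⟩
    a * ev q x + (0# + x * (ev p x * ev q x))
      ≈⟨ solve 4 (λ a x P Q → a :* Q :+ (con 0ℤ :+ x :* (P :* Q)) := (a :+ x :* P) :* Q)
           refl a x (ev p x) (ev q x) ⟩
    (a + x * ev p x) * ev q x                        ∎

  ev-sub : ∀ p q x → ev (sub p q) x ≈ ev p x - ev q x
  ev-sub p q x = trans (ev-add p _ x) (+-congˡ (trans (ev-scale (- 1#) q x) (-1*x≈-x _)))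

  ev-pow : ∀ p n x → ev (pow p n) x ≈ ev p x ^ n
  ev-pow p zero    x = ev-const 1# x
  ev-pow p (suc n) x = trans (ev-mul p (pow p n) x) (*-congˡ (ev-pow p n x))

  ev-shift : ∀ n p x → ev (shift n p) x ≈ ev p x * x ^ n
  ev-shift zero    p x = sym (*-identityʳ _)
  ev-shift (suc n) p x = trans (+-identityˡ _) (trans (*-congˡ (ev-shift n p x))
    (solve 3 (λ P x X → x :* (P :* X) := P :* (x :* X)) refl (ev p x) x (x ^ n)))

  ev-mono : ∀ n a x → ev (mono n a) x ≈ a * x ^ n
  ev-mono n a x = trans (ev-shift n (a ∷ []) x) (*-congʳ (ev-const a x))

  length-add : ∀ p q {n} → length p ℕ.≤ n → length q ℕ.≤ n → length (add p q) ℕ.≤ n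
  length-add []      q       p≤ q≤ = q≤
  length-add (a ∷ p) []      p≤ q≤ = p≤
  length-add (a ∷ p) (b ∷ q) (s≤s p≤) (s≤s q≤) = s≤s (length-add p q p≤ q≤)

  length-scale : ∀ k p {n} → length p ℕ.≤ n → length (scale k p) ℕ.≤ n
  length-scale k p p≤ = ℕ.≤-trans (ℕ.≤-reflexive (length-map (k *_) p)) p≤

  length-shift : ∀ n p → length (shift n p) ≡ n ℕ.+ length p
  length-shift zero    p = ≡.refl
  length-shift (suc n) p = ≡.cong suc (length-shift n p)

  length-mono : ∀ n a → length (mono n a) ≡ suc n
  length-mono n a = ≡.trans (length-shift n (a ∷ [])) (ℕ.+-comm n 1)

  lead≈0 : ∀ low n l → length low ℕ.≤ n → AllZero (add low (mono n l)) → l ≈ 0#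
  lead≈0 []        zero    l _         (l≈0 ∷ _) = l≈0
  lead≈0 []        (suc n) l _         (_ ∷ z)   = lead≈0 [] n l z≤n z
  lead≈0 (a ∷ low) (suc n) l (s≤s len) (_ ∷ z)   = lead≈0 low n l len z

  -- The quotient of a ∷ p by X - r, which does not depend on a.
  quot : Carrier → List Carrier → List Carrier
  quot r []      = []
  quot r (a ∷ p) = ev (a ∷ p) r ∷ quot r p

  quot-length : ∀ r p → length (quot r p) ≡ length p
  quot-length r []      = ≡.refl
  quot-length r (a ∷ p) = ≡.cong suc (quot-length r p)

  -- Horner's scheme: the coefficients of the quotient are the values at `r` of the successive
  -- tails.
  ev-quot : ∀ r a p x → ev (a ∷ p) x ≈ ev (a ∷ p) r + (x - r) * ev (quot r p) x
  ev-quot r a []      x = solve 3 (λ a x r → a :+ x :* con 0ℤ := (a :+ r :* con 0ℤ) :+ (x :- r) :* con 0ℤ)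
       refl a x r
  ev-quot r a (b ∷ p) x = begin
    a + x * ev (b ∷ p) x
      ≈⟨ +-congˡ (*-congˡ (ev-quot r b p x)) ⟩
    a + x * (ev (b ∷ p) r + (x - r) * ev (quot r p) x)
      ≈⟨ solve 5 (λ a x r P Q → a :+ x :* (P :+ (x :- r) :* Q)
           := (a :+ r :* P) :+ (x :- r) :* (P :+ x :* Q)) refl a x r (ev (b ∷ p) r) (ev (quot r p) x) ⟩
    ev (a ∷ b ∷ p) r + (x - r) * ev (quot r (b ∷ p)) x ∎

  -- Read from the top degree down: once a tail is zero, the Horner value above it is the bare
  -- coefficient.
  quot-AllZero : ∀ r p → AllZero (quot r p) → AllZero p
  quot-AllZero r []      []      = []
  quot-AllZero r (a ∷ p) (e ∷ z) = let p0 = quot-AllZero r p z in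
    trans (sym (trans (+-congˡ (trans (*-congˡ (ev-AllZero p0 r)) (zeroʳ r))) (+-identityʳ a))) e ∷ p0

  record IsSubring {p} (S : Pred Carrier p) : Set (c ⊔ ℓ ⊔ p) where
    field
      resp : ∀ {x y} → x ≈ y → S x → S y
      0∈   : S 0#
      1∈   : S 1#
      +∈   : ∀ {x y} → S x → S y → S (x + y)
      *∈   : ∀ {x y} → S x → S y → S (x * y)
      -∈   : ∀ {x} → S x → S (- x)

    ^∈ : ∀ n {x} → S x → S (x ^ n)
    ^∈ zero    Sx = 1∈
    ^∈ (suc n) Sx = *∈ Sx (^∈ n Sx)

    ev∈ : ∀ {p x} → All S p → S x → S (ev p x)
    ev∈ []       Sx = 0∈
    ev∈ (a ∷ Sp) Sx = +∈ a (*∈ Sx (ev∈ Sp Sx))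

    add∈ : ∀ {p q} → All S p → All S q → All S (add p q)
    add∈ []       Sq       = Sq
    add∈ (a ∷ Sp) []       = a ∷ Sp
    add∈ (a ∷ Sp) (b ∷ Sq) = +∈ a b ∷ add∈ Sp Sq

    scale∈ : ∀ {k p} → S k → All S p → All S (scale k p)
    scale∈ Sk []       = []
    scale∈ Sk (a ∷ Sp) = *∈ Sk a ∷ scale∈ Sk Sp

    mul∈ : ∀ {p q} → All S p → All S q → All S (mul p q)
    mul∈ []       Sq = []
    mul∈ (a ∷ Sp) Sq = add∈ (scale∈ a Sq) (0∈ ∷ mul∈ Sp Sq)

    sub∈ : ∀ {p q} → All S p → All S q → All S (sub p q)
    sub∈ Sp Sq = add∈ Sp (scale∈ (-∈ 1∈) Sq)

    pow∈ : ∀ {p} n → All S p → All S (pow p n)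
    pow∈ zero    Sp = 1∈ ∷ []
    pow∈ (suc n) Sp = mul∈ Sp (pow∈ n Sp)

    shift∈ : ∀ n {p} → All S p → All S (shift n p)
    shift∈ zero    Sp = Sp
    shift∈ (suc n) Sp = 0∈ ∷ shift∈ n Sp

    mono∈ : ∀ n {a} → S a → All S (mono n a)
    mono∈ n Sa = shift∈ n (Sa ∷ [])

  infix 10 _[_]

  _[_] : ∀ {p} → Pred Carrier p → Carrier → Pred Carrier (c ⊔ ℓ ⊔ p)
  (S [ b ]) x = ∃[ p ] All S p × ev p b ≈ x

  adjoin-isSubring : ∀ {p} {S : Pred Carrier p} → IsSubring S → ∀ b → IsSubring (S [ b ])
  adjoin-isSubring S-sub b = record
    { resp = λ { x≈y (p , Sp , e) → p , Sp , trans e x≈y }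
    ; 0∈   = [] , [] , refl
    ; 1∈   = 1# ∷ [] , 1∈ ∷ [] , ev-const 1# b
    ; +∈   = λ { (p , Sp , e) (q , Sq , e′) → add p q , add∈ Sp Sq , trans (ev-add p q b) (+-cong e e′) }
    ; *∈   = λ { (p , Sp , e) (q , Sq , e′) → mul p q , mul∈ Sp Sq , trans (ev-mul p q b) (*-cong e e′) }
    ; -∈   = λ { (p , Sp , e) → scale (- 1#) p , scale∈ (-∈ 1∈) Sp ,
                  trans (ev-scale (- 1#) p b) (trans (-1*x≈-x _) (-‿cong e)) }
    }
    where open IsSubring S-sub

  adjoin-⊆ : ∀ {p} {S : Pred Carrier p} {b x} → S x → (S [ b ]) x
  adjoin-⊆ {b = b} {x} Sx = x ∷ [] , Sx ∷ [] , ev-const x b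

  adjoin-∋ : ∀ {p} {S : Pred Carrier p} → IsSubring S → ∀ {b} → (S [ b ]) b
  adjoin-∋ S-sub {b} = 0# ∷ 1# ∷ [] , 0∈ ∷ 1∈ ∷ [] ,
    solve 1 (λ b → con 0ℤ :+ b :* (con 1ℤ :+ b :* con 0ℤ) := b) refl b
    where open IsSubring S-sub

  adjoin-least : ∀ {p q} {S : Pred Carrier p} {T : Pred Carrier q} → IsSubring T →
                 (∀ {x} → S x → T x) → ∀ {b} → T b → ∀ {x} → (S [ b ]) x → T x
  adjoin-least T-sub S⊆T Tb (p , Sp , e) = resp e (ev∈ (All.map S⊆T Sp) Tb)
    where open IsSubring T-sub

  infix 4 _∣[_]_

  -- The ambient ring will be a field, so divisibility has content only because the cofactor is
  -- confined to `S`.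
  _∣[_]_ : ∀ {p} → Carrier → Pred Carrier p → Carrier → Set (c ⊔ ℓ ⊔ p)
  x ∣[ S ] y = ∃[ w ] S w × x * w ≈ y

  module _ {p} {S : Pred Carrier p} (S-sub : IsSubring S) where
    open IsSubring S-sub

    ∣-*ʳ : ∀ {x y z} → S z → x ∣[ S ] y → x ∣[ S ] y * z
    ∣-*ʳ Sz (w , Sw , e) = w * _ , *∈ Sw Sz , trans (sym (*-assoc _ _ _)) (*-congʳ e)

    -- The hypothesis is a Bézout relation between `x` and `s`. It writes `s ^ N * y` as a
    -- combination of a multiple of `x` and of `s ^ suc N * y`, so one factor `s` is stripped at a
    -- time.
    coprime-∣ : ∀ {x s u v} → S s → S u → S v → x * u ≈ 1# + s * v →
                ∀ N {y} → S y → x ∣[ S ] s ^ N * y → x ∣[ S ] y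
    coprime-∣ Ss Su Sv e zero    Sy (w , Sw , eq) = w , Sw , trans eq (*-identityˡ _)
    coprime-∣ {x} {s} {u} {v} Ss Su Sv e (suc N) {y} Sy (w , Sw , eq) =
      coprime-∣ Ss Su Sv e N Sy (u * Y - v * w , +∈ (*∈ Su (*∈ (^∈ N Ss) Sy)) (-∈ (*∈ Sv Sw)) , (begin
        x * (u * Y - v * w)
          ≈⟨ solve 5 (λ x u Y v w → x :* (u :* Y :- v :* w) := (x :* u) :* Y :- v :* (x :* w)) refl x u Y v w ⟩
        (x * u) * Y - v * (x * w)        ≈⟨ +-cong (*-congʳ e) (-‿cong (*-congˡ eq)) ⟩
        (1# + s * v) * Y - v * (s * s ^ N * y)
          ≈⟨ solve 4 (λ s v S y → (con 1ℤ :+ s :* v) :* (S :* y) :- v :* (s :* S :* y) := S :* y)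
               refl s v (s ^ N) y ⟩
        s ^ N * y                        ∎))
      where
      Y = s ^ N * y

  -- A short list counts as padded with zeros, so `t` may be 0. The last component is what later
  -- shows that the top coefficient of a list of least length is nonzero.
  split-last : ∀ {p} {S : Pred Carrier p} → S 0# → ∀ n v → All S v → length v ℕ.≤ suc n →
               ∃[ v′ ] ∃[ t ] All S v′ × S t × length v′ ℕ.≤ n × (∀ x → ev v x ≈ ev v′ x + t * x ^ n) ×
               (AllZero v′ → t ≈ 0# → AllZero v)
  split-last 0∈ n [] [] _ = [] , 0# , [] , 0∈ , z≤n , (λ x → sym (trans (+-identityˡ _) (zeroˡ _))) , λ _ _ → []
  split-last 0∈ zero (a ∷ []) (Sa ∷ []) _ = [] , a , [] , Sa , z≤n ,
    (λ x → solve 2 (λ a x → a :+ x :* con 0ℤ := con 0ℤ :+ a :* con 1ℤ) refl a x) , λ _ a≈0 → a≈0 ∷ []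
  split-last 0∈ zero (a ∷ _ ∷ _) _ (s≤s ())
  split-last 0∈ (suc n) (a ∷ v) (Sa ∷ Sv) (s≤s len) =
    let v′ , t , Sv′ , St , len′ , e , z = split-last 0∈ n v Sv len
    in a ∷ v′ , t , Sa ∷ Sv′ , St , s≤s len′ , (λ x → trans (+-congˡ (*-congˡ (e x)))
      (solve 5 (λ a x V t X → a :+ x :* (V :+ t :* X) := (a :+ x :* V) :+ t :* (x :* X)) refl
        a x (ev v′ x) t (x ^ n))) , λ { (a≈0 ∷ z′) t≈0 → a≈0 ∷ z z′ t≈0 }

  -- The divisor is low + l X^e; multiplying by powers of its leading
  -- coefficient l keeps all coefficients inside S.
  pseudo-divide : ∀ {p} {S : Pred Carrier p} → IsSubring S →
                  ∀ {low l} e → All S low → S l → length low ℕ.≤ e → ∀ w → All S w →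
                  ∃[ k ] ∃[ u ] ∃[ r ] All S u × All S r × length r ℕ.≤ e ×
                    length u ℕ.≤ length w ℕ.∸ e ×
                    (∀ x → l ^ k * ev w x ≈ ev u x * (ev low x + l * x ^ e) + ev r x)
  pseudo-divide S-sub e Slow Sl len w Sw with length w ℕ.≤? e
  ... | yes w≤e = 0 , [] , w , [] , Sw , w≤e , z≤n , λ x →
        trans (*-identityˡ _) (sym (trans (+-congʳ (zeroˡ _)) (+-identityˡ _)))
  pseudo-divide S-sub e Slow Sl len [] Sw | no w≰e = ⊥-elim (w≰e z≤n)
  pseudo-divide {S = S} S-sub {low} {l} e Slow Sl len (a ∷ w) (Sa ∷ Sw) | no w≰e =
    let k , u , r , Su , Sr , r≤ , u≤ , eq = pseudo-divide S-sub e Slow Sl len w Sw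
        -- Prepending the next coefficient raises the old remainder to degree `e` at most; its
        -- coefficient `t` there is cleared by one more multiplication by `l`.
        v , t , Sv , St , v≤ , eq′ , _ = split-last 0∈ e (l ^ k * a ∷ r) (*∈ (^∈ k Sl) Sa ∷ Sr) (s≤s r≤)
    in suc k , t ∷ scale l u , add (scale l v) (scale (- t) low)
     , St ∷ scale∈ Sl Su , add∈ (scale∈ Sl Sv) (scale∈ (-∈ St) Slow)
     , length-add (scale l v) _ (length-scale l v v≤) (length-scale (- t) low len)
     , ℕ.≤-trans (s≤s (length-scale l u u≤)) (ℕ.≤-reflexive (≡.sym (ℕ.+-∸-assoc 1 (ℕ.≤-pred (ℕ.≰⇒> w≰e)))))
     , λ x → begin
      l * l ^ k * (a + x * ev w x)
        ≈⟨ solve 5 (λ l L a x W → l :* L :* (a :+ x :* W) := l :* (L :* a :+ x :* (L :* W))) refl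
             l (l ^ k) a x (ev w x) ⟩
      l * (l ^ k * a + x * (l ^ k * ev w x))
        ≈⟨ *-congˡ (+-congˡ (*-congˡ (eq x))) ⟩
      l * (l ^ k * a + x * (ev u x * (ev low x + l * x ^ e) + ev r x))
        ≈⟨ solve 6 (λ l A x U G Q → l :* (A :+ x :* (U :* G :+ Q)) := x :* (l :* U) :* G :+ l :* (A :+ x :* Q)) refl
             l (l ^ k * a) x (ev u x) (ev low x + l * x ^ e) (ev r x) ⟩
      x * (l * ev u x) * (ev low x + l * x ^ e) + l * (l ^ k * a + x * ev r x)
        ≈⟨ +-congˡ (*-congˡ (eq′ x)) ⟩
      x * (l * ev u x) * (ev low x + l * x ^ e) + l * (ev v x + t * x ^ e)
        ≈⟨ solve 7 (λ l x U L X V t → x :* (l :* U) :* (L :+ l :* X) :+ l :* (V :+ t :* X)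
             := (t :+ x :* (l :* U)) :* (L :+ l :* X) :+ (l :* V :+ (:- t) :* L)) refl
             l x (ev u x) (ev low x) (x ^ e) (ev v x) t ⟩
      (t + x * (l * ev u x)) * (ev low x + l * x ^ e) + (l * ev v x + - t * ev low x)
        ≈⟨ +-cong (*-congʳ (+-congˡ (*-congˡ (ev-scale l u x))))
                  (trans (ev-add (scale l v) _ x) (+-cong (ev-scale l v x) (ev-scale (- t) low x))) ⟨
      ev (t ∷ scale l u) x * (ev low x + l * x ^ e) + ev (add (scale l v) (scale (- t) low)) x ∎
    where open IsSubring S-sub

-- Roots, infinite sets and minimal polynomials over a field

module FieldPolynomials (em : ∀ ℓ → ExcludedMiddle ℓ) {c ℓ : Level}
                        (R : CommutativeRing c ℓ) (isField : IsField R) where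
  open CommutativeRing R
  open Classical em
  open Exp commutativeSemiring using (_^_)
  open IntegerMultiples R
  open Solver
  open Polynomials R
  open SetoidReasoning setoid

  1≉0 : ¬ (1# ≈ 0#)
  1≉0 1≈0 = proj₁ isField (sym 1≈0)

  inverse : ∀ {x} → ¬ x ≈ 0# → ∃[ y ] y * x ≈ 1#
  inverse {x} x≉0 = let y , yx≈1 , _ = proj₂ isField x x≉0 in y , yx≈1

  cancel : ∀ {x y z} → ¬ x ≈ 0# → x * y ≈ x * z → y ≈ z
  cancel {x} {y} {z} x≉0 eq = let i , ix≈1 = inverse x≉0 in begin
    y            ≈⟨ trans (*-congʳ ix≈1) (*-identityˡ y) ⟨
    i * x * y    ≈⟨ trans (*-assoc i x y) (trans (*-congˡ eq) (sym (*-assoc i x z))) ⟩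
    i * x * z    ≈⟨ trans (*-congʳ ix≈1) (*-identityˡ z) ⟩
    z            ∎

  zero-divisor : ∀ {x y} → ¬ x ≈ 0# → x * y ≈ 0# → y ≈ 0#
  zero-divisor x≉0 eq = cancel x≉0 (trans eq (sym (zeroʳ _)))

  *≉0 : ∀ {x y} → ¬ x ≈ 0# → ¬ y ≈ 0# → ¬ x * y ≈ 0#
  *≉0 x≉0 y≉0 xy≈0 = y≉0 (zero-divisor x≉0 xy≈0)

  ^≉0 : ∀ n {x} → ¬ x ≈ 0# → ¬ x ^ n ≈ 0#
  ^≉0 zero    x≉0 = 1≉0
  ^≉0 (suc n) x≉0 = *≉0 x≉0 (^≉0 n x≉0)

  x-y≈0⇒x≈y : ∀ {x y} → x - y ≈ 0# → x ≈ y
  x-y≈0⇒x≈y {x} {y} e = trans (solve 2 (λ x y → x := (x :- y) :+ y) refl x y) (trans (+-congʳ e) (+-identityˡ y))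

  x≈y⇒x-y≈0 : ∀ {x y} → x ≈ y → x - y ≈ 0#
  x≈y⇒x-y≈0 {x} {y} e = trans (+-congʳ e) (-‿inverseʳ y)

  infix 4 _∈≈_
  _∈≈_ : Carrier → List Carrier → Set (c ⊔ ℓ)
  x ∈≈ rs = Any (x ≈_) rs

  -- Whenever a root exists it is split off by `quot`, and the quotient is again nonzero; the length
  -- serves as the induction measure.
  roots : ∀ p → ¬ AllZero p → ∃[ rs ] (∀ x → ev p x ≈ 0# → x ∈≈ rs)
  roots p = go (length p) p ≡.refl
    where
    go : ∀ n p → length p ≡ n → ¬ AllZero p → ∃[ rs ] (∀ x → ev p x ≈ 0# → x ∈≈ rs)
    go n [] _ p≢0 = ⊥-elim (p≢0 [])
    go (suc n) (a ∷ p) len p≢0 with em _ {∃[ r ] ev (a ∷ p) r ≈ 0#}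
    ... | no ∄ = [] , λ x e → ⊥-elim (∄ (x , e))
    ... | yes (r , er) with em _ {AllZero (quot r p)}
    ...   | yes z = ⊥-elim (p≢0 (trans (sym (trans (+-congˡ (trans (*-congˡ (ev-AllZero p0 r)) (zeroʳ r))) (+-identityʳ a))) er ∷ p0))
      where p0 = quot-AllZero r p z
    ...   | no q≢0 with go n (quot r p) (≡.trans (quot-length r p) (ℕ.suc-injective len)) q≢0
    ...     | rs , all = r ∷ rs , λ x ex → case x ex
      where
      case : ∀ x → ev (a ∷ p) x ≈ 0# → x ∈≈ r ∷ rs
      case x ex with em _ {x - r ≈ 0#}
      ... | yes x-r≈0 = here (x-y≈0⇒x≈y x-r≈0)
      ... | no  x-r≉0 = there (all x (zero-divisor x-r≉0
              (trans (sym (trans (+-congʳ er) (+-identityˡ _))) (trans (sym (ev-quot r a p x)) ex))))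

  Injection : (ℕ → Carrier) → Set ℓ
  Injection f = ∀ {i j} → f i ≈ f j → i ≡ j

  -- Pigeonhole: `suc (length rs)` distinct values cannot all be found in `rs`.
  avoid : ∀ {f} → Injection f → ∀ rs → ∃[ n ] ¬ f n ∈≈ rs
  avoid {f} inj rs = byContradiction λ none →
    let all : ∀ n → f n ∈≈ rs
        all n = byContradiction (λ ∉ → none (n , ∉))
        i , j , i<j , same = Fin.pigeonhole (ℕ.n<1+n (length rs)) (λ i → Any.index (all (toℕ i)))
    in ℕ.<⇒≢ i<j (inj (trans (Any.lookup-index (all (toℕ i)))
         (trans (reflexive (≡.cong (lookup rs) same)) (sym (Any.lookup-index (all (toℕ j)))))))

  Infinite : ∀ {p} → Pred Carrier p → Set (c ⊔ ℓ ⊔ p)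
  Infinite S = ∃[ f ] Injection f × (∀ n → S (f n))

  nonvanishing : ∀ {p} {S : Pred Carrier p} → Infinite S → ∀ q → ¬ AllZero q → ∃[ v ] S v × ¬ ev q v ≈ 0#
  nonvanishing (f , inj , Sf) q q≢0 =
    let rs , all = roots q q≢0
        n , fn∉ = avoid inj rs
    in f n , Sf n , λ e → fn∉ (all _ e)

  Algebraic : ∀ {p} → Pred Carrier p → Carrier → Set (c ⊔ ℓ ⊔ p)
  Algebraic S b = ∃[ q ] All S q × ¬ AllZero q × ev q b ≈ 0#

  transcendental : ∀ {p} {S : Pred Carrier p} {b} → ¬ Algebraic S b → ∀ q → All S q → ev q b ≈ 0# → AllZero q
  transcendental tr q Sq e = byContradiction λ q≢0 → tr (q , Sq , q≢0 , e)

  -- The polynomial is `low + lead X^deg`. As `S` is only a subring, `lead` cannot be normalised to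
  -- 1, and it accumulates as a denominator in every reduction. Minimality is stated for at most
  -- `deg` coefficients, the exact length of a pseudo-remainder.
  record MinPoly {p} (S : Pred Carrier p) (b : Carrier) : Set (c ⊔ ℓ ⊔ p) where
    field
      deg     : ℕ
      low     : List Carrier
      lead    : Carrier
      low∈    : All S low
      lead∈   : S lead
      lead≉0  : ¬ lead ≈ 0#
      low≤    : length low ℕ.≤ deg
      root    : ev low b + lead * b ^ deg ≈ 0#
      minimal : ∀ q → All S q → length q ℕ.≤ deg → ev q b ≈ 0# → AllZero q

    1≤deg : 1 ℕ.≤ deg
    1≤deg = go deg low low≤ root
      where
      go : ∀ d low → length low ℕ.≤ d → ev low b + lead * b ^ d ≈ 0# → 1 ℕ.≤ d
      go zero    [] _ e = ⊥-elim (lead≉0 (trans (sym (trans (+-identityˡ _) (*-identityʳ _))) e))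
      go (suc d) _  _ e = s≤s z≤n

  minPoly : ∀ {p} {S : Pred Carrier p} → IsSubring S → ∀ {b} → Algebraic S b → MinPoly S b
  minPoly {S = S} S-sub {b} (q , Sq , q≢0 , e)
    with least (λ n → ∃[ q ] length q ≡ n × All S q × ¬ AllZero q × ev q b ≈ 0#) (length q , q , ≡.refl , Sq , q≢0 , e)
  ... | zero , ([] , _ , _ , ≢0 , _) , _ = ⊥-elim (≢0 [])
  ... | suc d , (q , len , Sq , q≢0 , e) , min
    with low , l , Slow , Sl , low≤ , eq , zeros ← split-last (IsSubring.0∈ S-sub) d q Sq (ℕ.≤-reflexive len) = record
    { deg = d ; low = low ; lead = l ; low∈ = Slow ; lead∈ = Sl ; low≤ = low≤
    ; root = trans (sym (eq b)) e
    ; minimal = minimal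
    ; lead≉0 = λ l≈0 → q≢0 (zeros (minimal low Slow low≤ (begin
        ev low b                 ≈⟨ +-identityʳ _ ⟨
        ev low b + 0#            ≈⟨ +-congˡ (trans (*-congʳ l≈0) (zeroˡ _)) ⟨
        ev low b + l * b ^ d     ≈⟨ trans (sym (eq b)) e ⟩
        0#                       ∎)) l≈0)
    }
    where
    minimal : ∀ q → All S q → length q ℕ.≤ d → ev q b ≈ 0# → AllZero q
    minimal q Sq len e = byContradiction λ q≢0 → ℕ.<⇒≱ (s≤s len) (min (length q) (q , ≡.refl , Sq , q≢0 , e))

-- Elements 1 + sa that divide no power of z

module Nondivisors (em : ∀ ℓ → ExcludedMiddle ℓ) {c ℓ : Level}
                   (R : CommutativeRing c ℓ) (isField : IsField R) where
  open CommutativeRing R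
  open Classical em
  open Exp commutativeSemiring using (_^_; ^-homo-*; ^-congˡ; ^-distrib-*)
  open IntegerMultiples R
  open Solver
  open Polynomials R
  open FieldPolynomials em R isField
  open SetoidReasoning setoid

  module _ {p} {S : Pred Carrier p} (S-sub : IsSubring S) {b} (m : MinPoly S b) where
    open IsSubring S-sub
    open MinPoly m
    private module S[b] = IsSubring (adjoin-isSubring S-sub b)

    reduce : ∀ {z} → (S [ b ]) z →
             ∃[ k ] ∃[ r ] All S r × length r ℕ.≤ deg × lead ^ k * z ≈ ev r b
    reduce {z} (w , Sw , e) =
      let k , u , r , _ , Sr , r≤ , _ , eq = pseudo-divide S-sub deg low∈ lead∈ low≤ w Sw
      in k , r , Sr , r≤ , (begin
        lead ^ k * z                                     ≈⟨ *-congˡ e ⟨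
        lead ^ k * ev w b                                ≈⟨ eq b ⟩
        ev u b * (ev low b + lead * b ^ deg) + ev r b    ≈⟨ +-congʳ (trans (*-congˡ root) (zeroʳ _)) ⟩
        0# + ev r b                                      ≈⟨ +-identityˡ _ ⟩
        ev r b                                           ∎)

    -- The remainder of least degree among the multiples of z is constant,
    -- since otherwise it would divide the minimal polynomial.
    divides-scalar : Infinite S → ∀ {z} → (S [ b ]) z → ¬ z ≈ 0# →
                     ∃[ z₀ ] S z₀ × ¬ z₀ ≈ 0# × z ∣[ S [ b ] ] z₀
    divides-scalar S-inf {z} z∈ z≉0 with reduce z∈
    ... | k , r , Sr , r≤ , er
      with least (λ n → ∃[ d ] length d ≡ n × All S d × ¬ ev d b ≈ 0# × z ∣[ S [ b ] ] ev d b)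
             (length r , r , ≡.refl , Sr , (λ r≈0 → *≉0 (^≉0 k lead≉0) z≉0 (trans er r≈0)) ,
              lead ^ k , adjoin-⊆ (^∈ k lead∈) , trans (*-comm _ _) er)
    ... | zero , ([] , _ , _ , ≉0 , _) , _ = ⊥-elim (≉0 refl)
    ... | suc g , (d , len , Sd , d≉0 , z∣d) , min
      with low′ , ρ , Slow′ , Sρ , low′≤ , eq , _ ← split-last 0∈ g d Sd (ℕ.≤-reflexive len) = result g ≡.refl low′≤
      where
      too-short : ∀ q → length q ℕ.≤ g → All S q → z ∣[ S [ b ] ] ev q b → ev q b ≈ 0#
      too-short q q≤ Sq z∣q = byContradiction λ q≉0 → ℕ.<⇒≱ (s≤s q≤) (min (length q) (q , ≡.refl , Sq , q≉0 , z∣q))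

      ρ≉0 : ¬ ρ ≈ 0#
      ρ≉0 ρ≈0 = d≉0 (trans d≈low′ (too-short low′ low′≤ Slow′ (proj₁ z∣d , proj₁ (proj₂ z∣d) , trans (proj₂ (proj₂ z∣d)) d≈low′)))
        where
        d≈low′ : ev d b ≈ ev low′ b
        d≈low′ = trans (eq b) (trans (+-congˡ (trans (*-congʳ ρ≈0) (zeroˡ _))) (+-identityʳ _))

      result : ∀ g′ → g ≡ g′ → length low′ ℕ.≤ g′ → ∃[ z₀ ] S z₀ × ¬ z₀ ≈ 0# × z ∣[ S [ b ] ] z₀
      result zero ≡.refl low′≤0 = ρ , Sρ , ρ≉0 , proj₁ z∣d , proj₁ (proj₂ z∣d) ,
        trans (proj₂ (proj₂ z∣d)) (trans (eq b) (trans (+-cong (empty low′ low′≤0) (*-identityʳ _)) (+-identityˡ _)))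
        where
        empty : ∀ p → length p ℕ.≤ 0 → ev p b ≈ 0#
        empty [] _ = refl
      result (suc g′) ≡.refl _ with pseudo-divide S-sub g Slow′ Sρ low′≤ (add low (mono deg lead)) (add∈ low∈ (mono∈ deg lead∈))
      ... | j , u , q , Su , Sq , q≤ , u≤ , eq″ = ⊥-elim
          -- The division identity is known pointwise only, so the contradiction is drawn at a point
          -- of the infinite set `S` where `Q` does not vanish.
          (let v , _ , Qv≉0 = nonvanishing {S = S} S-inf Q Q≢0 in *≉0 (^≉0 j ρ≉0) Qv≉0 (Q≈0 v))
        where
        Q = add low (mono deg lead)
        Q≢0 : ¬ AllZero Q
        Q≢0 = lead≉0 ∘ lead≈0 low deg lead low≤
        ev-Q : ∀ x → ev Q x ≈ ev low x + lead * x ^ deg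
        ev-Q x = trans (ev-add low _ x) (+-congˡ (ev-mono deg lead x))
        ud+q≈0 : ev u b * ev d b + ev q b ≈ 0#
        ud+q≈0 = begin
          ev u b * ev d b + ev q b                      ≈⟨ +-congʳ (*-congˡ (eq b)) ⟩
          ev u b * (ev low′ b + ρ * b ^ g) + ev q b     ≈⟨ eq″ b ⟨
          ρ ^ j * ev Q b                                ≈⟨ *-congˡ (trans (ev-Q b) root) ⟩
          ρ ^ j * 0#                                    ≈⟨ zeroʳ _ ⟩
          0#                                            ∎
        z∣q : z ∣[ S [ b ] ] ev q b
        z∣q = let t , St , zt≈d = z∣d in t * - ev u b , S[b].*∈ St (S[b].-∈ (u , Su , refl)) , (begin
          z * (t * - ev u b)       ≈⟨ *-assoc _ _ _ ⟨
          z * t * - ev u b         ≈⟨ *-congʳ zt≈d ⟩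
          ev d b * - ev u b
            ≈⟨ solve 3 (λ d u q → d :* :- u := q :- (u :* d :+ q)) refl (ev d b) (ev u b) (ev q b) ⟩
          ev q b - (ev u b * ev d b + ev q b) ≈⟨ +-congˡ (-‿cong ud+q≈0) ⟩
          ev q b - 0#              ≈⟨ solve 1 (λ q → q :- con 0ℤ := q) refl (ev q b) ⟩
          ev q b                   ∎)
        g<deg : suc g ℕ.≤ deg
        g<deg = ℕ.≤-trans (min (length r) (r , ≡.refl , Sr , (λ r≈0 → *≉0 (^≉0 k lead≉0) z≉0 (trans er r≈0)) ,
              lead ^ k , adjoin-⊆ (^∈ k lead∈) , trans (*-comm _ _) er)) r≤
        qb≈0 : ev q b ≈ 0#
        qb≈0 = too-short q q≤ Sq z∣q
        q0 : AllZero q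
        q0 = minimal q Sq (ℕ.≤-trans q≤ (ℕ.<⇒≤ g<deg)) qb≈0
        ub≈0 : ev u b ≈ 0#
        ub≈0 = zero-divisor d≉0 (trans (*-comm _ _) (trans (sym (trans (+-congˡ qb≈0) (+-identityʳ _))) ud+q≈0))
        length-Q : length Q ℕ.≤ suc deg
        length-Q = length-add low _ (ℕ.m≤n⇒m≤1+n low≤) (ℕ.≤-reflexive (length-mono deg lead))
        -- The positive degree of `d` matters here: it cuts the quotient down to at most `deg`
        -- coefficients, so minimality applies to `u`.
        u0 : AllZero u
        u0 = minimal u Su (ℕ.≤-trans u≤ (ℕ.≤-trans (ℕ.∸-monoˡ-≤ g length-Q) (ℕ.m∸n≤m deg g′))) ub≈0
        Q≈0 : ∀ x → ρ ^ j * ev Q x ≈ 0#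
        Q≈0 x = begin
          ρ ^ j * ev Q x                             ≈⟨ eq″ x ⟩
          ev u x * (ev low′ x + ρ * x ^ g) + ev q x  ≈⟨ +-cong (*-congʳ (ev-AllZero u0 x)) (ev-AllZero q0 x) ⟩
          0# * (ev low′ x + ρ * x ^ g) + 0#          ≈⟨ trans (+-identityʳ _) (zeroˡ _) ⟩
          0#                                         ∎

  -- For transcendental `b`, specialise `b` to a point of `S` where the polynomial giving `z` is
  -- nonzero; `h` is its value there. For algebraic `b`, some multiple `z₀` of `z` lies in `S`, and
  -- the cofactor is reduced to fewer than `deg + 1` coefficients. The relation then holds between
  -- polynomials of degree below `deg`, hence coefficientwise, and its constant term lives in `S`.
  adjoin-conservative : ∀ {p} {S : Pred Carrier p} → IsSubring S → Infinite S →
    ∀ {b z} → (S [ b ]) z → ¬ z ≈ 0# →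
    ∃[ h ] S h × ¬ h ≈ 0# × (∀ {x} → S x → ∀ N → x ∣[ S [ b ] ] z ^ N → ∃[ M ] x ∣[ S ] h ^ M)
  adjoin-conservative {S = S} S-sub S-inf {b} {z} z∈@(p , Sp , pb≈z) z≉0 with em _ {Algebraic S b}
  ... | no transc =
    let v , Sv , pv≉0 = nonvanishing {S = S} S-inf p λ p0 → z≉0 (trans (sym pb≈z) (ev-AllZero p0 b))
    in ev p v , ev∈ Sp Sv , pv≉0 , λ { {x} Sx N (_ , (w , Sw , refl-w) , eq) → N , ev w v , ev∈ Sw Sv ,
      (let D-zero : AllZero (sub (scale x w) (pow p N))
           D-zero = transcendental transc _ (sub∈ (scale∈ Sx Sw) (pow∈ N Sp)) (trans (ev-D x w N b) (x≈y⇒x-y≈0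
             (trans (*-congˡ refl-w) (trans eq (^-congˡ N (sym pb≈z))))))
       in x-y≈0⇒x≈y (trans (sym (ev-D x w N v)) (ev-AllZero D-zero v))) }
    where
    open IsSubring S-sub
    ev-D : ∀ x w N y → ev (sub (scale x w) (pow p N)) y ≈ x * ev w y - ev p y ^ N
    ev-D x w N y = trans (ev-sub (scale x w) _ y) (+-cong (ev-scale x w y) (-‿cong (ev-pow p N y)))
  ... | yes alg =
    let z₀ , Sz₀ , z₀≉0 , y , Sy , zy≈z₀ = divides-scalar S-sub m S-inf z∈ z≉0
    in lead * z₀ , *∈ lead∈ Sz₀ , *≉0 lead≉0 z₀≉0 , λ { {x} Sx N (w , Sw , eq) →
      let k , r , Sr , r≤ , er = reduce S-sub m (S[b].*∈ Sw (S[b].^∈ N Sy))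
          C = lead ^ k * z₀ ^ N
          D = sub (scale x r) (C ∷ [])
          ev-D : ∀ t → ev D t ≈ x * ev r t - C
          ev-D t = trans (ev-sub (scale x r) _ t) (+-cong (ev-scale x r t) (-‿cong (ev-const C t)))
          D-zero : AllZero D
          D-zero = minimal D (sub∈ (scale∈ Sx Sr) (*∈ (^∈ k lead∈) (^∈ N Sz₀) ∷ []))
            (length-add (scale x r) _ (length-scale x r r≤) 1≤deg)
            (trans (ev-D b) (x≈y⇒x-y≈0 (begin
              x * ev r b                           ≈⟨ *-congˡ er ⟨
              x * (lead ^ k * (w * y ^ N))
                ≈⟨ solve 4 (λ x L w Y → x :* (L :* (w :* Y)) := L :* (x :* w :* Y)) refl x (lead ^ k) w (y ^ N) ⟩
              lead ^ k * (x * w * y ^ N)           ≈⟨ *-congˡ (*-congʳ eq) ⟩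
              lead ^ k * (z ^ N * y ^ N)           ≈⟨ *-congˡ (^-distrib-* z y N) ⟨
              lead ^ k * (z * y) ^ N               ≈⟨ *-congˡ (^-congˡ N zy≈z₀) ⟩
              C                                    ∎)))
          -- The constant term of the identity `x * r = C`, obtained by evaluating at 0.
          x∣C : x ∣[ S ] C
          x∣C = ev r 0# , ev∈ Sr 0∈ , x-y≈0⇒x≈y (trans (sym (ev-D 0#)) (ev-AllZero D-zero 0#))
          -- The extra factor completes `C` to a power of `lead * z₀`, which has to be independent
          -- of `x`, `N` and `k`.
          w′ , Sw′ , xw′≈ = ∣-*ʳ S-sub (*∈ (^∈ N lead∈) (^∈ k Sz₀)) x∣C
      in k ℕ.+ N , w′ , Sw′ , trans xw′≈ (begin
        lead ^ k * z₀ ^ N * (lead ^ N * z₀ ^ k)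
          ≈⟨ solve 4 (λ A B C D → A :* B :* (C :* D) := A :* C :* (D :* B))
               refl (lead ^ k) (z₀ ^ N) (lead ^ N) (z₀ ^ k) ⟩
        lead ^ k * lead ^ N * (z₀ ^ k * z₀ ^ N)
          ≈⟨ *-cong (^-homo-* lead k N) (^-homo-* z₀ k N) ⟨
        lead ^ (k ℕ.+ N) * z₀ ^ (k ℕ.+ N)
          ≈⟨ ^-distrib-* lead z₀ (k ℕ.+ N) ⟨
        (lead * z₀) ^ (k ℕ.+ N) ∎) }
    where
    open IsSubring S-sub
    module S[b] = IsSubring (adjoin-isSubring S-sub b)
    m = minPoly S-sub alg
    open MinPoly m

  -- The map x ↦ -1/x, with default value 0 at 0. The root of 1 + sX is v = -1/s, so this map turns
  -- a finite list of forbidden `v` into a finite list of forbidden `s`.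
  neg-inv : Carrier → Carrier
  neg-inv x with em _ {x ≈ 0#}
  ... | yes _  = 0#
  ... | no x≉0 = - proj₁ (inverse x≉0)

  neg-inv-* : ∀ {x} → ¬ x ≈ 0# → neg-inv x * x ≈ - 1#
  neg-inv-* {x} x≉0 with em _ {x ≈ 0#}
  ... | yes x≈0 = ⊥-elim (x≉0 x≈0)
  ... | no  x≉0 = trans (solve 2 (λ y x → :- y :* x := :- (y :* x)) refl _ x) (-‿cong (proj₂ (inverse x≉0)))

  neg-inv-unique : ∀ {s v ρ} → s * v ≈ - 1# → v ≈ ρ → s ≈ neg-inv ρ
  neg-inv-unique {s} {v} {ρ} sv≈-1 v≈ρ = cancel ρ≉0 (trans (*-comm _ _) (trans sρ≈-1 (trans (sym (neg-inv-* ρ≉0)) (*-comm _ _))))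
    where
    sρ≈-1 : s * ρ ≈ - 1#
    sρ≈-1 = trans (*-congˡ (sym v≈ρ)) sv≈-1
    ρ≉0 : ¬ ρ ≈ 0#
    ρ≉0 ρ≈0 = 1≉0 (begin
      1#          ≈⟨ solve 0 (con 1ℤ := :- (:- con 1ℤ)) refl ⟩
      - - 1#      ≈⟨ -‿cong sρ≈-1 ⟨
      - (s * ρ)   ≈⟨ -‿cong (trans (*-congˡ ρ≈0) (zeroʳ s)) ⟩
      - 0#        ≈⟨ solve 0 (:- con 0ℤ := con 0ℤ) refl ⟩
      0#          ∎)

  ∈≈-neg-inv : ∀ {s v rs} → s * v ≈ - 1# → v ∈≈ rs → s ∈≈ map neg-inv rs
  ∈≈-neg-inv sv≈-1 v∈ = Any.map⁺ (Any.map (neg-inv-unique sv≈-1) v∈)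

  -1^n*-1^n : ∀ n → (- 1#) ^ n * (- 1#) ^ n ≈ 1#
  -1^n*-1^n zero    = *-identityˡ 1#
  -1^n*-1^n (suc n) = trans (solve 1 (λ e → (:- con 1ℤ :* e) :* (:- con 1ℤ :* e) := e :* e) refl _) (-1^n*-1^n n)

  -1^n∈ : ∀ {p} {S : Pred Carrier p} → IsSubring S → ∀ n → S ((- 1#) ^ n)
  -1^n∈ S-sub n = ^∈ n (-∈ 1∈) where open IsSubring S-sub

  -- Although v = -1/s need not lie in `S`, every s^n v^i with i ≤ n is up to sign a power of s.
  homogenize : ∀ {p} {S : Pred Carrier p} → IsSubring S → ∀ {s v} → S s → s * v ≈ - 1# →
               ∀ n p → All S p → length p ℕ.≤ suc n → S (s ^ n * ev p v)
  homogenize S-sub Ss sv n [] [] _ = resp (sym (zeroʳ _)) 0∈ where open IsSubring S-sub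
  homogenize S-sub {s} {v} Ss sv zero (a ∷ []) (Sa ∷ []) _ =
    resp (solve 2 (λ a v → a := con 1ℤ :* (a :+ v :* con 0ℤ)) refl a v) Sa where open IsSubring S-sub
  homogenize S-sub Ss sv zero (_ ∷ _ ∷ _) _ (s≤s ())
  homogenize S-sub {s} {v} Ss sv (suc n) (a ∷ p) (Sa ∷ Sp) (s≤s len) = resp (begin
    s * s ^ n * a + - 1# * (s ^ n * ev p v)    ≈⟨ +-congˡ (*-congʳ sv) ⟨
    s * s ^ n * a + s * v * (s ^ n * ev p v)
      ≈⟨ solve 5 (λ s N a v P → s :* N :* a :+ s :* v :* (N :* P) := s :* N :* (a :+ v :* P))
           refl s (s ^ n) a v (ev p v) ⟩
    s * s ^ n * (a + v * ev p v)               ∎)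
    (+∈ (*∈ (^∈ (suc n) Ss) Sa) (*∈ (-∈ 1∈) (homogenize S-sub Ss sv n p Sp len)))
    where open IsSubring S-sub

  FiniteUnits : ∀ {p} → Pred Carrier p → Set (c ⊔ ℓ ⊔ p)
  FiniteUnits S = ∃[ us ] (∀ u → S u → u ∣[ S ] 1# → u ∈≈ us)

  -- 1 + sa vanishes under a ↦ v = -1/s.  When a is algebraic over S with
  -- minimal polynomial m of leading coefficient l, divisibility forces
  -- μ = sᵈ m(v) / l to be a unit, which happens for finitely many s only.
  module _ {p} {S : Pred Carrier p} (S-sub : IsSubring S) (S-inf : Infinite S) (S-units : FiniteUnits S)
           {a : Carrier} (a≉0 : ¬ a ≈ 0#) where
    open IsSubring S-sub
    private
      module S[a] = IsSubring (adjoin-isSubring S-sub a)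
      f = proj₁ S-inf
      f-inj = proj₁ (proj₂ S-inf)
      f∈ = proj₂ (proj₂ S-inf)

    -- Divisibility is an identity in the polynomial ring, so it survives the substitution of v =
    -- -1/s for `a`. There 1 + sa becomes 0, whereas `q` vanishes at -1/s for finitely many `s`
    -- only.
    linear-nondivisor-transcendental : ¬ Algebraic S a → ∀ rs {h} → (S [ a ]) h → ¬ h ≈ 0# →
      ∃[ s ] S s × ¬ s ∈≈ rs × (∀ N → ¬ 1# + s * a ∣[ S [ a ] ] h ^ N)
    linear-nondivisor-transcendental transc rs {h} (q , Sq , qa≈h) h≉0 with
      roots q (λ q0 → h≉0 (trans (sym qa≈h) (ev-AllZero q0 a)))
    ... | ts , all-roots with avoid f-inj (rs ++ 0# ∷ map neg-inv ts)
    ...   | n , s∉ = s , f∈ n , s∉ ∘ Any.++⁺ˡ , nondivisor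
      where
      s = f n
      s≉0 : ¬ s ≈ 0#
      s≉0 s≈0 = s∉ (Any.++⁺ʳ rs (here s≈0))
      v = neg-inv s
      sv≈-1 : s * v ≈ - 1#
      sv≈-1 = trans (*-comm _ _) (neg-inv-* s≉0)
      qv≉0 : ¬ ev q v ≈ 0#
      qv≉0 qv≈0 = s∉ (Any.++⁺ʳ rs (there (∈≈-neg-inv sv≈-1 (all-roots v qv≈0))))
      nondivisor : ∀ N → ¬ 1# + s * a ∣[ S [ a ] ] h ^ N
      nondivisor N (_ , (w , Sw , refl-w) , eq) = ^≉0 N qv≉0 (begin
        ev q v ^ N                           ≈⟨ x-y≈0⇒x≈y (trans (sym (ev-D v)) (ev-AllZero D-zero v)) ⟨
        (1# + v * (s + v * 0#)) * ev w v
          ≈⟨ *-congʳ (solve 2 (λ v s → con 1ℤ :+ v :* (s :+ v :* con 0ℤ) := con 1ℤ :+ s :* v) refl v s) ⟩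
        (1# + s * v) * ev w v                ≈⟨ *-congʳ (+-congˡ sv≈-1) ⟩
        (1# - 1#) * ev w v
          ≈⟨ solve 1 (λ w → (con 1ℤ :- con 1ℤ) :* w := con 0ℤ) refl (ev w v) ⟩
        0#                                   ∎)
        where
        D = sub (mul (1# ∷ s ∷ []) w) (pow q N)
        ev-D : ∀ x → ev D x ≈ (1# + x * (s + x * 0#)) * ev w x - ev q x ^ N
        ev-D x = trans (ev-sub (mul (1# ∷ s ∷ []) w) _ x) (+-cong (ev-mul (1# ∷ s ∷ []) w x) (-‿cong (ev-pow q N x)))
        D-zero : AllZero D
        D-zero = transcendental transc D (sub∈ (mul∈ (1∈ ∷ f∈ n ∷ []) Sw) (pow∈ N Sq))
          (trans (ev-D a) (x≈y⇒x-y≈0 (begin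
            (1# + a * (s + a * 0#)) * ev w a
              ≈⟨ *-cong (solve 2 (λ v s → con 1ℤ :+ v :* (s :+ v :* con 0ℤ) := con 1ℤ :+ s :* v) refl a s) refl-w ⟩
            (1# + s * a) * _                  ≈⟨ eq ⟩
            h ^ N                             ≈⟨ ^-congˡ N qa≈h ⟨
            ev q a ^ N                        ∎)))

    linear-nondivisor-algebraic : MinPoly S a → ∀ rs {h} → (S [ a ]) h → ¬ h ≈ 0# →
      ∃[ s ] S s × ¬ s ∈≈ rs × (∀ N → ¬ 1# + s * a ∣[ S [ a ] ] h ^ N)
    linear-nondivisor-algebraic m rs {h} h∈ h≉0 = go deg ≡.refl 1≤deg
      where
      open MinPoly m renaming (lead to l; lead≉0 to l≉0; lead∈ to l∈)

      -- A minimal polynomial with zero constant term could be divided by X, since `a` is nonzero.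
      -- This keeps every `unit-equation` from being the zero polynomial.
      ev-low-0 : ∀ d′ → deg ≡ suc d′ → ¬ ev low 0# ≈ 0#
      ev-low-0 d′ ≡.refl low0≈0 = drop-root low low≤ low∈ low0≈0 root
        where
        drop-root : ∀ low → length low ℕ.≤ suc d′ → All S low → ev low 0# ≈ 0# → ¬ ev low a + l * a ^ suc d′ ≈ 0#
        drop-root [] _ _ _ e = *≉0 l≉0 (^≉0 (suc d′) a≉0) (trans (sym (+-identityˡ _)) e)
        drop-root (b ∷ low) (s≤s len) (_ ∷ Slow) b≈0 e = l≉0 (lead≈0 low d′ l len
          (minimal (add low (mono d′ l)) (add∈ Slow (mono∈ d′ l∈))
            (length-add low _ (ℕ.m≤n⇒m≤1+n len) (ℕ.≤-reflexive (length-mono d′ l)))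
            (zero-divisor a≉0 (begin
              a * ev (add low (mono d′ l)) a
                ≈⟨ *-congˡ (trans (ev-add low _ a) (+-congˡ (ev-mono d′ l a))) ⟩
              a * (ev low a + l * a ^ d′)
                ≈⟨ solve 4 (λ a L l A → a :* (L :+ l :* A) := con 0ℤ :+ a :* L :+ l :* (a :* A))
                     refl a (ev low a) l (a ^ d′) ⟩
              0# + a * ev low a + l * a ^ suc d′
                ≈⟨ +-congʳ (+-congʳ (trans (sym (ev-at-0 b low)) b≈0)) ⟨
              b + a * ev low a + l * a ^ suc d′          ≈⟨ e ⟩
              0#                                         ∎))))

      -- With d = `deg`, ε = (-1)^d and m the minimal polynomial, the equations s^d m(v) = l μ and
      -- s^d v^d = ε give m(v) = l μ ε v^d. This is that equation for μ = `u`.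
      unit-equation : Carrier → List Carrier
      unit-equation u = add low (mono deg (l - l * u * (- 1#) ^ deg))

      unit-roots : ∀ d′ → deg ≡ suc d′ → ∀ us → ∃[ ts ] (∀ {u} → u ∈≈ us → ∀ v →
                   ev low v + (l - l * u * (- 1#) ^ deg) * v ^ deg ≈ 0# → v ∈≈ ts)
      unit-roots d′ eq [] = [] , λ ()
      unit-roots d′ eq (u ∷ us) =
        let ts , all-roots = unit-roots d′ eq us
            ts′ , all-roots′ = roots (unit-equation u) (nonzero u)
        in ts′ ++ ts , λ
          { (here u′≈u) v e → Any.++⁺ˡ (all-roots′ v (trans (trans (ev-add low _ v)
              (+-congˡ (trans (ev-mono deg _ v) (*-congʳ (+-congˡ (-‿cong (*-congʳ (*-congˡ (sym u′≈u))))))))) e))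
          ; (there u∈) v e → Any.++⁺ʳ ts′ (all-roots u∈ v e) }
        where
        nonzero : ∀ u → ¬ AllZero (unit-equation u)
        nonzero u z = ev-low-0 d′ eq (begin
          ev low 0#                                      ≈⟨ +-identityʳ _ ⟨
          ev low 0# + 0#
            ≈⟨ +-congˡ (trans (*-congˡ (trans (^-cong-≡ eq) (zeroˡ _))) (zeroʳ _)) ⟨
          ev low 0# + κ * 0# ^ deg
            ≈⟨ trans (ev-add low _ 0#) (+-congˡ (ev-mono deg κ 0#)) ⟨
          ev (unit-equation u) 0#                        ≈⟨ ev-AllZero z 0# ⟩
          0#                                             ∎)
          where
          κ = l - l * u * (- 1#) ^ deg
          ^-cong-≡ : deg ≡ suc d′ → 0# ^ deg ≈ 0# * 0# ^ d′
          ^-cong-≡ e = reflexive (≡.cong (0# ^_) e)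

      go : ∀ d → deg ≡ d → 1 ℕ.≤ d → ∃[ s ] S s × ¬ s ∈≈ rs × (∀ N → ¬ 1# + s * a ∣[ S [ a ] ] h ^ N)
      go (suc d′) deg≡ _ with divides-scalar S-sub m S-inf h∈ h≉0 | unit-roots d′ deg≡ (proj₁ S-units)
      ... | h₀ , Sh₀ , h₀≉0 , y , Sy , hy≈h₀ | ts , all-roots
        -- The chosen s = l σ is divisible by l, and σ by l and h₀. Hence μ ≡ ε modulo each of l, h₀
        -- and σ, so all these factors can be cancelled from whatever μ divides.
        with avoid {λ n → l * (l * (h₀ * f n))} (f-inj ∘ cancel h₀≉0 ∘ cancel l≉0 ∘ cancel l≉0) (rs ++ 0# ∷ map neg-inv ts)
      ...   | n , s∉ = s , Ss , s∉ ∘ Any.++⁺ˡ , λ N → nondivisor N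
        where
        σ = l * (h₀ * f n)
        Sσ = *∈ l∈ (*∈ Sh₀ (f∈ n))
        s = l * σ
        Ss = *∈ l∈ Sσ
        s≉0 : ¬ s ≈ 0#
        s≉0 s≈0 = s∉ (Any.++⁺ʳ rs (here s≈0))
        v = neg-inv s
        sv≈-1 : s * v ≈ - 1#
        sv≈-1 = trans (*-comm _ _) (neg-inv-* s≉0)
        ε = (- 1#) ^ deg
        Sε = -1^n∈ S-sub deg
        m₁ = s ^ d′ * ev low v
        Sm₁ : S m₁
        Sm₁ = homogenize S-sub Ss sv≈-1 d′ low low∈ (≡.subst (length low ℕ.≤_) deg≡ low≤)
        -- In s^deg m(v) the leading term contributes l ε. The lower terms need only s^d′ to enter
        -- `S`, so a factor s = l σ is left over, and a common l comes out: the total is l μ.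
        μ = ε + σ * m₁
        Sμ = +∈ Sε (*∈ Sσ Sm₁)
        val = ev low v + l * v ^ deg
        s^deg : s ^ deg ≈ s * s ^ d′
        s^deg = reflexive (≡.cong (s ^_) deg≡)
        s^v^ : s ^ deg * v ^ deg ≈ ε
        s^v^ = trans (sym (^-distrib-* s v deg)) (^-congˡ deg sv≈-1)
        s^-low : s ^ deg * ev low v ≈ s * m₁
        s^-low = trans (*-congʳ s^deg) (*-assoc _ _ _)
        s^-val : s ^ deg * val ≈ l * μ
        s^-val = begin
          s ^ deg * (ev low v + l * v ^ deg)
            ≈⟨ solve 4 (λ D L l V → D :* (L :+ l :* V) := D :* L :+ l :* (D :* V))
                 refl (s ^ deg) (ev low v) l (v ^ deg) ⟩
          s ^ deg * ev low v + l * (s ^ deg * v ^ deg)   ≈⟨ +-cong s^-low (*-congˡ s^v^) ⟩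
          l * σ * m₁ + l * ε
            ≈⟨ solve 4 (λ l σ M ε → l :* σ :* M :+ l :* ε := l :* (ε :+ σ :* M)) refl l σ m₁ ε ⟩
          l * μ                                          ∎

        μ-nonunit : ¬ μ ∣[ S ] 1#
        μ-nonunit μ∣1 = s∉ (Any.++⁺ʳ rs (there (∈≈-neg-inv sv≈-1 (all-roots (proj₂ S-units μ Sμ μ∣1) v
          (zero-divisor (^≉0 deg s≉0) (begin
            s ^ deg * (ev low v + (l - l * μ * ε) * v ^ deg)
              ≈⟨ solve 6 (λ D L l μ ε V → D :* (L :+ (l :- l :* μ :* ε) :* V) := D :* (L :+ l :* V) :- l :* μ :* ε :* (D :* V))
                   refl (s ^ deg) (ev low v) l μ ε (v ^ deg) ⟩
            s ^ deg * val - l * μ * ε * (s ^ deg * v ^ deg)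
              ≈⟨ +-cong s^-val (-‿cong (trans (*-congˡ s^v^) (*-assoc _ _ _))) ⟩
            l * μ - l * μ * (ε * ε)
              ≈⟨ +-congˡ (-‿cong (*-congˡ (-1^n*-1^n deg))) ⟩
            l * μ - l * μ * 1#
              ≈⟨ solve 2 (λ l μ → l :* μ :- l :* μ :* con 1ℤ := con 0ℤ) refl l μ ⟩
            0# ∎))))))

        μ-comaximal : ∀ k t → σ ≈ k * t → μ * ε ≈ 1# + k * (t * m₁ * ε)
        μ-comaximal k t σ≈ = begin
          (ε + σ * m₁) * ε
            ≈⟨ solve 3 (λ ε σ M → (ε :+ σ :* M) :* ε := ε :* ε :+ σ :* (M :* ε)) refl ε σ m₁ ⟩
          ε * ε + σ * (m₁ * ε)           ≈⟨ +-cong (-1^n*-1^n deg) (*-congʳ σ≈) ⟩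
          1# + k * t * (m₁ * ε)
            ≈⟨ solve 4 (λ k t M ε → con 1ℤ :+ k :* t :* (M :* ε) := con 1ℤ :+ k :* (t :* M :* ε)) refl k t m₁ ε ⟩
          1# + k * (t * m₁ * ε)          ∎

        strip : ∀ {k t} → S k → S t → σ ≈ k * t → ∀ N {y} → S y → μ ∣[ S ] k ^ N * y → μ ∣[ S ] y
        strip {k} {t} Sk St σ≈ = coprime-∣ S-sub Sk Sε (*∈ (*∈ St Sm₁) Sε) (μ-comaximal k t σ≈)

        nondivisor : ∀ N → ¬ 1# + s * a ∣[ S [ a ] ] h ^ N
        nondivisor N (_ , w∈ , eq) with S[a].*∈ w∈ (S[a].^∈ N Sy)
        ... | w , Sw , w≈ with D ← sub (mul (1# ∷ s ∷ []) w) ((h₀ ^ N) ∷ []) in D≡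
          with pseudo-divide S-sub deg low∈ l∈ low≤ D (≡.subst (All S) D≡ (sub∈ (mul∈ (1∈ ∷ Ss ∷ []) Sw) (^∈ N Sh₀ ∷ [])))
        ...   | k , u , r , Su , Sr , r≤ , _ , divide = μ-nonunit
            -- From the inside outwards, the powers of l, h₀ and σ are cancelled in turn until μ
            -- divides 1.
            (strip Sσ 1∈ (sym (*-identityʳ σ)) E 1∈ (resp∣ (sym (*-identityʳ _))
              (strip Sh₀ (*∈ l∈ (f∈ n)) (solve 3 (λ l h f → l :* (h :* f) := h :* (l :* f))
                   refl l h₀ (f n)) N (^∈ E Sσ)
                (strip l∈ (*∈ Sh₀ (f∈ n)) refl (k ℕ.+ E) (*∈ (^∈ N Sh₀) (^∈ E Sσ)) μ∣))))
          where
          resp∣ : ∀ {x y z} → y ≈ z → x ∣[ S ] y → x ∣[ S ] z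
          resp∣ y≈z (w , Sw , e) = w , Sw , trans e y≈z
          E = deg ℕ.+ length u
          ev-D : ∀ x → ev D x ≈ (1# + x * (s + x * 0#)) * ev w x - h₀ ^ N
          ev-D x = ≡.subst (λ D → ev D x ≈ (1# + x * (s + x * 0#)) * ev w x - h₀ ^ N) D≡
            (trans (ev-sub (mul (1# ∷ s ∷ []) w) _ x) (+-cong (ev-mul (1# ∷ s ∷ []) w x) (-‿cong (ev-const (h₀ ^ N) x))))
          D-root : ev D a ≈ 0#
          D-root = trans (ev-D a) (x≈y⇒x-y≈0 (begin
            (1# + a * (s + a * 0#)) * ev w a
              ≈⟨ *-cong (solve 2 (λ v s → con 1ℤ :+ v :* (s :+ v :* con 0ℤ) := con 1ℤ :+ s :* v) refl a s) w≈ ⟩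
            (1# + s * a) * (_ * y ^ N)          ≈⟨ *-assoc _ _ _ ⟨
            (1# + s * a) * _ * y ^ N            ≈⟨ *-congʳ eq ⟩
            h ^ N * y ^ N                       ≈⟨ ^-distrib-* h y N ⟨
            (h * y) ^ N                         ≈⟨ ^-congˡ N hy≈h₀ ⟩
            h₀ ^ N                              ∎))
          r-zero : AllZero r
          r-zero = minimal r Sr r≤ (begin
            ev r a                                             ≈⟨ +-identityˡ _ ⟨
            0# + ev r a                                        ≈⟨ +-congʳ (trans (*-congˡ root) (zeroʳ _)) ⟨
            ev u a * (ev low a + l * a ^ deg) + ev r a         ≈⟨ divide a ⟨
            l ^ k * ev D a                                     ≈⟨ trans (*-congˡ D-root) (zeroʳ _) ⟩
            0#                                                 ∎)
          -- At `v` the factor 1 + sv is 0, so of `D` only the term -h₀^N survives.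
          uv-val : ev u v * val ≈ l ^ k * - (h₀ ^ N)
          uv-val = begin
            ev u v * val                                       ≈⟨ +-identityʳ _ ⟨
            ev u v * val + 0#                                  ≈⟨ +-congˡ (ev-AllZero r-zero v) ⟨
            ev u v * val + ev r v                              ≈⟨ divide v ⟨
            l ^ k * ev D v                                     ≈⟨ *-congˡ (ev-D v) ⟩
            l ^ k * ((1# + v * (s + v * 0#)) * ev w v - h₀ ^ N)
              ≈⟨ *-congˡ (+-congʳ (*-congʳ (solve 2 (λ v s → con 1ℤ :+ v :* (s :+ v :* con 0ℤ) := con 1ℤ :+ s :* v)
                   refl v s))) ⟩
            l ^ k * ((1# + s * v) * ev w v - h₀ ^ N)
              ≈⟨ *-congˡ (+-congʳ (*-congʳ (+-congˡ sv≈-1))) ⟩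
            l ^ k * ((1# - 1#) * ev w v - h₀ ^ N)
              ≈⟨ *-congˡ (solve 2 (λ w H → (con 1ℤ :- con 1ℤ) :* w :- H := :- H) refl (ev w v) (h₀ ^ N)) ⟩
            l ^ k * - (h₀ ^ N)                                 ∎
          U = s ^ length u * ev u v
          SU : S U
          SU = homogenize S-sub Ss sv≈-1 (length u) u Su (ℕ.n≤1+n _)
          μ∣ : μ ∣[ S ] l ^ (k ℕ.+ E) * (h₀ ^ N * σ ^ E)
          μ∣ = - (l * U) , -∈ (*∈ l∈ SU) , (begin
            μ * - (l * (s ^ length u * ev u v))
              ≈⟨ solve 4 (λ μ l D U → μ :* :- (l :* (D :* U)) := :- (l :* μ :* (D :* U)))
                   refl μ l (s ^ length u) (ev u v) ⟩
            - (l * μ * (s ^ length u * ev u v))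
              ≈⟨ -‿cong (*-congʳ s^-val) ⟨
            - (s ^ deg * val * (s ^ length u * ev u v))
              ≈⟨ solve 4 (λ D V E U → :- (D :* V :* (E :* U)) := :- (D :* E :* (U :* V)))
                   refl (s ^ deg) val (s ^ length u) (ev u v) ⟩
            - (s ^ deg * s ^ length u * (ev u v * val))
              ≈⟨ -‿cong (*-cong (sym (^-homo-* s deg (length u))) uv-val) ⟩
            - (s ^ E * (l ^ k * - (h₀ ^ N)))
              ≈⟨ -‿cong (*-congʳ (^-distrib-* l σ E)) ⟩
            - (l ^ E * σ ^ E * (l ^ k * - (h₀ ^ N)))
              ≈⟨ solve 4 (λ A B C D → :- (A :* B :* (C :* :- D)) := C :* A :* (D :* B))
                   refl (l ^ E) (σ ^ E) (l ^ k) (h₀ ^ N) ⟩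
            l ^ k * l ^ E * (h₀ ^ N * σ ^ E)
              ≈⟨ *-congʳ (^-homo-* l k E) ⟨
            l ^ (k ℕ.+ E) * (h₀ ^ N * σ ^ E) ∎)

    linear-nondivisor : ∀ rs {b z} → ((S [ a ]) [ b ]) z → ¬ z ≈ 0# →
      ∃[ s ] S s × ¬ s ∈≈ rs × (∀ N → ¬ 1# + s * a ∣[ (S [ a ]) [ b ] ] z ^ N)
    linear-nondivisor rs z∈ z≉0
      with adjoin-conservative (adjoin-isSubring S-sub a) (f , f-inj , adjoin-⊆ ∘ f∈) z∈ z≉0
    ... | h , h∈ , h≉0 , conserve with choose
      where
      choose : ∃[ s ] S s × ¬ s ∈≈ rs × (∀ N → ¬ 1# + s * a ∣[ S [ a ] ] h ^ N)
      choose with em _ {Algebraic S a}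
      ... | yes alg   = linear-nondivisor-algebraic (minPoly S-sub alg) rs h∈ h≉0
      ... | no transc = linear-nondivisor-transcendental transc rs h∈ h≉0
    ... | s , Ss , s∉ , nondiv = s , Ss , s∉ , λ N div →
      let M , div′ = conserve (S[a].+∈ S[a].1∈ (S[a].*∈ (adjoin-⊆ Ss) (adjoin-∋ S-sub))) N div in nondiv M div′

-- Leading terms of products

module Degrees (em : ∀ ℓ → ExcludedMiddle ℓ) {c ℓ : Level}
               (R : CommutativeRing c ℓ) (isField : IsField R) where
  open CommutativeRing R
  open Exp commutativeSemiring using (_^_; ^-homo-*)
  open IntegerMultiples R
  open Solver
  open Polynomials R
  open FieldPolynomials em R isField
  open SetoidReasoning setoid

  length-mul : ∀ p q {m n} → length p ℕ.≤ m → length q ℕ.≤ n → length (mul p q) ℕ.≤ m ℕ.+ n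
  length-mul []      q         p≤       q≤ = z≤n
  length-mul (a ∷ p) q {suc m} (s≤s p≤) q≤ =
    length-add (scale a q) _ (length-scale a q (ℕ.≤-trans q≤ (ℕ.m≤n+m _ (suc m)))) (s≤s (length-mul p q p≤ q≤))

  HasLead : ∀ {p} → Pred Carrier p → ℕ → Carrier → (Carrier → Carrier) → Set (c ⊔ ℓ ⊔ p)
  HasLead S n l g = ∃[ low ] All S low × length low ℕ.≤ n × (∀ x → g x ≈ ev low x + l * x ^ n)

  has-lead : ∀ {p} {S : Pred Carrier p} → IsSubring S → ∀ q → All S q → ¬ AllZero q →
             ∃[ n ] ∃[ l ] suc n ℕ.≤ length q × S l × ¬ l ≈ 0# × HasLead S n l (ev q)
  has-lead S-sub [] _ q≢0 = ⊥-elim (q≢0 [])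
  has-lead S-sub (a ∷ q) (Sa ∷ Sq) q≢0 with em _ {AllZero q}
  ... | yes q0 = 0 , a , s≤s z≤n , Sa , (λ a≈0 → q≢0 (a≈0 ∷ q0)) , [] , [] , z≤n , λ x → begin
        a + x * ev q x   ≈⟨ +-congˡ (*-congˡ (ev-AllZero q0 x)) ⟩
        a + x * 0#       ≈⟨ solve 2 (λ a x → a :+ x :* con 0ℤ := con 0ℤ :+ a :* con 1ℤ) refl a x ⟩
        0# + a * 1#      ∎
  ... | no q≢0′ =
    let n , l , n≤ , Sl , l≉0 , low , Slow , low≤ , eq = has-lead S-sub q Sq q≢0′
    in suc n , l , s≤s n≤ , Sl , l≉0 , a ∷ low , Sa ∷ Slow , s≤s low≤ , λ x → begin
      a + x * ev q x                     ≈⟨ +-congˡ (*-congˡ (eq x)) ⟩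
      a + x * (ev low x + l * x ^ n)
        ≈⟨ solve 5 (λ a x L l X → a :+ x :* (L :+ l :* X) := (a :+ x :* L) :+ l :* (x :* X))
             refl a x (ev low x) l (x ^ n) ⟩
      (a + x * ev low x) + l * x ^ suc n ∎

  lead-mul : ∀ {p} {S : Pred Carrier p} → IsSubring S → ∀ {m n k l f g} → S k → S l →
             HasLead S m k f → HasLead S n l g → HasLead S (m ℕ.+ n) (k * l) (λ x → f x * g x)
  lead-mul S-sub {m} {n} {k} {l} {f} {g} Sk Sl (p , Sp , p≤ , ep) (q , Sq , q≤ , eq) =
    add (mul p q) (add (scale l (shift n p)) (scale k (shift m q))) ,
    add∈ (mul∈ Sp Sq) (add∈ (scale∈ Sl (shift∈ n Sp)) (scale∈ Sk (shift∈ m Sq))) ,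
    length-add (mul p q) _ (length-mul p q p≤ q≤)
      (length-add (scale l (shift n p)) _
        (length-scale l (shift n p) (ℕ.≤-trans (ℕ.≤-reflexive (length-shift n p))
          (ℕ.≤-trans (ℕ.+-monoʳ-≤ n p≤) (ℕ.≤-reflexive (ℕ.+-comm n m)))))
        (length-scale k (shift m q) (ℕ.≤-trans (ℕ.≤-reflexive (length-shift m q)) (ℕ.+-monoʳ-≤ m q≤)))) ,
    λ x → begin
      f x * g x
        ≈⟨ *-cong (ep x) (eq x) ⟩
      (ev p x + k * x ^ m) * (ev q x + l * x ^ n)
        ≈⟨ solve 6 (λ P k X Q l Y → (P :+ k :* X) :* (Q :+ l :* Y)
             := (P :* Q :+ (l :* (P :* Y) :+ k :* (Q :* X))) :+ k :* l :* (X :* Y)) refl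
             (ev p x) k (x ^ m) (ev q x) l (x ^ n) ⟩
      (ev p x * ev q x + (l * (ev p x * x ^ n) + k * (ev q x * x ^ m))) + k * l * (x ^ m * x ^ n)
        ≈⟨ +-cong (+-cong (ev-mul p q x) (+-cong (trans (ev-scale l (shift n p) x) (*-congˡ (ev-shift n p x)))
             (trans (ev-scale k (shift m q) x) (*-congˡ (ev-shift m q x))))) (*-congˡ (^-homo-* x m n)) ⟨
      (ev (mul p q) x + (ev (scale l (shift n p)) x + ev (scale k (shift m q)) x)) + k * l * x ^ (m ℕ.+ n)
        ≈⟨ +-congʳ (trans (ev-add (mul p q) _ x) (+-congˡ (ev-add (scale l (shift n p)) _ x))) ⟨
      ev (add (mul p q) (add (scale l (shift n p)) (scale k (shift m q)))) x + k * l * x ^ (m ℕ.+ n) ∎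
    where open IsSubring S-sub

  -- After subtraction of the constant a nonzero leading coefficient in positive degree remains, and
  -- such a polynomial cannot vanish on an infinite set.
  not-constant : ∀ {p q} {S : Pred Carrier p} {T : Pred Carrier q} → Infinite T →
                 ∀ {n l g a} → ¬ l ≈ 0# → HasLead S (suc n) l g → ¬ (∀ x → T x → g x ≈ a)
  not-constant {T = T} T-inf {n} {l} {g} {a} l≉0 (low , _ , low≤ , e) const =
    let v , Sv , qv≉0 = nonvanishing {S = T} T-inf q
          (l≉0 ∘ lead≈0 (sub low (a ∷ [])) (suc n) l (length-add low _ low≤ (s≤s z≤n)))
    in qv≉0 (begin
      ev q v                                      ≈⟨ trans (ev-add (sub low (a ∷ [])) _ v)
                                                       (+-cong (trans (ev-sub low _ v) (+-congˡ (-‿cong (ev-const a v)))) (ev-mono (suc n) l v)) ⟩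
      (ev low v - a) + l * v ^ suc n
        ≈⟨ solve 4 (λ L a l V → (L :- a) :+ l :* V := (L :+ l :* V) :- a) refl (ev low v) a l (v ^ suc n) ⟩
      (ev low v + l * v ^ suc n) - a              ≈⟨ x≈y⇒x-y≈0 (trans (sym (e v)) (const v Sv)) ⟩
      0#                                          ∎)
    where
    q = add (sub low (a ∷ [])) (mono (suc n) l)

-- An infinite subring with finitely many units

module SmallSubring (em : ∀ ℓ → ExcludedMiddle ℓ) {c ℓ : Level}
                    (R : CommutativeRing c ℓ) (isField : IsField R) where
  open CommutativeRing R
  open Exp commutativeSemiring using (_^_; ^-homo-*)
  open IntegerMultiples R
  open SemiringMult′ semiring using () renaming (_×_ to _×′_; 1+× to 1+×′)
  open Solver
  open Polynomials R
  open FieldPolynomials em R isField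
  open Nondivisors em R isField using (FiniteUnits; neg-inv; neg-inv-*; neg-inv-unique; reduce)
  open Degrees em R isField
  open SetoidReasoning setoid

  -- Lifted so that the prime ring and `ℤ-image [ t ]` live at one level, as the case distinction in
  -- `small-subring` demands.
  ℤ-image : Pred Carrier (c ⊔ ℓ)
  ℤ-image x = Lift c (∃[ i ] fromℤ i ≈ x)

  ℤ-image-isSubring : IsSubring ℤ-image
  ℤ-image-isSubring = record
    { resp = λ { x≈y (lift (i , e)) → lift (i , trans e x≈y) }
    ; 0∈   = lift (0ℤ , refl)
    ; 1∈   = lift (1ℤ , refl)
    ; +∈   = λ { (lift (i , e)) (lift (j , e′)) → lift (i ℤ.+ j , trans (fromℤ-+ i j) (+-cong e e′)) }
    ; *∈   = λ { (lift (i , e)) (lift (j , e′)) → lift (i ℤ.* j , trans (fromℤ-* i j) (*-cong e e′)) }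
    ; -∈   = λ { (lift (i , e)) → lift (ℤ.- i , trans (fromℤ-neg i) (-‿cong e)) }
    }

  ℤ-image-least : ∀ {q} {T : Pred Carrier q} → IsSubring T → ∀ {x} → ℤ-image x → T x
  ℤ-image-least {T = T} T-sub (lift (i , e)) = resp e (go i)
    where
    open IsSubring T-sub
    nat : ∀ n → T (n ×′ 1#)
    nat zero    = 0∈
    nat (suc n) = resp (sym (1+×′ n 1#)) (+∈ 1∈ (nat n))
    go : ∀ i → T (fromℤ i)
    go (+ n)    = nat n
    go -[1+ n ] = -∈ (nat (suc n))

  module CharacteristicZero (char0 : ∀ n → ¬ suc n ×′ 1# ≈ 0#) where

    fromℤ≈0 : ∀ i → fromℤ i ≈ 0# → i ≡ 0ℤ
    fromℤ≈0 (+ zero)  e = ≡.refl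
    fromℤ≈0 (+ suc n) e = ⊥-elim (char0 n e)
    fromℤ≈0 -[1+ n ]  e = ⊥-elim (char0 n (begin
      suc n ×′ 1#       ≈⟨ solve 1 (λ x → x := :- (:- x)) refl _ ⟩
      - - (suc n ×′ 1#) ≈⟨ -‿cong e ⟩
      - 0#              ≈⟨ solve 0 (:- con 0ℤ := con 0ℤ) refl ⟩
      0#                ∎))

    fromℤ-injective : ∀ {i j} → fromℤ i ≈ fromℤ j → i ≡ j
    fromℤ-injective {i} {j} e = ℤ.i-j≡0⇒i≡j i j (fromℤ≈0 (i ℤ.- j)
      (trans (fromℤ-+ i (ℤ.- j)) (trans (+-congˡ (fromℤ-neg j)) (x≈y⇒x-y≈0 e))))

    infinite : Infinite ℤ-image
    infinite = fromℤ ∘ +_ , ℤ.+-injective ∘ fromℤ-injective , λ n → lift (+ n , refl)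

    finiteUnits : FiniteUnits ℤ-image
    finiteUnits = 1# ∷ - 1# ∷ [] , λ { u (lift (i , iu)) (w , lift (j , jw) , uw≈1) →
      unit i iu (ℕ.m*n≡1⇒m≡1 ℤ.∣ i ∣ ℤ.∣ j ∣ (≡.trans (≡.sym (ℤ.abs-* i j)) (≡.cong ℤ.∣_∣
        (fromℤ-injective {i ℤ.* j} {1ℤ} (trans (fromℤ-* i j) (trans (*-cong iu jw) uw≈1)))))) }
      where
      unit : ∀ {u} i → fromℤ i ≈ u → ℤ.∣ i ∣ ≡ 1 → u ∈≈ 1# ∷ - 1# ∷ []
      unit (+ 1)     e ≡.refl = here (sym e)
      unit -[1+ 0 ]  e ≡.refl = there (here (sym e))

  module PositiveCharacteristic (k : ℕ) (char : suc k ×′ 1# ≈ 0#)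
                                (t : Carrier) (t≉0 : ¬ t ≈ 0#) (t^≉1 : ∀ n → ¬ t ^ suc n ≈ 1#) where
    N : ℕ
    N = suc k

    elements : List Carrier
    elements = tabulate {n = N} (λ r → fromℤ (+ toℕ r))

    -- Division with remainder by `N`, any positive multiple of the characteristic.
    ℤ-image-finite : ∀ {x} → ℤ-image x → x ∈≈ elements
    ℤ-image-finite {x} (lift (i , e)) = Any.tabulate⁺ {f = λ (r : Fin N) → fromℤ (+ toℕ r)} (fromℕ< r<N) (begin
      x                                         ≈⟨ e ⟨
      fromℤ i                                   ≡⟨ ≡.cong fromℤ (ℤ.a≡a%ℕn+[a/ℕn]*n i N) ⟩
      fromℤ (+ r ℤ.+ q ℤ.* + N)
        ≈⟨ trans (fromℤ-+ (+ r) (q ℤ.* + N)) (+-congˡ (fromℤ-* q (+ N))) ⟩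
      fromℤ (+ r) + fromℤ q * (N ×′ 1#)         ≈⟨ +-congˡ (trans (*-congˡ char) (zeroʳ _)) ⟩
      fromℤ (+ r) + 0#                          ≈⟨ +-identityʳ _ ⟩
      fromℤ (+ r)                               ≡⟨ ≡.cong (λ j → fromℤ (+ j)) (Fin.toℕ-fromℕ< r<N) ⟨
      fromℤ (+ toℕ (fromℕ< r<N))                ∎)
      where
      r = i ℤ.%ℕ N
      q = i ℤ./ℕ N
      r<N : r ℕ.< N
      r<N = ℤ.n%ℕd<d i N

    t^-distinct : ∀ {i j} → i ℕ.< j → ¬ t ^ i ≈ t ^ j
    t^-distinct {i} i<j e with o , ≡.refl ← ℕ.m≤n⇒∃[o]m+o≡n i<j = t^≉1 o (cancel (^≉0 i t≉0) (begin
      t ^ i * t ^ suc o       ≈⟨ ^-homo-* t i (suc o) ⟨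
      t ^ (i ℕ.+ suc o)       ≡⟨ ≡.cong (t ^_) (ℕ.+-suc i o) ⟩
      t ^ suc (i ℕ.+ o)       ≈⟨ e ⟨
      t ^ i                   ≈⟨ *-identityʳ _ ⟨
      t ^ i * 1#              ∎))

    t^-injective : Injection (t ^_)
    t^-injective {i} {j} e with ℕ.<-cmp i j
    ... | tri< i<j _ _ = ⊥-elim (t^-distinct i<j e)
    ... | tri≈ _ i≡j _ = i≡j
    ... | tri> _ _ j<i = ⊥-elim (t^-distinct j<i (sym e))

    remainders : ∀ d → ∃[ xs ] (∀ r → All ℤ-image r → length r ℕ.≤ d → ev r t ∈≈ xs)
    remainders zero    = 0# ∷ [] , λ { [] _ _ → here refl }
    remainders (suc d) = let xs , all = remainders d in
      0# ∷ cartesianProductWith (λ a y → a + t * y) elements xs , λ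
        { [] _ _ → here refl
        ; (a ∷ r) (Pa ∷ Pr) (s≤s len) → there (Any.cartesianProductWith⁺ _
            (λ a≈ y≈ → +-cong a≈ (*-congˡ y≈)) (ℤ-image-finite Pa) (all r Pr len)) }

    -- Over the finite prime ring there are finitely many remainders below the degree of `t` and
    -- finitely many powers of the leading coefficient. Each power of `t` is a quotient of the
    -- former by the latter; `f a y` is y / a.
    t^-finite : MinPoly ℤ-image t → ∃[ xs ] (∀ n → t ^ n ∈≈ xs)
    t^-finite m = cartesianProductWith f elements (proj₁ (remainders deg)) , t^n∈
      where
      open MinPoly m
      f : Carrier → Carrier → Carrier
      f a y = - neg-inv a * y
      quotient≈ : ∀ {L z r a y} → ¬ L ≈ 0# → L * z ≈ r → L ≈ a → r ≈ y → z ≈ f a y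
      quotient≈ {L} {z} {r} {a} {y} L≉0 e L≈a r≈y = begin
        z                              ≈⟨ solve 1 (λ z → z := :- (:- con 1ℤ) :* z) refl z ⟩
        - - 1# * z                     ≈⟨ *-congʳ (-‿cong (neg-inv-* L≉0)) ⟨
        - (neg-inv L * L) * z
          ≈⟨ solve 3 (λ s l z → :- (s :* l) :* z := :- s :* (l :* z)) refl (neg-inv L) L z ⟩
        - neg-inv L * (L * z)          ≈⟨ *-cong (-‿cong (neg-inv-unique (neg-inv-* L≉0) L≈a)) (trans e r≈y) ⟩
        - neg-inv a * y                ∎
      t^n∈ : ∀ n → t ^ n ∈≈ cartesianProductWith f elements (proj₁ (remainders deg))
      t^n∈ n =
        let j , r , Pr , r≤ , e = reduce ℤ-image-isSubring m
                  (IsSubring.^∈ (adjoin-isSubring ℤ-image-isSubring t) n (adjoin-∋ ℤ-image-isSubring))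
        in Any.cartesianProductWith⁺ f (quotient≈ (^≉0 j lead≉0) e)
             (ℤ-image-finite (IsSubring.^∈ ℤ-image-isSubring j lead∈)) (proj₂ (remainders deg) r Pr r≤)

    t-transcendental : ¬ Algebraic ℤ-image t
    t-transcendental alg =
      let xs , t^∈ = t^-finite (minPoly ℤ-image-isSubring alg)
          n , t^n∉ = avoid t^-injective xs
      in t^n∉ (t^∈ n)

    infinite : Infinite (ℤ-image [ t ])
    infinite = t ^_ , t^-injective , λ n → IsSubring.^∈ (adjoin-isSubring ℤ-image-isSubring t) n (adjoin-∋ ℤ-image-isSubring)

    -- Since `t` is transcendental, p(t) q(t) = 1 holds identically; comparing degrees makes `p`
    -- constant, so the units lie in the finite prime ring.
    finiteUnits : FiniteUnits (ℤ-image [ t ])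
    finiteUnits = elements , λ { u (p , Sp , pt≈u) (w , (q , Sq , qt≈w) , uw≈1) → unit p Sp pt≈u q Sq
      (trans (*-cong pt≈u qt≈w) uw≈1) }
      where
      open IsSubring ℤ-image-isSubring
      unit : ∀ {u} p → All ℤ-image p → ev p t ≈ u → ∀ q → All ℤ-image q → ev p t * ev q t ≈ 1# → u ∈≈ elements
      unit {u} p Sp pt≈u q Sq pq≈1 = go (has-lead ℤ-image-isSubring p Sp p≢0) (has-lead ℤ-image-isSubring q Sq q≢0)
        where
        D = sub (mul p q) (1# ∷ [])
        ev-D : ∀ x → ev D x ≈ ev p x * ev q x - 1#
        ev-D x = trans (ev-sub (mul p q) _ x) (+-cong (ev-mul p q x) (-‿cong (ev-const 1# x)))
        D0 : AllZero D
        D0 = transcendental t-transcendental D (sub∈ (mul∈ Sp Sq) (1∈ ∷ [])) (trans (ev-D t) (x≈y⇒x-y≈0 pq≈1))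
        pq≈1′ : ∀ x → ev p x * ev q x ≈ 1#
        pq≈1′ x = x-y≈0⇒x≈y (trans (sym (ev-D x)) (ev-AllZero D0 x))
        p≢0 : ¬ AllZero p
        p≢0 p0 = 1≉0 (trans (sym pq≈1) (trans (*-congʳ (ev-AllZero p0 t)) (zeroˡ _)))
        q≢0 : ¬ AllZero q
        q≢0 q0 = 1≉0 (trans (sym pq≈1) (trans (*-congˡ (ev-AllZero q0 t)) (zeroʳ _)))
        go : ∃[ n ] ∃[ l ] suc n ℕ.≤ length p × ℤ-image l × ¬ l ≈ 0# × HasLead ℤ-image n l (ev p) →
             ∃[ n ] ∃[ l ] suc n ℕ.≤ length q × ℤ-image l × ¬ l ≈ 0# × HasLead ℤ-image n l (ev q) → u ∈≈ elements
        go (zero , l , _ , Sl , _ , [] , _ , _ , e) _ =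
          ℤ-image-finite (resp (trans (sym (trans (e t) (trans (+-identityˡ _) (*-identityʳ l)))) pt≈u) Sl)
        go (suc m , k , _ , Sk , k≉0 , p-lead) (n , l , _ , Sl , l≉0 , q-lead) =
          ⊥-elim (not-constant {T = ℤ-image [ t ]} infinite (*≉0 k≉0 l≉0) (lead-mul ℤ-image-isSubring Sk Sl p-lead q-lead) (λ x _ → pq≈1′ x))

  -- The last component says that `S` lies in every subring containing `t`; it later places `S`
  -- inside the image of the base field.
  small-subring : ∀ {q} t → ¬ t ≈ 0# → (∀ n → ¬ t ^ suc n ≈ 1#) →
    ∃[ S ] IsSubring {c ⊔ ℓ} S × Infinite S × FiniteUnits S ×
           ((T : Pred Carrier q) → IsSubring T → T t → ∀ {x} → S x → T x)
  small-subring t t≉0 t^≉1 with em _ {∃[ k ] suc k ×′ 1# ≈ 0#}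
  ... | no char0 = ℤ-image , ℤ-image-isSubring , infinite , finiteUnits , λ T T-sub _ → ℤ-image-least T-sub
    where open CharacteristicZero (λ n e → char0 (n , e))
  ... | yes (k , char) = ℤ-image [ t ] , adjoin-isSubring ℤ-image-isSubring t , infinite , finiteUnits ,
                         λ T T-sub Tt → adjoin-least T-sub (ℤ-image-least T-sub) Tt
    where open PositiveCharacteristic k char t t≉0 t^≉1

-- Euclid's argument in a small subring

module UnitChains (em : ∀ ℓ → ExcludedMiddle ℓ) {c ℓ : Level}
                  (R : CommutativeRing c ℓ) (isField : IsField R) where
  open CommutativeRing R
  open Exp commutativeSemiring using (_^_; ^-homo-*)
  open IntegerMultiples R
  open Solver
  open Polynomials R
  open FieldPolynomials em R isField
  open Nondivisors em R isField using (FiniteUnits)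
  open SetoidReasoning setoid
  private module Rˣ = AbelianGroup (R ˣ)
  open Rank em (R ˣ) using (IsSubgroup; ⟨⟩-least; Clˡ; extend⇒infinite)
  open CommutativeMonoidMult Rˣ.commutativeMonoid using () renaming (_×_ to _·ℕ_)

  value : Rˣ.Carrier → Carrier
  value = proj₁

  unit : ∀ {x} → ¬ x ≈ 0# → Rˣ.Carrier
  unit {x} x≉0 = x , proj₂ isField x x≉0

  value-⁻¹ : ∀ u → value u * value (u Rˣ.⁻¹) ≈ 1#
  value-⁻¹ (_ , _ , _ , xx′≈1) = xx′≈1

  value≉0 : ∀ u → ¬ value u ≈ 0#
  value≉0 u u≈0 = 1≉0 (trans (sym (value-⁻¹ u)) (trans (*-congʳ u≈0) (zeroˡ _)))

  value-·ℕ : ∀ n u → value (n ·ℕ u) ≈ value u ^ n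
  value-·ℕ zero    u = refl
  value-·ℕ (suc n) u = *-congˡ (value-·ℕ n u)

  module _ {p} {S : Pred Carrier p} (S-sub : IsSubring S) (S-inf : Infinite S) (S-units : FiniteUnits S) where
    open IsSubring S-sub

    UnitIn[1/_] : Carrier → Pred Rˣ.Carrier p
    UnitIn[1/ z ] u = ∃[ N ] S (z ^ N * value u) × S (z ^ N * value (u Rˣ.⁻¹))

    UnitIn[1/]-isSubgroup : ∀ z → IsSubgroup UnitIn[1/ z ]
    UnitIn[1/]-isSubgroup z = record
      { resp = λ { {u} {v} u≈v (N , a , b) → N , resp (*-congˡ u≈v) a , resp (*-congˡ (Rˣ.⁻¹-cong {u} {v} u≈v)) b }
      ; ε∈   = 0 , *∈ 1∈ 1∈ , *∈ 1∈ 1∈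
      ; ∙∈   = λ { (N , a , b) (M , a′ , b′) → N ℕ.+ M , merge N M a a′ , merge N M b b′ }
      ; ⁻¹∈  = λ { (N , a , b) → N , b , a }
      }
      where
      merge : ∀ N M {x y} → S (z ^ N * x) → S (z ^ M * y) → S (z ^ (N ℕ.+ M) * (x * y))
      merge N M {x} {y} a b = resp (begin
        z ^ N * x * (z ^ M * y)
          ≈⟨ solve 4 (λ A x B y → A :* x :* (B :* y) := A :* B :* (x :* y)) refl (z ^ N) x (z ^ M) y ⟩
        z ^ N * z ^ M * (x * y)     ≈⟨ *-congʳ (^-homo-* z N M) ⟨
        z ^ (N ℕ.+ M) * (x * y)     ∎) (*∈ a b)

    product-values : ∀ ys → All (S ∘ value) ys →
                     ∃[ z ] S z × ¬ z ≈ 0# × (∀ {y} → y ∈ˡ ys → ∃[ r ] S r × z ≈ value y * r)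
    product-values []       []         = 1# , 1∈ , 1≉0 , λ ()
    product-values (y ∷ ys) (Sy ∷ Sys) =
      let z , Sz , z≉0 , factor = product-values ys Sys
      in value y * z , *∈ Sy Sz , *≉0 (value≉0 y) z≉0 , λ
        { (here ≡.refl) → z , Sz , refl
        ; (there y′∈)  → let r , Sr , e = factor y′∈ in
            value y * r , *∈ Sy Sr , trans (*-congˡ e) (solve 3 (λ a b c → a :* (b :* c) := b :* (a :* c))
                 refl _ _ _) }

    -- Euclid's argument: 1 + zc is prime to the product z of the given
    -- elements, and is not a unit of S for a suitable c.
    extend-units : ∀ ys → All (S ∘ value) ys → ∃[ y ] S (value y) × ¬ Clˡ ys y
    extend-units ys Sys with product-values ys Sys
    ... | z , Sz , z≉0 , factor
      -- Avoiding 0 makes the new element invertible in the field; avoiding the listed units makes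
      -- it a nonunit of `S`.
      with avoid {λ n → 1# + z * proj₁ S-inf n} (proj₁ (proj₂ S-inf) ∘ cancel z≉0 ∘ +-cancelˡ 1# _ _) (0# ∷ proj₁ S-units)
      where open GroupProperties +-group using () renaming (∙-cancelˡ to +-cancelˡ)
    ...   | n , x∉ = y , Sx , not-in-closure
      where
      c₀ = proj₁ S-inf n
      x = 1# + z * c₀
      Sc₀ = proj₂ (proj₂ S-inf) n
      Sx : S x
      Sx = +∈ 1∈ (*∈ Sz Sc₀)
      y : Rˣ.Carrier
      y = unit {x} (x∉ ∘ here)
      gens : ∀ {u} → u ∈ˡ ys → UnitIn[1/ z ] u
      gens {u} u∈ = let r , Sr , e = factor u∈ in
        1 , *∈ (*∈ Sz 1∈) (All.lookup Sys u∈) , resp (begin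
          r                                          ≈⟨ *-identityˡ r ⟨
          1# * r                                     ≈⟨ *-congʳ (value-⁻¹ u) ⟨
          value u * value (u Rˣ.⁻¹) * r
            ≈⟨ solve 3 (λ a b r → a :* b :* r := a :* r :* con 1ℤ :* b) refl (value u) (value (u Rˣ.⁻¹)) r ⟩
          value u * r * 1# * value (u Rˣ.⁻¹)         ≈⟨ *-congʳ (*-congʳ e) ⟨
          z * 1# * value (u Rˣ.⁻¹)                   ∎) Sr
      -- The old elements divide `z`, hence are units of S[1/z]. If a positive power of `x` were one
      -- too, `x` would divide a power of `z` in `S`; being prime to `z`, it would then be a unit of
      -- `S`.
      not-in-closure : ¬ Clˡ ys y
      not-in-closure (m , ym∈) with ⟨⟩-least (UnitIn[1/]-isSubgroup z) gens ym∈
      ... | N , _ , Sw = x∉ (there (proj₂ S-units x Sx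
              (coprime-∣ S-sub Sz 1∈ Sc₀ (*-identityʳ x) N 1∈ (x ^ m * (z ^ N * w) , *∈ (^∈ m Sx) Sw , (begin
                x * (x ^ m * (z ^ N * w))
                  ≈⟨ solve 4 (λ x X Z w → x :* (X :* (Z :* w)) := Z :* (x :* X :* w)) refl x (x ^ m) (z ^ N) w ⟩
                z ^ N * (x * x ^ m * w)
                  ≈⟨ *-congˡ (trans (*-congʳ (sym (value-·ℕ (suc m) y))) (value-⁻¹ (suc m ·ℕ y))) ⟩
                z ^ N * 1#                    ∎)))))
        where w = value ((suc m ·ℕ y) Rˣ.⁻¹)

    units-rank-infinite : RankInfinite (R ˣ)
    units-rank-infinite = extend⇒infinite (S ∘ value) extend-units

-- Adjoining a root of a nonconstant polynomial

module SimpleExtension (em : ∀ ℓ → ExcludedMiddle ℓ) {c ℓ : Level}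
                       (K : CommutativeRing c ℓ) (isField : IsField K) where
  open CommutativeRing K
  open Classical em
  open Exp commutativeSemiring using (_^_)
  open IntegerMultiples K
  open Solver
  open Polynomials K
  open FieldPolynomials em K isField
  open Degrees em K isField
  open SetoidReasoning setoid

  everything : Pred Carrier ℓ
  everything _ = ⊤

  everything-isSubring : IsSubring everything
  everything-isSubring = record
    { resp = λ _ _ → tt ; 0∈ = tt ; 1∈ = tt ; +∈ = λ _ _ → tt ; *∈ = λ _ _ → tt ; -∈ = λ _ → tt }

  all∈ : ∀ p → All everything p
  all∈ p = All.universal (λ _ → tt) p

  Constant : List Carrier → Set (c ⊔ ℓ)
  Constant []      = ⊤
  Constant (a ∷ p) = AllZero p

  AllZero⇒Constant : ∀ p → AllZero p → Constant p
  AllZero⇒Constant []      _       = tt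
  AllZero⇒Constant (_ ∷ _) (_ ∷ z) = z

  infix 4 _∣ᵖ_
  -- Over an infinite field this pointwise form is divisibility of polynomials, and it is
  -- indifferent to trailing zeros.
  _∣ᵖ_ : List Carrier → List Carrier → Set (c ⊔ ℓ)
  q ∣ᵖ r = ∃[ w ] (∀ x → ev r x ≈ ev q x * ev w x)

  module _ (K-inf : Infinite everything) (r : List Carrier) (r-nonconst : ¬ Constant r) where

    -- Irreducibility is recorded only as leastness of the length among nonconstant divisors of `r`,
    -- the form in which inverses are found.
    irreducible-factor : ∃[ q ] ¬ Constant q × q ∣ᵖ r × (∀ g → ¬ Constant g → g ∣ᵖ r → length q ℕ.≤ length g)
    irreducible-factor with least (λ n → ∃[ q ] length q ≡ n × ¬ Constant q × q ∣ᵖ r)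
      (length r , r , ≡.refl , r-nonconst , 1# ∷ [] , λ x → sym (trans (*-congˡ (ev-const 1# x)) (*-identityʳ _)))
    ... | n , (q , ≡.refl , nc , q∣r) , min = q , nc , q∣r , λ g nc′ g∣r → min (length g) (g , ≡.refl , nc′ , g∣r)

    record Lead (q : List Carrier) : Set (c ⊔ ℓ) where
      field
        e    : ℕ
        κ    : Carrier
        κ≉0  : ¬ κ ≈ 0#
        low  : List Carrier
        low≤ : length low ℕ.≤ suc e
        len  : length q ≡ suc (suc e)
        eq   : ∀ x → ev q x ≈ ev low x + κ * x ^ suc e

    -- A zero top coefficient could be dropped, leaving a shorter nonconstant divisor of `r`.
    least⇒lead : ∀ q → ¬ Constant q → q ∣ᵖ r → (∀ g → ¬ Constant g → g ∣ᵖ r → length q ℕ.≤ length g) → Lead q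
    least⇒lead []       nc _ _ = ⊥-elim (nc tt)
    least⇒lead (a ∷ []) nc _ _ = ⊥-elim (nc [])
    least⇒lead (a ∷ p@(a′ ∷ p′)) nc (w , e) q-least
      with split-last {S = everything} tt (length p′) p (all∈ p) ℕ.≤-refl
    ... | low , κ , _ , _ , low≤ , eq , zeros = record
      { e = length p′ ; κ = κ ; κ≉0 = κ≉0 ; low = a ∷ low ; low≤ = s≤s low≤ ; len = ≡.refl ; eq = eq′ }
      where
      eq′ : ∀ x → ev (a ∷ p) x ≈ ev (a ∷ low) x + κ * x ^ suc (length p′)
      eq′ x = trans (+-congˡ (*-congˡ (eq x)))
        (solve 5 (λ a x L k X → a :+ x :* (L :+ k :* X) := (a :+ x :* L) :+ k :* (x :* X))
             refl a x (ev low x) κ (x ^ length p′))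
      κ≉0 : ¬ κ ≈ 0#
      κ≉0 κ≈0 = ℕ.<⇒≱ (s≤s (s≤s low≤)) (q-least (a ∷ low) (λ low0 → nc (zeros low0 κ≈0))
        (w , λ x → trans (e x) (*-congʳ (trans (eq′ x) (trans (+-congˡ (trans (*-congʳ κ≈0) (zeroˡ _))) (+-identityʳ _))))))

    module Quotient (q : List Carrier) (q-nonconst : ¬ Constant q) (q∣r : q ∣ᵖ r)
                    (q-least : ∀ g → ¬ Constant g → g ∣ᵖ r → length q ℕ.≤ length g) where

      infix 4 _∼_
      record _∼_ (u v : List Carrier) : Set (c ⊔ ℓ) where
        constructor _,_
        field
          factor : List Carrier
          difference : ∀ x → ev u x - ev v x ≈ ev q x * ev factor x

      pointwise : ∀ {u v} → (∀ x → ev u x ≈ ev v x) → u ∼ v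
      pointwise e = [] , λ x → trans (x≈y⇒x-y≈0 (e x)) (sym (zeroʳ _))

      neg : List Carrier → List Carrier
      neg = scale (- 1#)

      ev-neg : ∀ p x → ev (neg p) x ≈ - ev p x
      ev-neg p x = trans (ev-scale (- 1#) p x) (solve 1 (λ p → :- con 1ℤ :* p := :- p) refl (ev p x))

      ∼-sym : ∀ {u v} → u ∼ v → v ∼ u
      ∼-sym {u} {v} (w , e) = neg w , λ x → begin
        ev v x - ev u x         ≈⟨ solve 2 (λ u v → v :- u := :- (u :- v)) refl (ev u x) (ev v x) ⟩
        - (ev u x - ev v x)     ≈⟨ -‿cong (e x) ⟩
        - (ev q x * ev w x)     ≈⟨ solve 2 (λ q w → :- (q :* w) := q :* :- w) refl (ev q x) (ev w x) ⟩
        ev q x * - ev w x       ≈⟨ *-congˡ (ev-neg w x) ⟨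
        ev q x * ev (neg w) x   ∎

      ∼-trans : ∀ {u v t} → u ∼ v → v ∼ t → u ∼ t
      ∼-trans {u} {v} {t} (w , e) (w′ , e′) = add w w′ , λ x → begin
        ev u x - ev t x
          ≈⟨ solve 3 (λ u v t → u :- t := (u :- v) :+ (v :- t)) refl (ev u x) (ev v x) (ev t x) ⟩
        (ev u x - ev v x) + (ev v x - ev t x) ≈⟨ +-cong (e x) (e′ x) ⟩
        ev q x * ev w x + ev q x * ev w′ x    ≈⟨ distribˡ _ _ _ ⟨
        ev q x * (ev w x + ev w′ x)           ≈⟨ *-congˡ (ev-add w w′ x) ⟨
        ev q x * ev (add w w′) x              ∎

      add-cong : ∀ {u u′ v v′} → u ∼ u′ → v ∼ v′ → add u v ∼ add u′ v′
      add-cong {u} {u′} {v} {v′} (w , e) (w′ , e′) = add w w′ , λ x → begin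
        ev (add u v) x - ev (add u′ v′) x            ≈⟨ +-cong (ev-add u v x) (-‿cong (ev-add u′ v′ x)) ⟩
        (ev u x + ev v x) - (ev u′ x + ev v′ x)
          ≈⟨ solve 4 (λ u u′ v v′ → (u :+ v) :- (u′ :+ v′) := (u :- u′) :+ (v :- v′))
               refl (ev u x) (ev u′ x) (ev v x) (ev v′ x) ⟩
        (ev u x - ev u′ x) + (ev v x - ev v′ x)      ≈⟨ +-cong (e x) (e′ x) ⟩
        ev q x * ev w x + ev q x * ev w′ x           ≈⟨ distribˡ _ _ _ ⟨
        ev q x * (ev w x + ev w′ x)                  ≈⟨ *-congˡ (ev-add w w′ x) ⟨
        ev q x * ev (add w w′) x                     ∎

      mul-cong : ∀ {u u′ v v′} → u ∼ u′ → v ∼ v′ → mul u v ∼ mul u′ v′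
      mul-cong {u} {u′} {v} {v′} (w , e) (w′ , e′) = add (mul w v) (mul u′ w′) , λ x → begin
        ev (mul u v) x - ev (mul u′ v′) x            ≈⟨ +-cong (ev-mul u v x) (-‿cong (ev-mul u′ v′ x)) ⟩
        ev u x * ev v x - ev u′ x * ev v′ x
          ≈⟨ solve 4 (λ u u′ v v′ → u :* v :- u′ :* v′ := (u :- u′) :* v :+ u′ :* (v :- v′))
               refl (ev u x) (ev u′ x) (ev v x) (ev v′ x) ⟩
        (ev u x - ev u′ x) * ev v x + ev u′ x * (ev v x - ev v′ x)
                                                     ≈⟨ +-cong (*-congʳ (e x)) (*-congˡ (e′ x)) ⟩
        ev q x * ev w x * ev v x + ev u′ x * (ev q x * ev w′ x)
                                                     ≈⟨ solve 5 (λ q w v u w′ → q :* w :* v :+ u :* (q :* w′) := q :* (w :* v :+ u :* w′))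
                                                          refl (ev q x) (ev w x) (ev v x) (ev u′ x) (ev w′ x) ⟩
        ev q x * (ev w x * ev v x + ev u′ x * ev w′ x)
          ≈⟨ *-congˡ (trans (ev-add (mul w v) _ x) (+-cong (ev-mul w v x) (ev-mul u′ w′ x))) ⟨
        ev q x * ev (add (mul w v) (mul u′ w′)) x    ∎

      neg-cong : ∀ {u v} → u ∼ v → neg u ∼ neg v
      neg-cong {u} {v} (w , e) = neg w , λ x → begin
        ev (neg u) x - ev (neg v) x     ≈⟨ +-cong (ev-neg u x) (-‿cong (ev-neg v x)) ⟩
        - ev u x - - ev v x
          ≈⟨ solve 2 (λ u v → :- u :- :- v := :- (u :- v)) refl (ev u x) (ev v x) ⟩
        - (ev u x - ev v x)             ≈⟨ -‿cong (e x) ⟩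
        - (ev q x * ev w x)             ≈⟨ solve 2 (λ q w → :- (q :* w) := q :* :- w) refl (ev q x) (ev w x) ⟩
        ev q x * - ev w x               ≈⟨ *-congˡ (ev-neg w x) ⟨
        ev q x * ev (neg w) x           ∎

      one : List Carrier
      one = 1# ∷ []

      mul-comm : ∀ u v → mul u v ∼ mul v u
      mul-comm u v = pointwise λ x → trans (ev-mul u v x) (trans (*-comm _ _) (sym (ev-mul v u x)))

      add-comm : ∀ u v → add u v ∼ add v u
      add-comm u v = pointwise λ x → trans (ev-add u v x) (trans (+-comm _ _) (sym (ev-add v u x)))

      one-mul : ∀ u → mul one u ∼ u
      one-mul u = pointwise λ x → trans (ev-mul one u x) (trans (*-congʳ (ev-const 1# x)) (*-identityˡ _))

      neg-add : ∀ u → add (neg u) u ∼ []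
      neg-add u = pointwise λ x → trans (ev-add (neg u) u x) (trans (+-congʳ (ev-neg u x)) (-‿inverseˡ _))

      mul-add : ∀ u v t → mul u (add v t) ∼ add (mul u v) (mul u t)
      mul-add u v t = pointwise λ x → begin
        ev (mul u (add v t)) x              ≈⟨ trans (ev-mul u _ x) (*-congˡ (ev-add v t x)) ⟩
        ev u x * (ev v x + ev t x)          ≈⟨ distribˡ _ _ _ ⟩
        ev u x * ev v x + ev u x * ev t x
          ≈⟨ trans (ev-add (mul u v) _ x) (+-cong (ev-mul u v x) (ev-mul u t x)) ⟨
        ev (add (mul u v) (mul u t)) x      ∎

      -- The ring K[X]/(q), with arbitrary coefficient lists as representatives. The ring laws
      -- already hold pointwise, before passing to the quotient.
      L : CommutativeRing c (c ⊔ ℓ)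
      L = record
        { Carrier = List Carrier ; _≈_ = _∼_ ; _+_ = add ; _*_ = mul ; -_ = neg ; 0# = [] ; 1# = one
        ; isCommutativeRing = record
          { isRing = record
            { +-isAbelianGroup = record
              { isGroup = record
                { isMonoid = record
                  { isSemigroup = record
                    { isMagma = record
                      { isEquivalence = record
                        { refl = pointwise (λ _ → refl)
                        ; sym = λ {u} {v} → ∼-sym {u} {v}
                        ; trans = λ {u} {v} {t} → ∼-trans {u} {v} {t} }
                      ; ∙-cong = λ {u} {u′} {v} {v′} → add-cong {u} {u′} {v} {v′} }
                    ; assoc = λ u v t → pointwise λ x → trans (ev-add (add u v) t x)
                        (trans (+-congʳ (ev-add u v x)) (trans (+-assoc _ _ _)
                          (sym (trans (ev-add u (add v t) x) (+-congˡ (ev-add v t x)))))) }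
                  ; identity = (λ u → pointwise λ x → refl) ,
                               (λ u → pointwise λ x → trans (ev-add u [] x) (+-identityʳ _)) }
                ; inverse = neg-add , λ u → ∼-trans {add u (neg u)} {add (neg u) u} {[]} (add-comm u (neg u)) (neg-add u)
                ; ⁻¹-cong = λ {u} {v} → neg-cong {u} {v} }
              ; comm = add-comm }
            ; *-cong = λ {u} {u′} {v} {v′} → mul-cong {u} {u′} {v} {v′}
            ; *-assoc = λ u v t → pointwise λ x → trans (ev-mul (mul u v) t x)
                (trans (*-congʳ (ev-mul u v x)) (trans (*-assoc _ _ _)
                  (sym (trans (ev-mul u (mul v t) x) (*-congˡ (ev-mul v t x))))))
            ; *-identity = one-mul , λ u → ∼-trans {mul u one} {mul one u} {u} (mul-comm u one) (one-mul u)
            ; distrib = mul-add , λ u v t → pointwise λ x → begin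
                ev (mul (add v t) u) x              ≈⟨ trans (ev-mul (add v t) u x) (*-congʳ (ev-add v t x)) ⟩
                (ev v x + ev t x) * ev u x          ≈⟨ distribʳ _ _ _ ⟩
                ev v x * ev u x + ev t x * ev u x
                  ≈⟨ trans (ev-add (mul v u) _ x) (+-cong (ev-mul v u x) (ev-mul t u x)) ⟨
                ev (add (mul v u) (mul t u)) x      ∎
            }
          ; *-comm = mul-comm
          }
        }

      φ : Carrier → List Carrier
      φ a = a ∷ []

      open RingMorphisms rawRing (CommutativeRing.rawRing L) using (IsRingHomomorphism)

      φ-isRingHomomorphism : IsRingHomomorphism φ
      φ-isRingHomomorphism = record
        { isSemiringHomomorphism = record
          { isNearSemiringHomomorphism = record
            { +-isMonoidHomomorphism = record
              { isMagmaHomomorphism = record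
                { isRelHomomorphism = record { cong = λ a≈b → pointwise λ x → +-congʳ a≈b }
                ; homo = λ a b → pointwise λ x → refl }
              ; ε-homo = pointwise (ev-const 0#) }
            ; *-homo = λ a b → pointwise λ x → +-congʳ (sym (+-identityʳ _)) }
          ; 1#-homo = pointwise λ x → refl }
        ; -‿homo = λ a → pointwise λ x → +-congʳ (solve 1 (λ a → :- a := :- con 1ℤ :* a) refl a) }

      β : List Carrier
      β = 0# ∷ 1# ∷ []

      ev-β : ∀ p x → ev (Polynomials.ev L (map φ p) β) x ≈ ev p x
      ev-β []      x = refl
      ev-β (a ∷ p) x = begin
        ev (add (φ a) (mul β P)) x
          ≈⟨ trans (ev-add (φ a) (mul β P) x) (+-congˡ (ev-mul β P x)) ⟩
        (a + x * 0#) + (0# + x * (1# + x * 0#)) * ev P x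
          ≈⟨ solve 3 (λ a x P → (a :+ x :* con 0ℤ) :+ (con 0ℤ :+ x :* (con 1ℤ :+ x :* con 0ℤ)) :* P := a :+ x :* P)
               refl a x (ev P x) ⟩
        a + x * ev P x                                ≈⟨ +-congˡ (*-congˡ (ev-β p x)) ⟩
        a + x * ev p x                                ∎
        where P = Polynomials.ev L (map φ p) β

      β-root : ∀ g → r ∣ᵖ g → Polynomials.ev L (map φ g) β ∼ []
      β-root g (v , e′) = let w , e = q∣r in mul w v , λ x → begin
        ev (Polynomials.ev L (map φ g) β) x - 0#   ≈⟨ +-congʳ (ev-β g x) ⟩
        ev g x - 0#                                ≈⟨ solve 1 (λ g → g :- con 0ℤ := g) refl (ev g x) ⟩
        ev g x                                     ≈⟨ trans (e′ x) (*-congʳ (e x)) ⟩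
        ev q x * ev w x * ev v x                   ≈⟨ trans (*-assoc _ _ _) (*-congˡ (sym (ev-mul w v x))) ⟩
        ev q x * ev (mul w v) x                    ∎

      q-lead : Lead q
      q-lead = least⇒lead q q-nonconst q∣r q-least

      0≁1 : ¬ [] ∼ one
      0≁1 (w , e) with has-lead everything-isSubring w (all∈ w) w≢0
        where
        w≢0 : ¬ AllZero w
        w≢0 w0 = 1≉0 (begin
          1#
            ≈⟨ solve 0 (con 1ℤ := :- (con 0ℤ :- (con 1ℤ :+ con 0ℤ :* con 0ℤ))) refl ⟩
          - (ev [] 0# - ev one 0#)          ≈⟨ -‿cong (e 0#) ⟩
          - (ev q 0# * ev w 0#)             ≈⟨ -‿cong (*-congˡ (ev-AllZero w0 0#)) ⟩
          - (ev q 0# * 0#)                  ≈⟨ solve 1 (λ q → :- (q :* con 0ℤ) := con 0ℤ) refl (ev q 0#) ⟩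
          0#                                ∎)
      ... | n , l , _ , _ , l≉0 , w-lead =
        not-constant {S = everything} {T = everything} K-inf {a = - 1#} (*≉0 Q.κ≉0 l≉0)
          (lead-mul everything-isSubring tt tt (Q.low , all∈ _ , Q.low≤ , Q.eq) w-lead)
          (λ x _ → trans (sym (e x)) (solve 1 (λ x → con 0ℤ :- (con 1ℤ :+ x :* con 0ℤ) := :- con 1ℤ) refl x))
        where module Q = Lead q-lead

      module Inverse (u : List Carrier) (u≁0 : ¬ u ∼ []) where
        module Q = Lead q-lead

        Ideal : List Carrier → Set (c ⊔ ℓ)
        Ideal g = ∃[ α ] ∃[ γ ] (∀ x → ev g x ≈ ev α x * ev u x + ev γ x * ev q x)

        u∈ : Ideal u
        u∈ = one , [] , λ x → solve 3 (λ x u q → u := (con 1ℤ :+ x :* con 0ℤ) :* u :+ con 0ℤ :* q)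
             refl x (ev u x) (ev q x)

        q∈ : Ideal q
        q∈ = [] , one , λ x → solve 3 (λ x u q → q := con 0ℤ :* u :+ (con 1ℤ :+ x :* con 0ℤ) :* q)
             refl x (ev u x) (ev q x)

        remainder∈ : ∀ {h g k w s} → Ideal h → Ideal g → (∀ x → k * ev h x ≈ ev w x * ev g x + ev s x) → Ideal s
        remainder∈ {h} {g} {k} {w} {s} (α , γ , e) (α′ , γ′ , e′) eq =
          sub (scale k α) (mul w α′) , sub (scale k γ) (mul w γ′) , λ x → begin
            ev s x
              ≈⟨ solve 3 (λ w g s → s := (w :* g :+ s) :- w :* g) refl (ev w x) (ev g x) (ev s x) ⟩
            (ev w x * ev g x + ev s x) - ev w x * ev g x
              ≈⟨ +-cong (trans (sym (eq x)) (*-congˡ (e x))) (-‿cong (*-congˡ (e′ x))) ⟩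
            k * (ev α x * ev u x + ev γ x * ev q x) - ev w x * (ev α′ x * ev u x + ev γ′ x * ev q x)
              ≈⟨ solve 8 (λ k A u C q w A′ C′ → k :* (A :* u :+ C :* q) :- w :* (A′ :* u :+ C′ :* q)
                   := (k :* A :- w :* A′) :* u :+ (k :* C :- w :* C′) :* q) refl k (ev α x) (ev u x) (ev γ x) (ev q x) (ev w x) (ev α′ x) (ev γ′ x) ⟩
            (k * ev α x - ev w x * ev α′ x) * ev u x + (k * ev γ x - ev w x * ev γ′ x) * ev q x
              ≈⟨ +-cong (*-congʳ (comb α α′ x)) (*-congʳ (comb γ γ′ x)) ⟨
            ev (sub (scale k α) (mul w α′)) x * ev u x + ev (sub (scale k γ) (mul w γ′)) x * ev q x ∎
          where
          comb : ∀ α α′ x → ev (sub (scale k α) (mul w α′)) x ≈ k * ev α x - ev w x * ev α′ x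
          comb α α′ x = trans (ev-sub (scale k α) _ x) (+-cong (ev-scale k α x) (-‿cong (ev-mul w α′ x)))

        q≢0 : ¬ AllZero q
        q≢0 = q-nonconst ∘ AllZero⇒Constant q

        -- A nonzero element `g` of least length in the ideal (u, q) divides both generators. Were
        -- it nonconstant, it would be a divisor of `r`, so at least as long as `q`; the remainder
        -- of `g` by `q` would be too short to be nonzero, and `q` would divide `g` and hence `u`.
        -- So `g` is a nonzero constant, and its expression in `u` and `q` is a Bézout relation.
        inverse′ : ∃[ v ] mul v u ∼ one
        inverse′ with least (λ n → ∃[ g ] length g ≡ n × ¬ AllZero g × Ideal g) (length q , q , ≡.refl , q≢0 , q∈)
        ... | zero , ([] , _ , g≢0 , _) , _ = ⊥-elim (g≢0 [])
        ... | suc e , (g , len , g≢0 , g∈) , min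
          with split-last {S = everything} tt e g (all∈ g) (ℕ.≤-reflexive len)
        ...   | low , ρ , _ , _ , low≤ , eq , zeros = result
          where
          too-short : ∀ s → length s ℕ.≤ e → Ideal s → AllZero s
          too-short s s≤ s∈ = byContradiction λ s≢0 → ℕ.<⇒≱ (s≤s s≤) (min (length s) (s , ≡.refl , s≢0 , s∈))
          ρ≉0 : ¬ ρ ≈ 0#
          ρ≉0 ρ≈0 = g≢0 (zeros (too-short low low≤ (let α , γ , e = g∈ in α , γ , λ x →
            trans (sym (trans (eq x) (trans (+-congˡ (trans (*-congʳ ρ≈0) (zeroˡ _))) (+-identityʳ _)))) (e x))) ρ≈0)

          exact-division : ∀ {k h w d s} → ¬ k ≈ 0# → AllZero s → (∀ x → k * ev h x ≈ ev w x * ev d x + ev s x) → d ∣ᵖ h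
          exact-division {k} {h} {w} {d} {s} k≉0 s0 e′ = let i , ik≈1 = inverse k≉0 in scale i w , λ x → begin
            ev h x                           ≈⟨ trans (*-congʳ ik≈1) (*-identityˡ _) ⟨
            i * k * ev h x                   ≈⟨ trans (*-assoc _ _ _) (*-congˡ (e′ x)) ⟩
            i * (ev w x * ev d x + ev s x)   ≈⟨ *-congˡ (+-congˡ (ev-AllZero s0 x)) ⟩
            i * (ev w x * ev d x + 0#)
              ≈⟨ solve 3 (λ i w d → i :* (w :* d :+ con 0ℤ) := d :* (i :* w)) refl i (ev w x) (ev d x) ⟩
            ev d x * (i * ev w x)            ≈⟨ *-congˡ (ev-scale i w x) ⟨
            ev d x * ev (scale i w) x        ∎

          g∣ : ∀ h → Ideal h → g ∣ᵖ h
          g∣ h h∈ with k , w , s , _ , _ , s≤ , _ , e′ ← pseudo-divide everything-isSubring e (all∈ low) tt low≤ h (all∈ h) =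
            exact-division {ρ ^ k} {h} {w} {g} {s} (^≉0 k ρ≉0) (too-short s s≤ (remainder∈ {h} {g} {ρ ^ k} {w} {s} h∈ g∈ e″)) e″
            where
            e″ : ∀ x → ρ ^ k * ev h x ≈ ev w x * ev g x + ev s x
            e″ x = trans (e′ x) (+-congʳ (*-congˡ (sym (eq x))))

          ∣ᵖ-trans : ∀ {s t h} → s ∣ᵖ t → t ∣ᵖ h → s ∣ᵖ h
          ∣ᵖ-trans (w , e) (w′ , e′) = mul w w′ , λ x →
            trans (e′ x) (trans (*-congʳ (e x)) (trans (*-assoc _ _ _) (*-congˡ (sym (ev-mul w w′ x)))))

          result : ∃[ v ] mul v u ∼ one
          result with em _ {Constant g}
          ... | no nc = ⊥-elim (u≁0 (let w , e = ∣ᵖ-trans {q} {g} {u} q∣g (g∣ u u∈) in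
                  w , λ x → trans (solve 1 (λ u → u :- con 0ℤ := u) refl (ev u x)) (e x)))
            where
            e≥ : suc Q.e ℕ.≤ e
            e≥ = ℕ.≤-pred (≡.subst₂ ℕ._≤_ Q.len len (q-least g nc (∣ᵖ-trans {g} {q} {r} (g∣ q q∈) q∣r)))
            q∣g : q ∣ᵖ g
            q∣g with k , w , s , _ , _ , s≤ , _ , e′ ← pseudo-divide everything-isSubring (suc Q.e) (all∈ Q.low) tt Q.low≤ g (all∈ g) =
              exact-division {Q.κ ^ k} {g} {w} {q} {s} (^≉0 k Q.κ≉0) (too-short s (ℕ.≤-trans s≤ e≥) (remainder∈ {g} {q} {Q.κ ^ k} {w} {s} g∈ q∈ e″)) e″
              where
              e″ : ∀ x → Q.κ ^ k * ev g x ≈ ev w x * ev q x + ev s x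
              e″ x = trans (e′ x) (+-congʳ (*-congˡ (sym (Q.eq x))))
          ... | yes const = const-inverse g const g≢0 g∈
            where
            const-inverse : ∀ g → Constant g → ¬ AllZero g → Ideal g → ∃[ v ] mul v u ∼ one
            const-inverse [] _ g≢0 _ = ⊥-elim (g≢0 [])
            const-inverse (a ∷ p) p0 g≢0 (α , γ , e) =
              let i , ia≈1 = inverse {a} (λ a≈0 → g≢0 (a≈0 ∷ p0)) in
              scale i α , scale (- i) γ , λ x → begin
                ev (mul (scale i α) u) x - (1# + x * 0#)
                  ≈⟨ +-cong (trans (ev-mul (scale i α) u x) (*-congʳ (ev-scale i α x))) (-‿cong (trans (ev-const 1# x) (sym ia≈1))) ⟩
                i * ev α x * ev u x - i * a
                  ≈⟨ solve 6 (λ i A u a G q → i :* A :* u :- i :* a := i :* ((A :* u :+ G :* q) :- a) :+ q :* (:- i :* G))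
                       refl i (ev α x) (ev u x) a (ev γ x) (ev q x) ⟩
                i * ((ev α x * ev u x + ev γ x * ev q x) - a) + ev q x * (- i * ev γ x)
                  ≈⟨ +-congʳ (*-congˡ (x≈y⇒x-y≈0 (trans (sym (e x)) (trans (+-congˡ (trans (*-congˡ (ev-AllZero p0 x)) (zeroʳ x))) (+-identityʳ a))))) ⟩
                i * 0# + ev q x * (- i * ev γ x)
                  ≈⟨ trans (+-congʳ (zeroʳ i)) (+-identityˡ _) ⟩
                ev q x * (- i * ev γ x)
                  ≈⟨ *-congˡ (ev-scale (- i) γ x) ⟨
                ev q x * ev (scale (- i) γ) x ∎

      L-isField : IsField L
      L-isField = 0≁1 , λ u u≁0 → let v , vu∼1 = Inverse.inverse′ u u≁0 in
        v , vu∼1 , ∼-trans {mul u v} {mul v u} {one} (mul-comm u v) vu∼1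

    record Extension : Set (Level.suc (c ⊔ ℓ)) where
      field
        L        : CommutativeRing c (c ⊔ ℓ)
        L-isField : IsField L
        φ        : Carrier → CommutativeRing.Carrier L
        φ-hom    : RingMorphisms.IsRingHomomorphism rawRing (CommutativeRing.rawRing L) φ
        β        : CommutativeRing.Carrier L
        β-root    : ∀ g → r ∣ᵖ g → CommutativeRing._≈_ L (Polynomials.ev L (map φ g) β) (CommutativeRing.0# L)

    adjoin-root : Extension
    adjoin-root =
      let q , nc , q∣r , q-least = irreducible-factor
          open Quotient q nc q∣r q-least
      in record { L = L ; L-isField = L-isField ; φ = φ ; φ-hom = φ-isRingHomomorphism ; β = β ; β-root = β-root }

-- Separable powers and a polynomial whose roots are other conjugates

module SeparatingPolynomial
  (em : ∀ ℓ → ExcludedMiddle ℓ) {c ℓ : Level} (K : CommutativeRing c ℓ) (isField : IsField K)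
  {p : Level} (F : Pred (CommutativeRing.Carrier K) p)
  (F-sub : Polynomials.IsSubring K F)
  (F-inv : ∀ {x} → F x → ¬ CommutativeRing._≈_ K x (CommutativeRing.0# K) →
           ∃[ y ] F y × CommutativeRing._≈_ K (CommutativeRing._*_ K y x) (CommutativeRing.1# K))
  where
  open CommutativeRing K
  open Classical em
  open Exp commutativeSemiring using (_^_; ^-assocʳ)
  open SemiringMult semiring using () renaming (_×_ to _×ᴿ_; ×-homo-+ to ×ᴿ-homo-+)
  open IntegerMultiples K
  open Solver
  open Polynomials K
  open FieldPolynomials em K isField
  open SimpleExtension em K isField using (Constant; _∣ᵖ_)
  open SetoidReasoning setoid
  open IsSubring F-sub

  natural : ℕ → Carrier
  natural n = n ×ᴿ 1#

  natural∈ : ∀ n → F (natural n)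
  natural∈ zero    = 0∈
  natural∈ (suc n) = +∈ 1∈ (natural∈ n)

  -- deriv 1 q is the derivative of a ∷ q, whatever a is.
  deriv : ℕ → List Carrier → List Carrier
  deriv k []      = []
  deriv k (a ∷ q) = natural k * a ∷ deriv (suc k) q

  deriv∈ : ∀ k {q} → All F q → All F (deriv k q)
  deriv∈ k []       = []
  deriv∈ k (a ∷ Fq) = *∈ (natural∈ k) a ∷ deriv∈ (suc k) Fq

  length-deriv : ∀ k q → length (deriv k q) ≡ length q
  length-deriv k []      = ≡.refl
  length-deriv k (a ∷ q) = ≡.cong suc (length-deriv (suc k) q)

  -- For `k = 0` this says that the derivative at x is the value at x of the quotient by X - x;
  -- general `k` carries the induction.
  ev-deriv : ∀ k q x → ev (deriv (suc k) q) x ≈ natural k * ev q x + ev (quot x q) x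
  ev-deriv k []      x = sym (trans (+-identityʳ _) (zeroʳ _))
  ev-deriv k (a ∷ q) x = trans (+-congˡ (*-congˡ (ev-deriv (suc k) q x)))
    (solve 5 (λ k a x Q D → (con 1ℤ :+ k) :* a :+ x :* ((con 1ℤ :+ k) :* Q :+ D)
       := k :* (a :+ x :* Q) :+ ((a :+ x :* Q) :+ x :* D)) refl (natural k) a x (ev q x) (ev (quot x q) x))

  module Decimation (e : ℕ) (char : natural (suc e) ≈ 0#) (least-char : ∀ n → natural (suc n) ≈ 0# → e ℕ.≤ n) where

    -- Keeps the coefficients at positions j, j + (e + 1), j + 2(e + 1), …
    decimate : ℕ → List Carrier → List Carrier
    decimate j       []      = []
    decimate zero    (a ∷ q) = a ∷ decimate e q
    decimate (suc j) (a ∷ q) = decimate j q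

    decimate∈ : ∀ j {q} → All F q → All F (decimate j q)
    decimate∈ j       []       = []
    decimate∈ zero    (a ∷ Fq) = a ∷ decimate∈ e Fq
    decimate∈ (suc j) (a ∷ Fq) = decimate∈ j Fq

    length-decimate : ∀ j q → length (decimate j q) ℕ.≤ length q
    length-decimate j       []      = z≤n
    length-decimate zero    (a ∷ q) = s≤s (length-decimate e q)
    length-decimate (suc j) (a ∷ q) = ℕ.m≤n⇒m≤1+n (length-decimate j q)

    wrap : ∀ k → natural (k ℕ.+ 0) ≈ 0# → natural (suc k ℕ.+ e) ≈ 0#
    wrap k k≈0 = begin
      natural (suc k ℕ.+ e)             ≡⟨ ≡.cong natural (ℕ.+-suc k e) ⟨
      natural (k ℕ.+ suc e)             ≈⟨ ×ᴿ-homo-+ 1# k (suc e) ⟩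
      natural k + natural (suc e)
        ≈⟨ +-cong (trans (reflexive (≡.cong natural (≡.sym (ℕ.+-identityʳ k)))) k≈0) char ⟩
      0# + 0#                           ≈⟨ +-identityˡ _ ⟩
      0#                                ∎

    step : ∀ k j → natural (k ℕ.+ suc j) ≈ 0# → natural (suc k ℕ.+ j) ≈ 0#
    step k j e = trans (reflexive (≡.cong natural (≡.sym (ℕ.+-suc k j)))) e

    -- The weight `k` is not a multiple of the characteristic, because the next multiple is only
    -- `suc j` ahead, less than a full period.
    skipped≈0 : ∀ k j {a} → natural (k ℕ.+ suc j) ≈ 0# → suc j ℕ.≤ e → natural k * a ≈ 0# → a ≈ 0#
    skipped≈0 k j k+j≈0 j<e ka≈0 = zero-divisor (λ k≈0 → ℕ.<⇒≱ j<e (least-char j (begin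
      natural (suc j)                   ≈⟨ +-identityˡ _ ⟨
      0# + natural (suc j)              ≈⟨ +-congʳ k≈0 ⟨
      natural k + natural (suc j)       ≈⟨ ×ᴿ-homo-+ 1# k (suc j) ⟨
      natural (k ℕ.+ suc j)             ≈⟨ k+j≈0 ⟩
      0#                                ∎))) ka≈0

    -- The head of `q` carries the weight `k`, and the next weight divisible by the characteristic
    -- is `j` positions ahead. The vanishing derivative kills all coefficients in between.
    ev-decimate : ∀ j k q → AllZero (deriv k q) → natural (k ℕ.+ j) ≈ 0# → j ℕ.≤ e →
                  ∀ x → ev q x ≈ x ^ j * ev (decimate j q) (x ^ suc e)
    ev-decimate j       k []      _         _    _   x = sym (zeroʳ _)
    ev-decimate zero    k (a ∷ q) (_ ∷ z)   k≈0  _   x = begin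
      a + x * ev q x
        ≈⟨ +-congˡ (*-congˡ (ev-decimate e (suc k) q z (wrap k k≈0) ℕ.≤-refl x)) ⟩
      a + x * (x ^ e * ev (decimate e q) (x ^ suc e))
        ≈⟨ solve 4 (λ a x X D → a :+ x :* (X :* D) := con 1ℤ :* (a :+ x :* X :* D))
             refl a x (x ^ e) (ev (decimate e q) (x ^ suc e)) ⟩
      1# * (a + x ^ suc e * ev (decimate e q) (x ^ suc e))    ∎
    ev-decimate (suc j) k (a ∷ q) (ka≈0 ∷ z) k+j≈0 j<e x = begin
      a + x * ev q x
        ≈⟨ +-cong (skipped≈0 k j k+j≈0 j<e ka≈0) (*-congˡ (ev-decimate j (suc k) q z (step k j k+j≈0) (ℕ.<⇒≤ j<e) x)) ⟩
      0# + x * (x ^ j * ev (decimate j q) (x ^ suc e))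
        ≈⟨ solve 3 (λ x X D → con 0ℤ :+ x :* (X :* D) := x :* X :* D) refl x (x ^ j) _ ⟩
      x ^ suc j * ev (decimate j q) (x ^ suc e)               ∎

    decimate-AllZero : ∀ j k q → AllZero (deriv k q) → natural (k ℕ.+ j) ≈ 0# → j ℕ.≤ e →
                       AllZero (decimate j q) → AllZero q
    decimate-AllZero j       k []      _          _     _   _         = []
    decimate-AllZero zero    k (a ∷ q) (_ ∷ z)    k≈0   _   (a0 ∷ d0) = a0 ∷ decimate-AllZero e (suc k) q z (wrap k k≈0) ℕ.≤-refl d0
    decimate-AllZero (suc j) k (a ∷ q) (ka≈0 ∷ z) k+j≈0 j<e d0        =
      skipped≈0 k j k+j≈0 j<e ka≈0 ∷ decimate-AllZero j (suc k) q z (step k j k+j≈0) (ℕ.<⇒≤ j<e) d0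

  char0⇒AllZero : (∀ n → ¬ natural (suc n) ≈ 0#) → ∀ k q → AllZero (deriv (suc k) q) → AllZero q
  char0⇒AllZero char0 k []      []         = []
  char0⇒AllZero char0 k (a ∷ q) (ka≈0 ∷ z) = zero-divisor (char0 k) ka≈0 ∷ char0⇒AllZero char0 (suc k) q z

  -- Every root of `r` is a root of all polynomials over `F` that vanish at `a`, and it differs from
  -- `a` because `r` does not vanish there.
  Separating : Carrier → Set (c ⊔ ℓ ⊔ p)
  Separating a = ∃[ r ] ¬ Constant r × ¬ ev r a ≈ 0# × (∀ g → All F g → ev g a ≈ 0# → r ∣ᵖ g)

  NoPowerIn : Carrier → Set p
  NoPowerIn a = ∀ n → ¬ F (a ^ suc n)

  AnnihilatedBelow : ℕ → Carrier → Set (c ⊔ ℓ ⊔ p)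
  AnnihilatedBelow n a = ∃[ q ] All F q × ¬ AllZero q × ev q a ≈ 0# × length q ℕ.≤ n

  -- In characteristic e + 1, a polynomial with vanishing derivative is a
  -- polynomial in X^(e + 1), hence a^(e + 1) has smaller degree.
  inseparable : ∀ {a} b b′ q → All F (b ∷ b′ ∷ q) → ¬ AllZero (b ∷ b′ ∷ q) → ev (b ∷ b′ ∷ q) a ≈ 0# →
                AllZero (deriv 1 (b′ ∷ q)) → ∃[ e ] AnnihilatedBelow (suc (length q)) (a ^ suc e)
  inseparable {a} b b′ q Fq q≢0 qa≈0 z with em _ {∃[ n ] natural (suc n) ≈ 0#}
  ... | no char0 = ⊥-elim (q≢0 (b≈0 ∷ tail0))
    where
    tail0 : AllZero (b′ ∷ q)
    tail0 = char0⇒AllZero (λ n e → char0 (n , e)) 0 (b′ ∷ q) z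
    b≈0 : b ≈ 0#
    b≈0 = trans (sym (trans (+-congˡ (trans (*-congˡ (ev-AllZero tail0 a)) (zeroʳ a))) (+-identityʳ b))) qa≈0
  ... | yes pos with least (λ n → natural (suc n) ≈ 0#) pos
  ...   | zero   , char , _ = ⊥-elim (1≉0 (trans (sym (+-identityʳ 1#)) char))
  ...   | suc e , char , min = suc e , decimate 0 Q , decimate∈ 0 Fq ,
          (q≢0 ∘ decimate-AllZero 0 0 Q z′ refl z≤n) ,
          trans (sym (trans (ev-decimate 0 0 Q z′ refl z≤n a) (*-identityˡ _))) qa≈0 ,
          -- The characteristic is at least 2, so decimation also drops `b′` and the list really
          -- gets shorter.
          s≤s (length-decimate e q)
    where
    open Decimation (suc e) char min
    Q = b ∷ b′ ∷ q
    z′ : AllZero (deriv 0 Q)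
    z′ = zeroˡ b ∷ z

  -- The polynomial `r` is the minimal polynomial divided by X - a. It divides whatever the minimal
  -- polynomial divides, and a nonzero `q` makes it nonconstant.
  separable : ∀ {a} (m : MinPoly F a) b b′ q → (∀ x → ev (b ∷ b′ ∷ q) x ≈ ev (MinPoly.low m) x + MinPoly.lead m * x ^ MinPoly.deg m) →
              ¬ AllZero q → ¬ ev (quot a (b′ ∷ q)) a ≈ 0# → Separating a
  separable {a} m b b′ q eq q≢0 sep = quot a (b′ ∷ q) , q≢0 ∘ quot-AllZero a q , sep , divides
    where
    open MinPoly m
    divides : ∀ g → All F g → ev g a ≈ 0# → quot a (b′ ∷ q) ∣ᵖ g
    divides g Fg ga≈0 with k , u , s , Fu , Fs , s≤ , _ , e ← pseudo-divide F-sub deg low∈ lead∈ low≤ g Fg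
      -- The cofactor is u (X - a) / lead^k, the missing linear factor having been put back.
      with i , il≈1 ← inverse (^≉0 k lead≉0) = scale i (mul u (- a ∷ 1# ∷ [])) , λ x → begin
        ev g x
          ≈⟨ trans (*-congʳ il≈1) (*-identityˡ _) ⟨
        i * lead ^ k * ev g x
          ≈⟨ trans (*-assoc _ _ _) (*-congˡ (e x)) ⟩
        i * (ev u x * (ev low x + lead * x ^ deg) + ev s x)
          ≈⟨ *-congˡ (+-cong (*-congˡ (trans (sym (eq x)) (ev-quot a b (b′ ∷ q) x))) (ev-AllZero s0 x)) ⟩
        i * (ev u x * (ev (b ∷ b′ ∷ q) a + (x - a) * R x) + 0#)
          ≈⟨ *-congˡ (+-congʳ (*-congˡ (+-congʳ (trans (eq a) root)))) ⟩
        i * (ev u x * (0# + (x - a) * R x) + 0#)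
          ≈⟨ solve 5 (λ i u x a R → i :* (u :* (con 0ℤ :+ (x :- a) :* R) :+ con 0ℤ)
               := R :* (i :* (u :* (:- a :+ x :* (con 1ℤ :+ x :* con 0ℤ))))) refl i (ev u x) x a (R x) ⟩
        R x * (i * (ev u x * (- a + x * (1# + x * 0#))))
          ≈⟨ *-congˡ (trans (ev-scale i (mul u (- a ∷ 1# ∷ [])) x) (*-congˡ (ev-mul u (- a ∷ 1# ∷ []) x))) ⟨
        R x * ev (scale i (mul u (- a ∷ 1# ∷ []))) x ∎
      where
      R : Carrier → Carrier
      R x = ev (quot a (b′ ∷ q)) x
      s0 : AllZero s
      s0 = minimal s Fs s≤ (begin
        ev s a                                             ≈⟨ +-identityˡ _ ⟨
        0# + ev s a                                        ≈⟨ +-congʳ (trans (*-congˡ root) (zeroʳ _)) ⟨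
        ev u a * (ev low a + lead * a ^ deg) + ev s a      ≈⟨ e a ⟨
        lead ^ k * ev g a                                  ≈⟨ trans (*-congˡ ga≈0) (zeroʳ _) ⟩
        0#                                                 ∎)

  -- Induction on a bound for the length of an annihilating polynomial. An inseparable `a` is
  -- replaced by `a ^ suc e`, whose powers are powers of `a` and so avoid `F` as well.
  algebraic-separating : ∀ n a → ¬ a ≈ 0# → NoPowerIn a → AnnihilatedBelow n a →
                         ∃[ a′ ] ¬ a′ ≈ 0# × Separating a′
  algebraic-separating zero a _ _ ([] , _ , q≢0 , _) = ⊥-elim (q≢0 [])
  algebraic-separating (suc n) a a≉0 a∉ (q , Fq , q≢0 , qa≈0 , q≤) =
    go (add low (mono deg lead)) (add∈ low∈ (mono∈ deg lead∈)) (lead≉0 ∘ lead≈0 low deg lead low≤)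
       (length-add low _ (ℕ.m≤n⇒m≤1+n low≤) (ℕ.≤-reflexive (length-mono deg lead)))
       (λ x → trans (ev-add low _ x) (+-congˡ (ev-mono deg lead x)))
    where
    m = minPoly F-sub (q , Fq , q≢0 , qa≈0)
    open MinPoly m
    deg≤n : deg ℕ.≤ n
    deg≤n = ℕ.≤-pred (ℕ.≤-trans (ℕ.≰⇒> (λ q≤deg → q≢0 (minimal q Fq q≤deg qa≈0))) q≤)

    a∉F : ¬ F a
    a∉F Fa = a∉ 0 (resp (sym (*-identityʳ a)) Fa)

    go : ∀ P → All F P → ¬ AllZero P → length P ℕ.≤ suc deg → (∀ x → ev P x ≈ ev low x + lead * x ^ deg) →
         ∃[ a′ ] ¬ a′ ≈ 0# × Separating a′
    go [] _ P≢0 _ _ = ⊥-elim (P≢0 [])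
    go (b ∷ []) FP P≢0 _ eq = ⊥-elim (P≢0 (trans (sym (ev-const b a)) (trans (eq a) root) ∷ []))
    go (b ∷ b′ ∷ r) FP P≢0 P≤ eq with em _ {ev (quot a (b′ ∷ r)) a ≈ 0#}
    ... | no sep = a , a≉0 , separable m b b′ r eq r≢0 sep
      where
      b′≉0 : AllZero r → ¬ b′ ≈ 0#
      b′≉0 r0 b′≈0 = P≢0 (trans (sym (trans (+-congˡ (trans (*-congˡ (trans (+-cong b′≈0 (*-congˡ (ev-AllZero r0 a))) (trans (+-identityˡ _) (zeroʳ a)))) (zeroʳ a))) (+-identityʳ b))) (trans (eq a) root) ∷ b′≈0 ∷ r0)
      -- If the degree were one, a = -b / b′ would lie in `F`.
      r≢0 : ¬ AllZero r
      r≢0 r0 with All.tail FP | F-inv (All.head (All.tail FP)) (b′≉0 r0)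
      ... | _ | y , Fy , yb′≈1 = a∉F (resp (begin
          y * - b
            ≈⟨ solve 4 (λ y b c a → y :* :- b := y :* c :* a :- y :* (b :+ a :* (c :+ a :* con 0ℤ)))
                 refl y b b′ a ⟩
          y * b′ * a - y * (b + a * (b′ + a * 0#))
            ≈⟨ +-cong (*-congʳ yb′≈1) (-‿cong (*-congˡ (trans (+-congˡ (*-congˡ (+-congˡ (*-congˡ (sym (ev-AllZero r0 a)))))) (trans (eq a) root)))) ⟩
          1# * a - y * 0#
            ≈⟨ solve 2 (λ a y → con 1ℤ :* a :- y :* con 0ℤ := a) refl a y ⟩
          a                                          ∎) (*∈ Fy (-∈ (All.head FP))))
    -- The vanishing quotient value is the derivative at `a`. The derivative has at most `deg`
    -- coefficients, so minimality makes all of them zero.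
    ... | yes insep = descend (inseparable b b′ r FP P≢0 (trans (eq a) root)
          (minimal (deriv 1 (b′ ∷ r)) (deriv∈ 1 (All.tail FP))
            (ℕ.≤-trans (ℕ.≤-reflexive (length-deriv 1 (b′ ∷ r))) (ℕ.≤-pred P≤))
            (trans (ev-deriv 0 (b′ ∷ r) a) (trans (+-cong (zeroˡ _) insep) (+-identityˡ _)))))
      where
      descend : ∃[ e ] AnnihilatedBelow (suc (length r)) (a ^ suc e) → ∃[ a′ ] ¬ a′ ≈ 0# × Separating a′
      descend (e , q , Fq , q≢0 , qa≈0 , q≤) = algebraic-separating n (a ^ suc e) (^≉0 (suc e) a≉0)
        (λ k F^ → a∉ (k ℕ.+ e ℕ.* suc k) (resp (^-assocʳ a (suc e) (suc k)) F^))
        (q , Fq , q≢0 , qa≈0 , ℕ.≤-trans q≤ (ℕ.≤-trans (ℕ.≤-pred P≤) deg≤n))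

  separating : ∀ a → ¬ a ≈ 0# → NoPowerIn a → ∃[ a′ ] ¬ a′ ≈ 0# × Separating a′
  separating a a≉0 a∉ with em _ {Algebraic F a}
  ... | yes (q , Fq , q≢0 , qa≈0) = algebraic-separating (length q) a a≉0 a∉ (q , Fq , q≢0 , qa≈0 , ℕ.≤-refl)
  ... | no transc = a , a≉0 , 0# ∷ 1# ∷ [] , (λ { (1≈0 ∷ []) → 1≉0 1≈0 }) ,
        (λ e → a≉0 (trans (solve 1 (λ a → a := con 0ℤ :+ a :* (con 1ℤ :+ a :* con 0ℤ)) refl a) e)) ,
        λ g Fg ga≈0 → [] , λ x → trans (ev-AllZero (transcendental transc g Fg ga≈0) x) (sym (zeroʳ _))

-- Transport along a homomorphism of fields

module FieldHomomorphism
  (em : ∀ ℓ → ExcludedMiddle ℓ) {c₁ ℓ₁ c₂ ℓ₂ : Level}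
  (K : CommutativeRing c₁ ℓ₁) (K-isField : IsField K) (L : CommutativeRing c₂ ℓ₂) (L-isField : IsField L)
  (φ : CommutativeRing.Carrier K → CommutativeRing.Carrier L)
  (φ-hom : RingMorphisms.IsRingHomomorphism (CommutativeRing.rawRing K) (CommutativeRing.rawRing L) φ)
  where
  private
    module K = CommutativeRing K
    module L = CommutativeRing L
    module PK = Polynomials K
    module PL = Polynomials L
    module FK = FieldPolynomials em K K-isField
    module FL = FieldPolynomials em L L-isField
    module EK = Exp K.commutativeSemiring
    module EL = Exp L.commutativeSemiring
  open RingMorphisms K.rawRing L.rawRing using (module IsRingHomomorphism)
  open IsRingHomomorphism φ-hom using (⟦⟧-cong; +-homo; *-homo; 0#-homo; 1#-homo; -‿homo)

  φ≉0 : ∀ {x} → ¬ x K.≈ K.0# → ¬ φ x L.≈ L.0#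
  φ≉0 {x} x≉0 φx≈0 = let y , yx≈1 = FK.inverse x≉0 in FL.1≉0
    (L.trans (L.sym (L.trans (⟦⟧-cong yx≈1) 1#-homo)) (L.trans (*-homo y x) (L.trans (L.*-congˡ φx≈0) (L.zeroʳ _))))

  φ-injective : ∀ {x y} → φ x L.≈ φ y → x K.≈ y
  φ-injective {x} {y} e = Classical.byContradiction em λ x≉y → φ≉0 (x≉y ∘ FK.x-y≈0⇒x≈y)
    (L.trans (+-homo x (K.- y)) (L.trans (L.+-congˡ (-‿homo y)) (FL.x≈y⇒x-y≈0 e)))

  φ-^ : ∀ x n → φ (x EK.^ n) L.≈ φ x EL.^ n
  φ-^ x zero    = 1#-homo
  φ-^ x (suc n) = L.trans (*-homo x _) (L.*-congˡ (φ-^ x n))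

  φ-nontorsion : ∀ {x} → (∀ n → ¬ x EK.^ suc n K.≈ K.1#) → ∀ n → ¬ φ x EL.^ suc n L.≈ L.1#
  φ-nontorsion {x} nt n e = nt n (φ-injective (L.trans (φ-^ x (suc n)) (L.trans e (L.sym 1#-homo))))

  image : ∀ {p} → Pred K.Carrier p → Pred L.Carrier (c₁ ⊔ ℓ₂ ⊔ p)
  image S y = ∃[ x ] S x × φ x L.≈ y

  image-isSubring : ∀ {p} {S : Pred K.Carrier p} → PK.IsSubring S → PL.IsSubring (image S)
  image-isSubring S-sub = record
    { resp = λ { y≈z (x , Sx , e) → x , Sx , L.trans e y≈z }
    ; 0∈ = K.0# , S.0∈ , 0#-homo
    ; 1∈ = K.1# , S.1∈ , 1#-homo
    ; +∈ = λ { (x , Sx , e) (y , Sy , e′) → x K.+ y , S.+∈ Sx Sy , L.trans (+-homo x y) (L.+-cong e e′) }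
    ; *∈ = λ { (x , Sx , e) (y , Sy , e′) → x K.* y , S.*∈ Sx Sy , L.trans (*-homo x y) (L.*-cong e e′) }
    ; -∈ = λ { (x , Sx , e) → K.- x , S.-∈ Sx , L.trans (-‿homo x) (L.-‿cong e) }
    }
    where module S = PK.IsSubring S-sub

  evφ : List K.Carrier → L.Carrier → L.Carrier
  evφ g b = PL.ev (map φ g) b

  evφ-φ : ∀ g x → evφ g (φ x) L.≈ φ (PK.ev g x)
  evφ-φ []      x = L.sym 0#-homo
  evφ-φ (k ∷ g) x = L.sym (L.trans (+-homo k _) (L.+-congˡ (L.trans (*-homo x _) (L.*-congˡ (L.sym (evφ-φ g x))))))

  module _ (b : L.Carrier) where
    open IntegerMultiples L
    open Solver
    open SetoidReasoning L.setoid

    evφ-add : ∀ g h → evφ (PK.add g h) b L.≈ evφ g b L.+ evφ h b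
    evφ-add []      h       = L.sym (L.+-identityˡ _)
    evφ-add (x ∷ g) []      = L.sym (L.+-identityʳ _)
    evφ-add (x ∷ g) (y ∷ h) = L.trans (L.+-cong (+-homo x y) (L.*-congˡ (evφ-add g h)))
      (solve 5 (λ a b x P Q → (a :+ b) :+ x :* (P :+ Q) := (a :+ x :* P) :+ (b :+ x :* Q)) L.refl
        (φ x) (φ y) b (evφ g b) (evφ h b))

    evφ-scale : ∀ k g → evφ (PK.scale k g) b L.≈ φ k L.* evφ g b
    evφ-scale k []      = L.sym (L.zeroʳ _)
    evφ-scale k (x ∷ g) = L.trans (L.+-cong (*-homo k x) (L.*-congˡ (evφ-scale k g)))
      (solve 4 (λ k a x P → k :* a :+ x :* (k :* P) := k :* (a :+ x :* P)) L.refl (φ k) (φ x) b (evφ g b))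

    evφ-mul : ∀ g h → evφ (PK.mul g h) b L.≈ evφ g b L.* evφ h b
    evφ-mul []      h = L.sym (L.zeroˡ _)
    evφ-mul (x ∷ g) h = begin
      evφ (PK.add (PK.scale x h) (K.0# ∷ PK.mul g h)) b
        ≈⟨ L.trans (evφ-add (PK.scale x h) _) (L.+-cong (evφ-scale x h) (L.+-cong 0#-homo (L.*-congˡ (evφ-mul g h)))) ⟩
      φ x L.* evφ h b L.+ (L.0# L.+ b L.* (evφ g b L.* evφ h b))
        ≈⟨ solve 4 (λ a x P Q → a :* Q :+ (con 0ℤ :+ x :* (P :* Q)) := (a :+ x :* P) :* Q) L.refl (φ x) b (evφ g b) (evφ h b) ⟩
      (φ x L.+ b L.* evφ g b) L.* evφ h b ∎

    evφ-const : ∀ x → evφ (x ∷ []) b L.≈ φ x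
    evφ-const x = PL.ev-const (φ x) b

-- Independence modulo the base field by conjugation

module ConjugateIndependence
  (em : ∀ ℓ → ExcludedMiddle ℓ) {c₁ ℓ₁ c₂ ℓ₂ : Level}
  (K : CommutativeRing c₁ ℓ₁) (K-isField : IsField K) (L : CommutativeRing c₂ ℓ₂) (L-isField : IsField L)
  (φ : CommutativeRing.Carrier K → CommutativeRing.Carrier L)
  (φ-hom : RingMorphisms.IsRingHomomorphism (CommutativeRing.rawRing K) (CommutativeRing.rawRing L) φ)
  {p : Level} {F : Pred (CommutativeRing.Carrier K) p} (F-sub : Polynomials.IsSubring K F)
  (a : CommutativeRing.Carrier K) (a≉0 : ¬ CommutativeRing._≈_ K a (CommutativeRing.0# K))
  (β : CommutativeRing.Carrier L) (φa≉β : ¬ CommutativeRing._≈_ L (φ a) β)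
  (conjugate : ∀ g → All F g → CommutativeRing._≈_ K (Polynomials.ev K g a) (CommutativeRing.0# K) →
               CommutativeRing._≈_ L (Polynomials.ev L (map φ g) β) (CommutativeRing.0# L))
  where
  private
    module K = CommutativeRing K
    module PK = Polynomials K
    module FK = FieldPolynomials em K K-isField
    module EK = Exp K.commutativeSemiring
    module F = PK.IsSubring F-sub
    module SK = IntegerMultiples.Solver K
  open CommutativeRing L
  open Exp commutativeSemiring using (_^_; ^-homo-*; ^-congˡ; ^-distrib-*)
  open RingMorphisms K.rawRing rawRing using (module IsRingHomomorphism)
  open IsRingHomomorphism φ-hom using (⟦⟧-cong; +-homo; *-homo; 0#-homo; 1#-homo)
  open IntegerMultiples L
  open Solver
  open Polynomials L
  open FieldPolynomials em L L-isField
  open Nondivisors em L L-isField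
  open FieldHomomorphism em K K-isField L L-isField φ φ-hom
  open SetoidReasoning setoid

  -- Graph of the F-linear isomorphism F[a] → F[β] sending a to β.
  Conj : K.Carrier → Carrier → Set (c₁ ⊔ ℓ₁ ⊔ ℓ₂ ⊔ p)
  Conj u ū = ∃[ g ] All F g × PK.ev g a K.≈ u × evφ g β ≈ ū

  conj-0 : ∀ {u ū} → Conj u ū → u K.≈ K.0# → ū ≈ 0#
  conj-0 (g , Fg , e , ē) u≈0 = trans (sym ē) (conjugate g Fg (K.trans e u≈0))

  conj-const : ∀ {f} → F f → Conj f (φ f)
  conj-const {f} Ff = f ∷ [] , Ff ∷ [] , PK.ev-const f a , evφ-const β f

  conj-a : Conj a β
  conj-a = K.0# ∷ K.1# ∷ [] , F.0∈ ∷ F.1∈ ∷ [] ,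
    SK.solve 1 (λ a → SK.con 0ℤ SK.:+ a SK.:* (SK.con 1ℤ SK.:+ a SK.:* SK.con 0ℤ) SK.:= a) K.refl a ,
    trans (+-cong 0#-homo (*-congˡ (+-congʳ 1#-homo)))
          (solve 1 (λ b → con 0ℤ :+ b :* (con 1ℤ :+ b :* con 0ℤ) := b) refl β)

  conj-+ : ∀ {u ū v v̄} → Conj u ū → Conj v v̄ → Conj (u K.+ v) (ū + v̄)
  conj-+ (g , Fg , e , ē) (h , Fh , e′ , ē′) = PK.add g h , F.add∈ Fg Fh ,
    K.trans (PK.ev-add g h a) (K.+-cong e e′) , trans (evφ-add β g h) (+-cong ē ē′)

  conj-* : ∀ {u ū v v̄} → Conj u ū → Conj v v̄ → Conj (u K.* v) (ū * v̄)
  conj-* (g , Fg , e , ē) (h , Fh , e′ , ē′) = PK.mul g h , F.mul∈ Fg Fh ,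
    K.trans (PK.ev-mul g h a) (K.*-cong e e′) , trans (evφ-mul β g h) (*-cong ē ē′)

  conj-1 : Conj K.1# 1#
  conj-1 = let g , Fg , e , ē = conj-const F.1∈ in g , Fg , e , trans ē 1#-homo

  conj-^ : ∀ n {u ū} → Conj u ū → Conj (u EK.^ n) (ū ^ n)
  conj-^ zero    c = conj-1
  conj-^ (suc n) c = conj-* c (conj-^ n c)

  -- Conjugation is well defined: the difference of two polynomials with equal value at `a` vanishes
  -- at `a`, hence at `β`.
  conj-≈ : ∀ {u ū v v̄} → Conj u ū → Conj v v̄ → u K.≈ v → ū ≈ v̄
  conj-≈ {u} {ū} {v} {v̄} c c′ u≈v = x-y≈0⇒x≈y (trans (+-congˡ (trans (solve 1 (λ v → :- v := :- con 1ℤ :* v)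
       refl v̄)
    (*-congʳ (sym -1-homo)))) (conj-0 (conj-+ c (conj-* (conj-const (F.-∈ F.1∈)) c′))
      (K.trans (K.+-congʳ u≈v) (SK.solve 1 (λ v → v SK.:+ (SK.:- SK.con 1ℤ) SK.:* v SK.:= SK.con 0ℤ) K.refl v))))
    where
    -1-homo : φ (K.- K.1#) ≈ - 1#
    -1-homo = trans (IsRingHomomorphism.-‿homo φ-hom K.1#) (-‿cong 1#-homo)

  module _ {q} {S : Pred Carrier q} (S-sub : IsSubring S) (S-inf : Infinite S) (S-units : FiniteUnits S)
           (S⊆F : ∀ {s} → S s → image F s) where
    private
      module S = IsSubring S-sub
      A = φ a
      S[A]-sub = adjoin-isSubring S-sub A
      T = (S [ A ]) [ β ]
      T-sub = adjoin-isSubring S[A]-sub β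
      module T = IsSubring T-sub
      S⊆T : ∀ {s} → S s → T s
      S⊆T = adjoin-⊆ ∘ adjoin-⊆
      A∈ : T A
      A∈ = adjoin-⊆ (adjoin-∋ S-sub)
      β∈ : T β
      β∈ = adjoin-∋ S[A]-sub

    -- g = u / v with u, v ∈ F[a] such that g / ḡ = u v̄ / (v ū) is a unit of T[1/z].
    record Fraction (z : Carrier) (g : K.Carrier) : Set (c₁ ⊔ ℓ₁ ⊔ c₂ ⊔ ℓ₂ ⊔ p ⊔ q) where
      field
        {u v}   : K.Carrier
        {ū v̄}   : Carrier
        cu      : Conj u ū
        cv      : Conj v v̄
        u≉0     : ¬ u K.≈ K.0#
        v≉0     : ¬ v K.≈ K.0#
        ū≉0     : ¬ ū ≈ 0#
        v̄≉0     : ¬ v̄ ≈ 0#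
        gv≈u    : g K.* v K.≈ u
        N       : ℕ
        {t t′}  : Carrier
        t∈      : T t
        t′∈     : T t′
        t-eq    : t * (φ v * ū) ≈ z ^ N * (φ u * v̄)
        t′-eq   : t′ * (φ u * v̄) ≈ z ^ N * (φ v * ū)

    module _ {z : Carrier} where
      open Fraction

      fraction-1 : Fraction z K.1#
      fraction-1 = record
        { cu = conj-1 ; cv = conj-1 ; u≉0 = FK.1≉0 ; v≉0 = FK.1≉0 ; ū≉0 = 1≉0 ; v̄≉0 = 1≉0
        ; gv≈u = K.*-identityˡ K.1# ; N = 0 ; t∈ = T.1∈ ; t′∈ = T.1∈ ; t-eq = refl ; t′-eq = refl }

      fraction-* : ∀ {g h} → Fraction z g → Fraction z h → Fraction z (g K.* h)
      fraction-* {g} {h} p q = record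
        { cu = conj-* (cu p) (cu q) ; cv = conj-* (cv p) (cv q)
        ; u≉0 = FK.*≉0 (u≉0 p) (u≉0 q) ; v≉0 = FK.*≉0 (v≉0 p) (v≉0 q)
        ; ū≉0 = *≉0 (ū≉0 p) (ū≉0 q) ; v̄≉0 = *≉0 (v̄≉0 p) (v̄≉0 q)
        ; gv≈u = K.trans (SK.solve 4 (λ g h v w → g SK.:* h SK.:* (v SK.:* w) SK.:= g SK.:* v SK.:* (h SK.:* w)) K.refl g h (v p) (v q))
                         (K.*-cong (gv≈u p) (gv≈u q))
        ; N = N p ℕ.+ N q ; t∈ = T.*∈ (t∈ p) (t∈ q) ; t′∈ = T.*∈ (t′∈ p) (t′∈ q)
        ; t-eq = combine (t-eq p) (t-eq q) ; t′-eq = combine (t′-eq p) (t′-eq q) }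
        where
        combine : ∀ {t t′ x x′ y y′ w w′ k k′} → t * (φ x * y) ≈ z ^ N p * (φ w * k) → t′ * (φ x′ * y′) ≈ z ^ N q * (φ w′ * k′) →
                  (t * t′) * (φ (x K.* x′) * (y * y′)) ≈ z ^ (N p ℕ.+ N q) * (φ (w K.* w′) * (k * k′))
        combine {t} {t′} {x} {x′} {y} {y′} {w} {w′} {k} {k′} e e′ = begin
          t * t′ * (φ (x K.* x′) * (y * y′))            ≈⟨ *-congˡ (*-congʳ (*-homo x x′)) ⟩
          t * t′ * (φ x * φ x′ * (y * y′))
            ≈⟨ solve 6 (λ t s x x′ y y′ → t :* s :* (x :* x′ :* (y :* y′)) := t :* (x :* y) :* (s :* (x′ :* y′)))
                 refl t t′ (φ x) (φ x′) y y′ ⟩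
          t * (φ x * y) * (t′ * (φ x′ * y′))            ≈⟨ *-cong e e′ ⟩
          z ^ N p * (φ w * k) * (z ^ N q * (φ w′ * k′))
            ≈⟨ solve 6 (λ Z Y w w′ k k′ → Z :* (w :* k) :* (Y :* (w′ :* k′)) := Z :* Y :* (w :* w′ :* (k :* k′)))
                 refl (z ^ N p) (z ^ N q) (φ w) (φ w′) k k′ ⟩
          z ^ N p * z ^ N q * (φ w * φ w′ * (k * k′))
            ≈⟨ *-cong (sym (^-homo-* z (N p) (N q))) (*-congʳ (sym (*-homo w w′))) ⟩
          z ^ (N p ℕ.+ N q) * (φ (w K.* w′) * (k * k′)) ∎

      fraction-⁻¹ : ∀ {g g′} → g K.* g′ K.≈ K.1# → Fraction z g → Fraction z g′
      fraction-⁻¹ {g} {g′} gg′≈1 p = record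
        { cu = cv p ; cv = cu p ; u≉0 = v≉0 p ; v≉0 = u≉0 p ; ū≉0 = v̄≉0 p ; v̄≉0 = ū≉0 p
        ; gv≈u = K.trans (K.*-congˡ (K.sym (gv≈u p))) (K.trans (SK.solve 3 (λ g h v → h SK.:* (g SK.:* v) SK.:= g SK.:* h SK.:* v) K.refl g g′ (v p))
                   (K.trans (K.*-congʳ gg′≈1) (K.*-identityˡ _)))
        ; N = N p ; t∈ = t′∈ p ; t′∈ = t∈ p ; t-eq = t′-eq p ; t′-eq = t-eq p }

      -- An element of `F` is its own conjugate, so it cancels from g / ḡ. This is what makes
      -- `Fraction z` a property of classes modulo `F`.
      fraction-scale : ∀ {f g h} → F f → ¬ f K.≈ K.0# → g K.≈ f K.* h → Fraction z g → Fraction z h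
      fraction-scale {f} {g} {h} Ff f≉0 g≈fh p = record
        { cu = cu p ; cv = conj-* (conj-const Ff) (cv p) ; u≉0 = u≉0 p ; v≉0 = FK.*≉0 f≉0 (v≉0 p)
        ; ū≉0 = ū≉0 p ; v̄≉0 = *≉0 (φ≉0 f≉0) (v̄≉0 p)
        ; gv≈u = K.trans (SK.solve 3 (λ h f v → h SK.:* (f SK.:* v) SK.:= f SK.:* h SK.:* v) K.refl h f (v p))
                   (K.trans (K.*-congʳ (K.sym g≈fh)) (gv≈u p))
        ; N = N p ; t∈ = t∈ p ; t′∈ = t′∈ p
        ; t-eq = begin
            t p * (φ (f K.* v p) * ū p)          ≈⟨ *-congˡ (*-congʳ (*-homo f (v p))) ⟩
            t p * (φ f * φ (v p) * ū p)
              ≈⟨ solve 4 (λ t f v u → t :* (f :* v :* u) := f :* (t :* (v :* u)))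
                   refl (t p) (φ f) (φ (v p)) (ū p) ⟩
            φ f * (t p * (φ (v p) * ū p))        ≈⟨ *-congˡ (t-eq p) ⟩
            φ f * (z ^ N p * (φ (u p) * v̄ p))
              ≈⟨ solve 4 (λ f Z u v → f :* (Z :* (u :* v)) := Z :* (u :* (f :* v)))
                   refl (φ f) (z ^ N p) (φ (u p)) (v̄ p) ⟩
            z ^ N p * (φ (u p) * (φ f * v̄ p))    ∎
        ; t′-eq = begin
            t′ p * (φ (u p) * (φ f * v̄ p))
              ≈⟨ solve 4 (λ t u f v → t :* (u :* (f :* v)) := f :* (t :* (u :* v)))
                   refl (t′ p) (φ (u p)) (φ f) (v̄ p) ⟩
            φ f * (t′ p * (φ (u p) * v̄ p))       ≈⟨ *-congˡ (t′-eq p) ⟩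
            φ f * (z ^ N p * (φ (v p) * ū p))
              ≈⟨ solve 4 (λ f Z v u → f :* (Z :* (v :* u)) := Z :* (f :* v :* u))
                   refl (φ f) (z ^ N p) (φ (v p)) (ū p) ⟩
            z ^ N p * (φ f * φ (v p) * ū p)      ≈⟨ *-congˡ (*-congʳ (*-homo f (v p))) ⟨
            z ^ N p * (φ (f K.* v p) * ū p)      ∎ }

    record Linear (x : K.Carrier) : Set (c₁ ⊔ ℓ₁ ⊔ ℓ₂ ⊔ p ⊔ q) where
      field
        f   : K.Carrier
        Ff  : F f
        Sφf : S (φ f)
        x≈  : x K.≈ K.1# K.+ f K.* a
        x≉0 : ¬ x K.≈ K.0#
        y≉0 : ¬ 1# + φ f * β ≈ 0#

      Y : Carrier
      Y = 1# + φ f * β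

      φx≈ : φ x ≈ 1# + φ f * A
      φx≈ = trans (⟦⟧-cong x≈) (trans (+-homo _ _) (+-cong 1#-homo (*-homo f a)))

      x∈ : T (φ x)
      x∈ = T.resp (sym φx≈) (T.+∈ T.1∈ (T.*∈ (S⊆T Sφf) A∈))

      y∈ : T Y
      y∈ = T.+∈ T.1∈ (T.*∈ (S⊆T Sφf) β∈)

      conj : Conj x Y
      conj = let g , Fg , e , ē = conj-+ conj-1 (conj-* (conj-const Ff) conj-a) in g , Fg , K.trans e (K.sym x≈) , ē

    -- With z = x Y r the two quotients are x / Y = x² r / z and Y / x = Y² r / z, whence `N = 1`.
    linear-fraction : ∀ {x z} (l : Linear x) r → T r → z ≈ φ x * Linear.Y l * r → Fraction z x
    linear-fraction {x} {z} l r Tr e = record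
      { cu = conj ; cv = conj-1 ; u≉0 = x≉0 ; v≉0 = FK.1≉0 ; ū≉0 = y≉0 ; v̄≉0 = 1≉0
      ; gv≈u = K.*-identityʳ x ; N = 1 ; t∈ = T.*∈ (T.*∈ x∈ x∈) Tr ; t′∈ = T.*∈ (T.*∈ y∈ y∈) Tr
      ; t-eq = begin
          φ x * φ x * r * (φ K.1# * Y)    ≈⟨ *-congˡ (*-congʳ 1#-homo) ⟩
          φ x * φ x * r * (1# * Y)
            ≈⟨ solve 3 (λ x r y → x :* x :* r :* (con 1ℤ :* y) := x :* y :* r :* con 1ℤ :* (x :* con 1ℤ))
                 refl (φ x) r Y ⟩
          φ x * Y * r * 1# * (φ x * 1#)   ≈⟨ *-congʳ (*-congʳ e) ⟨
          z * 1# * (φ x * 1#)             ∎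
      ; t′-eq = begin
          Y * Y * r * (φ x * 1#)
            ≈⟨ solve 3 (λ x r y → y :* y :* r :* (x :* con 1ℤ) := x :* y :* r :* con 1ℤ :* (con 1ℤ :* y))
                 refl (φ x) r Y ⟩
          φ x * Y * r * 1# * (1# * Y)     ≈⟨ *-cong (*-congʳ e) (*-congʳ 1#-homo) ⟨
          z * 1# * (φ K.1# * Y)           ∎ }
      where open Linear l

    -- The factor `β - A` is included because `fraction⇒∣` leaves a power of it to be absorbed by
    -- `z`.
    common-multiple : ∀ xs → All Linear xs →
      ∃[ z ] T z × ¬ z ≈ 0# × (∃[ r ] T r × z ≈ (β - A) * r) × (∀ {x} → x ∈ˡ xs → Fraction z x)
    common-multiple xs ls = let z , Tz , z≉0 , div , factor = go xs ls in z , Tz , z≉0 , div ,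
        λ x∈ → let l , r , Tr , e = factor x∈ in linear-fraction l r Tr e
      where
      go : ∀ xs → All Linear xs → ∃[ z ] T z × ¬ z ≈ 0# × (∃[ r ] T r × z ≈ (β - A) * r) ×
           (∀ {x} → x ∈ˡ xs → ∃[ l ] ∃[ r ] T r × z ≈ φ x * Linear.Y {x} l * r)
      go [] [] = β - A , T.+∈ β∈ (T.-∈ A∈) , (λ e → φa≉β (sym (x-y≈0⇒x≈y e))) ,
                 (1# , T.1∈ , sym (*-identityʳ _)) , λ ()
      go (x ∷ xs) (l ∷ ls) = let z , Tz , z≉0 , (r , Tr , e) , factor = go xs ls in
        φ x * Y * z , T.*∈ (T.*∈ x∈ y∈) Tz , *≉0 (*≉0 (φ≉0 x≉0) y≉0) z≉0 ,
        (φ x * Y * r , T.*∈ (T.*∈ x∈ y∈) Tr , trans (*-congˡ e) (solve 4 (λ x y d r → x :* y :* (d :* r) := d :* (x :* y :* r))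
             refl (φ x) Y (β - A) r)) ,
        λ { (here ≡.refl) → l , z , Tz , refl
          ; (there {xs = _} x′∈) → let l′ , r′ , Tr′ , e′ = factor x′∈ in
              l′ , φ x * Y * r′ , T.*∈ (T.*∈ x∈ y∈) Tr′ , trans (*-congˡ e′)
                (solve 5 (λ x y x′ y′ r → x :* y :* (x′ :* y′ :* r) := x′ :* y′ :* (x :* y :* r))
                     refl (φ x) Y _ (Linear.Y l′) r′) }
        where open Linear l

    -- Modulo `X` the factors `Y` may be replaced by `d` one after another.
    ∣-shift : ∀ {X Y d} → T d → Y ≈ X + d → ∀ k {W} → T W → T Y → X ∣[ T ] Y ^ k * W → X ∣[ T ] d ^ k * W
    ∣-shift Td Y≈ zero TW TY div = div
    ∣-shift {X} {Y} {d} Td Y≈ (suc k) {W} TW TY (w , Tw , e) =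
      let w′ , Tw′ , e′ = ∣-shift Td Y≈ k (T.*∈ Td TW) TY
            (w - Y ^ k * W , T.+∈ Tw (T.-∈ (T.*∈ (T.^∈ k TY) TW)) , (begin
              X * (w - Y ^ k * W)
                ≈⟨ solve 3 (λ x w Z → x :* (w :- Z) := x :* w :- x :* Z) refl X w (Y ^ k * W) ⟩
              X * w - X * (Y ^ k * W)              ≈⟨ +-congʳ (trans e (*-assoc _ _ _)) ⟩
              Y * (Y ^ k * W) - X * (Y ^ k * W)    ≈⟨ +-congʳ (*-congʳ Y≈) ⟩
              (X + d) * (Y ^ k * W) - X * (Y ^ k * W)
                ≈⟨ solve 4 (λ x d Z W → (x :+ d) :* (Z :* W) :- x :* (Z :* W) := Z :* (d :* W))
                     refl X d (Y ^ k) W ⟩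
              Y ^ k * (d * W)                      ∎))
      in w′ , Tw′ , trans e′ (solve 3 (λ D d W → D :* (d :* W) := d :* D :* W) refl (d ^ k) d W)

    module _ {x : K.Carrier} {z r : Carrier} (l : Linear x) (Tz : T z) (Tr : T r) (z≈ : z ≈ (β - A) * r) where
      open Linear l
      private X = φ x

      -- A fraction x^k makes φ x divide z^N Y^k for the conjugate
      -- Y = φ x + φ f (β - A), hence a power of z.
      fraction⇒∣ : ∀ m → Fraction z (x EK.^ suc m) → ∃[ M ] X ∣[ T ] z ^ M
      fraction⇒∣ m frac = N ℕ.+ k , X∣₄
        where
        open Fraction frac
        k = suc m
        δ = β - A
        Tδ : T δ
        Tδ = T.+∈ β∈ (T.-∈ A∈)
        Y≈ : Y ≈ X + φ f * δ
        Y≈ = trans (solve 3 (λ s b A → con 1ℤ :+ s :* b := (con 1ℤ :+ s :* A) :+ s :* (b :- A)) refl (φ f) β A)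
                   (+-congʳ (sym φx≈))
        ū≈ : Y ^ k * v̄ ≈ ū
        ū≈ = conj-≈ (conj-* (conj-^ k conj) cv) cu gv≈u
        φu≈ : X ^ k * φ v ≈ φ u
        φu≈ = trans (*-congʳ (sym (φ-^ x k))) (trans (sym (*-homo _ v)) (⟦⟧-cong gv≈u))
        -- This is `t′-eq` with u = x^k v and its conjugate ū = Y^k v̄ inserted, divided by φ v ·
        -- v̄.
        t′X^k : t′ * X ^ k ≈ z ^ N * Y ^ k
        t′X^k = cancel (*≉0 (φ≉0 v≉0) v̄≉0) (begin
          φ v * v̄ * (t′ * X ^ k)
            ≈⟨ solve 4 (λ v w t X → v :* w :* (t :* X) := t :* (X :* v :* w)) refl (φ v) v̄ t′ (X ^ k) ⟩
          t′ * (X ^ k * φ v * v̄)        ≈⟨ *-congˡ (*-congʳ φu≈) ⟩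
          t′ * (φ u * v̄)                ≈⟨ t′-eq ⟩
          z ^ N * (φ v * ū)             ≈⟨ *-congˡ (*-congˡ ū≈) ⟨
          z ^ N * (φ v * (Y ^ k * v̄))
            ≈⟨ solve 4 (λ Z v Y w → Z :* (v :* (Y :* w)) := v :* w :* (Z :* Y)) refl (z ^ N) (φ v) (Y ^ k) v̄ ⟩
          φ v * v̄ * (z ^ N * Y ^ k)     ∎)
        X∣₁ : X ∣[ T ] Y ^ k * z ^ N
        X∣₁ = X ^ m * t′ , T.*∈ (T.^∈ m x∈) t′∈ ,
          trans (solve 3 (λ x X t → x :* (X :* t) := t :* (x :* X)) refl X (X ^ m) t′) (trans t′X^k (*-comm _ _))
        X∣₂ : X ∣[ T ] (φ f * δ) ^ k * z ^ N
        X∣₂ = ∣-shift (T.*∈ (S⊆T Sφf) Tδ) Y≈ k (T.^∈ N Tz) y∈ X∣₁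
        X∣₂′ : X ∣[ T ] φ f ^ k * (δ ^ k * z ^ N)
        X∣₂′ = let w , Tw , e = X∣₂ in w , Tw , trans e (trans (*-congʳ (^-distrib-* (φ f) δ k)) (*-assoc _ _ _))
        -- The factor `φ f ^ k` drops out, since X = 1 + φ f · A is prime to φ f.
        X∣₃ : X ∣[ T ] δ ^ k * z ^ N
        X∣₃ = coprime-∣ T-sub (S⊆T Sφf) T.1∈ A∈ (trans (*-identityʳ X) φx≈) k (T.*∈ (T.^∈ k Tδ) (T.^∈ N Tz)) X∣₂′
        X∣₄ : X ∣[ T ] z ^ (N ℕ.+ k)
        X∣₄ = let w , Tw , e = ∣-*ʳ T-sub (T.^∈ k Tr) X∣₃ in w , Tw , trans e (begin
          δ ^ k * z ^ N * r ^ k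
            ≈⟨ solve 3 (λ D Z R → D :* Z :* R := Z :* (D :* R)) refl (δ ^ k) (z ^ N) (r ^ k) ⟩
          z ^ N * (δ ^ k * r ^ k)       ≈⟨ *-congˡ (trans (sym (^-distrib-* δ r k)) (^-congˡ k (sym z≈))) ⟩
          z ^ N * z ^ k                 ≈⟨ ^-homo-* z N k ⟨
          z ^ (N ℕ.+ k)                 ∎)

    *≈-1 : ∀ {s v} → 1# + s * v ≈ 0# → s * v ≈ - 1#
    *≈-1 {s} {v} e = trans (solve 2 (λ s v → s :* v := (con 1ℤ :+ s :* v) :- con 1ℤ) refl s v)
      (trans (+-congʳ e) (+-identityˡ _))

    -- The two excluded values of `s` are those at which 1 + sA or 1 + sβ vanishes.
    linear-from : ∀ {s f} → S s → F f → φ f ≈ s → ¬ s ∈≈ neg-inv A ∷ neg-inv β ∷ [] →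
                  Σ (Linear (K.1# K.+ f K.* a)) λ l → Linear.f l ≡ f
    linear-from {s} {f} Ss Ff φf≈s s∉ = record
      { f = f ; Ff = Ff ; Sφf = S.resp (sym φf≈s) Ss ; x≈ = K.refl
      ; x≉0 = λ x≈0 → s∉ (here (neg-inv-unique (*≈-1 (trans (sym φx≈′) (trans (⟦⟧-cong x≈0) 0#-homo))) refl))
      ; y≉0 = λ y≈0 → s∉ (there (here (neg-inv-unique (*≈-1 (trans (+-congˡ (*-congʳ (sym φf≈s))) y≈0)) refl)))
      } , ≡.refl
      where
      φx≈′ : φ (K.1# K.+ f K.* a) ≈ 1# + s * A
      φx≈′ = trans (+-homo K.1# (f K.* a)) (+-cong 1#-homo (trans (*-homo f a) (*-congʳ φf≈s)))

    extend-linear : ∀ xs → All Linear xs →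
      ∃[ x ] Linear x × ∃[ z ] (∀ {x′} → x′ ∈ˡ xs → Fraction z x′) × (∀ m → ¬ Fraction z (x EK.^ suc m))
    extend-linear xs ls =
      let z , Tz , z≉0 , (r , Tr , z≈) , fractions = common-multiple xs ls
          s , Ss , s∉ , nondiv = linear-nondivisor S-sub S-inf S-units (φ≉0 a≉0) (neg-inv A ∷ neg-inv β ∷ []) Tz z≉0
          f , Ff , φf≈s = S⊆F Ss
          l , lf≡f = linear-from Ss Ff φf≈s s∉
      in K.1# K.+ f K.* a , l , z , fractions , λ m frac →
        let M , w , Tw , e = fraction⇒∣ l Tz Tr z≈ m frac
        in nondiv M (w , Tw , trans (*-congʳ (sym (trans (Linear.φx≈ l)
             (+-congˡ (*-congʳ (trans (reflexive (≡.cong φ lf≡f)) φf≈s)))))) e)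

-- The rank of the unit group of a field

module UnitRank (em : ∀ ℓ → ExcludedMiddle ℓ) {c ℓ : Level}
                (R : CommutativeRing c ℓ) (isField : IsField R) where
  open CommutativeRing R
  open Exp commutativeSemiring using (_^_)
  open Classical em
  open UnitChains em R isField
  private module Rˣ = AbelianGroup (R ˣ)

  Nontorsion : Pred Rˣ.Carrier ℓ
  Nontorsion u = ∀ n → ¬ value u ^ suc n ≈ 1#

  units-rank : RankZeroOrInfinite (R ˣ)
  units-rank with em _ {∃[ u ] Nontorsion u}
  ... | no ∄ = inj₁ (Rank.torsion⇒RankIs0 em (R ˣ) λ u → byContradiction λ nt →
        ∄ (u , λ n e → nt (n , trans (value-·ℕ (suc n) u) e)))
  ... | yes (u , nt) =
    let _ , S-sub , S-inf , S-units , _ = SmallSubring.small-subring em R isField {ℓ} (value u) (value≉0 u) nt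
    in inj₂ (units-rank-infinite S-sub S-inf S-units)

-- The rank of the quotient of unit groups

module ExtensionRank (em : ∀ ℓ → ExcludedMiddle ℓ) {c₁ ℓ₁ c₂ ℓ₂ : Level}
                     (F : CommutativeRing c₁ ℓ₁) (K : CommutativeRing c₂ ℓ₂) (E : FieldExtension F K) where
  open FieldExtension E
  private
    module F = CommutativeRing F
    module K = CommutativeRing K
    module Fˣ = AbelianGroup (F ˣ)
    module Kˣ = AbelianGroup (K ˣ)
    module A = AbelianGroup Kˣ/Fˣ
    module RF = UnitRank em F F-isField
    module UF = UnitChains em F F-isField
    module UK = UnitChains em K K-isField
    module FK = FieldPolynomials em K K-isField
    module PK = Polynomials K
    module EF = Exp F.commutativeSemiring
    module EK = Exp K.commutativeSemiring
    module RankA = Rank em Kˣ/Fˣ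
    module RankK = Rank em (K ˣ)
    module MK = CommutativeMonoidMult Kˣ.commutativeMonoid
    module MA = CommutativeMonoidMult A.commutativeMonoid
  open Classical em
  open RingMorphisms F.rawRing K.rawRing using (module IsRingMonomorphism)
  open IsRingMonomorphism ι-mono using (isRingHomomorphism; ⟦⟧-cong; *-homo; 1#-homo)
  private module ι = FieldHomomorphism em F F-isField K K-isField ι isRingHomomorphism

  ·-agree : ∀ n u → n MA.× u ≡ n MK.× u
  ·-agree zero    u = ≡.refl
  ·-agree (suc n) u = ≡.cong (u Kˣ.∙_) (·-agree n u)

  value-·A : ∀ n u → UK.value (n MA.× u) K.≈ UK.value u EK.^ n
  value-·A n u = K.trans (K.reflexive (≡.cong UK.value (·-agree n u))) (UK.value-·ℕ n u)

  In-F : Pred K.Carrier (c₁ ⊔ ℓ₁ ⊔ ℓ₂)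
  In-F = ι.image (SimpleExtension.everything em F F-isField)

  In-F-isSubring : PK.IsSubring In-F
  In-F-isSubring = ι.image-isSubring (SimpleExtension.everything-isSubring em F F-isField)

  In-F-unit : ∀ {x} → In-F x → ¬ x K.≈ K.0# → ∃[ u ] ι (UF.value u) K.≈ x
  In-F-unit (f , _ , e) x≉0 = UF.unit {f} (λ f≈0 → x≉0 (K.trans (K.sym e) (K.trans (⟦⟧-cong f≈0) ι-0))) , e
    where
    ι-0 : ι F.0# K.≈ K.0#
    ι-0 = IsRingMonomorphism.0#-homo ι-mono

  In-F-inverse : ∀ {x} → In-F x → ¬ x K.≈ K.0# → ∃[ y ] In-F y × y K.* x K.≈ K.1#
  In-F-inverse x∈ x≉0 =
    let u , e = In-F-unit x∈ x≉0
        v = u Fˣ.⁻¹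
    in ι (UF.value v) , (UF.value v , tt , K.refl) ,
       K.trans (K.*-congˡ (K.sym e)) (K.trans (K.sym (*-homo _ _))
         (K.trans (⟦⟧-cong (F.trans (F.*-comm _ _) (UF.value-⁻¹ u))) 1#-homo))

  NontorsionModF : Pred Kˣ.Carrier (c₁ ⊔ ℓ₁ ⊔ ℓ₂)
  NontorsionModF x = ∀ n → ¬ In-F (UK.value x EK.^ suc n)

  torsion-rank : ¬ ∃ NontorsionModF → RankIs Kˣ/Fˣ 0
  torsion-rank ∄ = RankA.torsion⇒RankIs0 λ g → byContradiction λ nt → ∄ (g , λ n g^n∈F →
    let u , e = In-F-unit g^n∈F (FK.^≉0 (suc n) (UK.value≉0 g))
    in nt (n , u , K.trans (value-·A (suc n) g) (K.trans (K.sym e) (K.sym (K.*-identityʳ _)))))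

  module TorsionBase (F-torsion : ∀ u → ∃[ m ] UF.value u EF.^ suc m F.≈ F.1#) where

    lift-generated : ∀ {ys g} → RankA.⟨ _∈ˡ ys ⟩ g → ∃[ h ] RankK.⟨ _∈ˡ ys ⟩ h × g A.≈ h
    lift-generated {ys} = RankA.⟨⟩-least
      {H = λ g → ∃[ h ] RankK.⟨ _∈ˡ ys ⟩ h × g A.≈ h}
      (record
        { resp = λ { {x} {y} x≈y (h , h∈ , e) → h , h∈ , A.trans {y} {x} {h} (A.sym {x} {y} x≈y) e }
        ; ε∈   = Kˣ.ε , RankK.ε∈ , A.refl {A.ε}
        ; ∙∈   = λ { {x} {y} (h , h∈ , e) (h′ , h′∈ , e′) → h Kˣ.∙ h′ , RankK.∙∈ h∈ h′∈ , A.∙-cong {x} {h} {y} {h′} e e′ }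
        ; ⁻¹∈  = λ { {x} (h , h∈ , e) → h Kˣ.⁻¹ , RankK.⁻¹∈ h∈ , A.⁻¹-cong {x} {h} e }
        })
      (λ {x} x∈ → x , RankK.gen x∈ , A.refl {x})

    -- A relation modulo Fˣ has some `f` on its right-hand side. Raising it to the order of `f`
    -- makes it a relation in Kˣ, with the exponent of `y` still positive.
    descend : ∀ {ys y} → RankA.Clˡ ys y → RankK.Clˡ ys y
    descend {ys} {y} (m , y^m∈) =
      let h , h∈ , f , e = lift-generated y^m∈
          k , f^k≈1 = F-torsion f
      in RankK.Cl-root m (k , RankK.resp (h^k≈ m h f k e f^k≈1) (RankK.IsSubgroup.·ℕ∈ (RankK.⟨⟩-isSubgroup _) (suc k) h∈))
      where
      open SetoidReasoning K.setoid
      h^k≈ : ∀ m h f k → UK.value (suc m MA.× y) K.≈ ι (UF.value f) K.* UK.value h → UF.value f EF.^ suc k F.≈ F.1# →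
             UK.value (suc k MK.× h) K.≈ UK.value (suc k MK.× (suc m MK.× y))
      h^k≈ m h f k e f^k≈1 = begin
        UK.value (suc k MK.× h)                                     ≈⟨ UK.value-·ℕ (suc k) h ⟩
        UK.value h EK.^ suc k                                       ≈⟨ K.*-identityˡ _ ⟨
        K.1# K.* UK.value h EK.^ suc k
          ≈⟨ K.*-congʳ (K.trans (⟦⟧-cong f^k≈1) 1#-homo) ⟨
        ι (UF.value f EF.^ suc k) K.* UK.value h EK.^ suc k         ≈⟨ K.*-congʳ (ι.φ-^ _ (suc k)) ⟩
        ι (UF.value f) EK.^ suc k K.* UK.value h EK.^ suc k         ≈⟨ EK.^-distrib-* _ _ (suc k) ⟨
        (ι (UF.value f) K.* UK.value h) EK.^ suc k                  ≈⟨ EK.^-congˡ (suc k) e ⟨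
        UK.value (suc m MA.× y) EK.^ suc k
          ≈⟨ EK.^-congˡ (suc k) (K.reflexive (≡.cong UK.value (·-agree (suc m) y))) ⟩
        UK.value (suc m MK.× y) EK.^ suc k                          ≈⟨ UK.value-·ℕ (suc k) (suc m MK.× y) ⟨
        UK.value (suc k MK.× (suc m MK.× y))                        ∎

    independent : ∀ {q} {S : Pred K.Carrier q} → PK.IsSubring S → FK.Infinite S →
                  Nondivisors.FiniteUnits em K K-isField S → RankInfinite Kˣ/Fˣ
    independent {S = S} S-sub S-inf S-units = RankA.extend⇒infinite (S ∘ UK.value) λ ys Sys →
      let y , Sy , y∉ = UK.extend-units S-sub S-inf S-units ys Sys
      in y , Sy , λ y∈ → y∉ (descend {ys} {y} y∈)

    infinite : ∃ NontorsionModF → RankInfinite Kˣ/Fˣ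
    infinite (x , x∉) =
      let _ , S-sub , S-inf , S-units , _ = SmallSubring.small-subring em K K-isField {ℓ₂} (UK.value x) (UK.value≉0 x)
            (λ n e → x∉ n (F.1# , tt , K.trans 1#-homo (K.sym e)))
      in independent S-sub S-inf S-units

  module NontorsionBase (t : Fˣ.Carrier) (t-nontorsion : RF.Nontorsion t) where
    private
      module SE = SimpleExtension em K K-isField
      module SP = SeparatingPolynomial em K K-isField In-F In-F-isSubring In-F-inverse
      τ = ι (UF.value t)

    τ≉0 : ¬ τ K.≈ K.0#
    τ≉0 = ι.φ≉0 (UF.value≉0 t)

    τ-nontorsion : ∀ n → ¬ τ EK.^ suc n K.≈ K.1#
    τ-nontorsion = ι.φ-nontorsion t-nontorsion

    K-infinite : FK.Infinite SE.everything
    K-infinite = let _ , _ , (f , inj , _) , _ = SmallSubring.small-subring em K K-isField {ℓ₂} τ τ≉0 τ-nontorsion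
                 in f , inj , λ _ → tt

    module Separated (a : K.Carrier) (a≉0 : ¬ a K.≈ K.0#) (r : List K.Carrier) (r-nonconst : ¬ SE.Constant r)
                     (ra≉0 : ¬ PK.ev r a K.≈ K.0#) (r∣ : ∀ g → All In-F g → PK.ev g a K.≈ K.0# → r SE.∣ᵖ g)
                     (extension : SE.Extension K-infinite r r-nonconst) where
      open SE.Extension extension
      private
        module L = CommutativeRing L
        module PL = Polynomials L
        module φ = FieldHomomorphism em K K-isField L L-isField φ φ-hom

      β-root′ : φ.evφ r β L.≈ L.0#
      β-root′ = β-root r (K.1# ∷ [] , λ x → K.sym (K.trans (K.*-congˡ (PK.ev-const K.1# x)) (K.*-identityʳ _)))

      φa≉β : ¬ φ a L.≈ β
      φa≉β e = φ.φ≉0 ra≉0 (L.trans (L.sym (φ.evφ-φ r a)) (L.trans (PL.ev-cong (map φ r) e) β-root′))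

      private
        module CI = ConjugateIndependence em K K-isField L L-isField φ φ-hom In-F-isSubring a a≉0 β φa≉β
                      (λ g Fg e → β-root g (r∣ g Fg e))

      infinite : RankInfinite Kˣ/Fˣ
      infinite =
        -- Starting from the image of `t` keeps the small subring of `L` inside the image of `F`,
        -- where conjugation is trivial.
        let S , S-sub , S-inf , S-units , S-least = SmallSubring.small-subring em L L-isField (φ τ) (φ.φ≉0 τ≉0) (φ.φ-nontorsion τ-nontorsion)
        in step S-sub S-inf S-units λ Ss → S-least (φ.image In-F) (φ.image-isSubring In-F-isSubring)
             (τ , (UF.value t , tt , K.refl) , L.refl) Ss
        where
        module _ {q} {S : Pred L.Carrier q} (S-sub : PL.IsSubring S) (S-inf : FieldPolynomials.Infinite em L L-isField S)
                 (S-units : Nondivisors.FiniteUnits em L L-isField S) (S⊆F : ∀ {s} → S s → φ.image In-F s) where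

          Linear : K.Carrier → Set _
          Linear = CI.Linear S-sub S-inf S-units S⊆F

          Fraction : L.Carrier → K.Carrier → Set _
          Fraction = CI.Fraction S-sub S-inf S-units S⊆F

          fraction-isSubgroup : ∀ z → RankA.IsSubgroup (Fraction z ∘ UK.value)
          fraction-isSubgroup z = record
            { resp = λ { {x} {y} (u , e) p → CI.fraction-scale S-sub S-inf S-units S⊆F
                          (UF.value u , tt , K.refl) (ι.φ≉0 (UF.value≉0 u)) e p }
            ; ε∈   = CI.fraction-1 S-sub S-inf S-units S⊆F
            ; ∙∈   = CI.fraction-* S-sub S-inf S-units S⊆F
            ; ⁻¹∈  = λ {u} → CI.fraction-⁻¹ S-sub S-inf S-units S⊆F (UK.value-⁻¹ u)
            }

          step : RankInfinite Kˣ/Fˣ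
          step = RankA.extend⇒infinite (Linear ∘ UK.value) λ ys ls →
            let x , l , z , fractions , not-fraction = CI.extend-linear S-sub S-inf S-units S⊆F (map UK.value ys) (All-map⁺ ls)
                y = UK.unit {x} (CI.Linear.x≉0 l)
            in y , l , λ { (m , p) → not-fraction m (CI.fraction-scale S-sub S-inf S-units S⊆F
                 (PK.IsSubring.1∈ In-F-isSubring) FK.1≉0
                 (K.trans (value-·A (suc m) y) (K.sym (K.*-identityˡ _)))
                 (RankA.⟨⟩-least (fraction-isSubgroup z) (λ y′∈ → fractions (∈-map⁺ UK.value y′∈)) p)) }

    infinite : ∃ NontorsionModF → RankInfinite Kˣ/Fˣ
    infinite (x , x∉) =
      let a , a≉0 , r , r-nonconst , ra≉0 , r∣ = SP.separating (UK.value x) (UK.value≉0 x) x∉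
      in Separated.infinite a a≉0 r r-nonconst ra≉0 r∣ (SE.adjoin-root K-infinite r r-nonconst)

  extension-rank : RankZeroOrInfinite Kˣ/Fˣ
  extension-rank with em _ {∃ NontorsionModF} | em _ {∃ RF.Nontorsion}
  ... | no ∄  | _ = inj₁ (torsion-rank ∄)
  ... | yes x | yes (t , nt) = inj₂ (NontorsionBase.infinite t nt x)
  ... | yes x | no ∄ = inj₂ (TorsionBase.infinite
          (λ u → byContradiction λ nt → ∄ (u , λ n e → nt (n , e))) x)

theorem4p1 : (∀ ℓ → ExcludedMiddle ℓ) →
    ∀ {c₁ ℓ₁ c₂ ℓ₂} (F : CommutativeRing c₁ ℓ₁) (K : CommutativeRing c₂ ℓ₂)
    (E : FieldExtension F K) →
    RankZeroOrInfinite (F ˣ) × RankZeroOrInfinite (FieldExtension.Kˣ/Fˣ E)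
theorem4p1 em F K E =
  UnitRank.units-rank em F (FieldExtension.F-isField E) , ExtensionRank.extension-rank em F K E
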